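{- Let $\mathcal{G}$ be a graph on $n$ vertices whose adjacency matrix $A$ has spectrum $\lambda_1,\lambda_2,\ldots,\lambda_n$ (eigenvalues listed with multiplicity), and let $k\in\mathbb{N}$. Then the spectrum of $\mathcal{G}^{\odot k}$ consists of the $\binom{n+k-1}{k}$ products $\lambda_{i_1}\lambda_{i_2}\cdots\lambda_{i_k}$ with $1\le i_1\le i_2\le\cdots\le i_k\le n$ (as a multiset); these are all of the eigenvalues of the adjacency matrix $A^{\odot k}$ of $\mathcal{G}^{\odot k}$.
   Context: $\mathbb{N}=\{1,2,\ldots\}$ and $[n]=\{1,\ldots,n\}$. The symmetric group $\mathfrak{S}_k$ acts on $[n]^k$ by permuting coordinates; $\operatorname{Orb}(\mathbf{i})$ is the orbit of $\mathbf{i}$ (the set of its distinct rearrangements). For $\mathbf{i}\in[n]^k$, $\mathbf{m}(\mathbf{i})=(m_1,\ldots,m_n)$ where $m_\ell$ is the number of occurrences of $\ell$ in $\mathbf{i}$, and $\binom{k}{\mathbf{m}(\mathbf{i})}=\frac{k!}{m_1!\cdots m_n!}$. Graphs are finite and undirected, loops are allowed, and edges may carry real weights ($\omega(v_p,v_q)=\omega(v_q,v_p)$, nonexistent edges have weight $0$; an unweighted graph has weights in $\{0,1\}$). The adjacency matrix is $[A]_{p,q}=\omega(v_p,v_q)$. For a graph $\mathcal{G}$ with vertices $v_1,\ldots,v_n$, the symmetric tensor power $\mathcal{G}^{\odot k}$ is the weighted graph whose vertices are the $\binom{n+k-1}{k}$ nondecreasing elements of $[n]^k$, with edge weights $$\omega^{\odot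 k}(\mathbf{i},\mathbf{j})=\frac{1}{\sqrt{\binom{k}{\mathbf{m}(\mathbf{i})}\binom{k}{\mathbf{m}(\mathbf{j})}}}\sum_{\mathbf{p}\in\operatorname{Orb}(\mathbf{i}),\ \mathbf{q}\in\operatorname{Orb}(\mathbf{j})}\ \prod_{\ell=1}^k\omega(v_{p_\ell},v_{q_\ell}).$$ Its adjacency matrix is denoted $A^{\odot k}$. The spectrum of a graph is the multiset of eigenvalues of its adjacency matrix. -}

module Defs where

open import Algebra.Bundles using (CommutativeRing; Semiring)
import Algebra.Definitions.RawSemiring as RawSemiringDefinitions
import Algebra.Properties.CommutativeMonoid.Sum as Sum
open import Data.Fin.Base as Fin using (Fin; zero; suc; toℕ; punchIn)
import Data.Fin.Properties as Fin
open import Data.List.Base as List using (List; []; _∷_; length; filter; deduplicate; allFin; cartesianProductWith)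
open import Data.List.Relation.Unary.All.Properties using (tabulate⁺)
open import Data.Nat.Base as ℕ using (ℕ; zero; suc; NonZero; _!)
import Data.Nat.DivMod as ℕ
open import Data.Nat.ListAction using (product)
open import Data.Nat.ListAction.Properties using (product≢0)
import Data.Nat.Properties as ℕ
open import Data.Product.Base using (Σ; ∃; _×_; _,_)
open import Data.Sum.Base using (_⊎_)
open import Data.Vec.Base as Vec using (Vec; lookup; count)
open import Data.Vec.Functional using (Vector)
open import Data.Vec.Properties using (≡-dec)
open import Data.Vec.Relation.Unary.AllPairs using (allPairs?)
open import Data.Vec.Relation.Unary.Linked using (Linked; linked?)
open import Data.Vec.Relation.Unary.Unique.Propositional using (Unique)
open import Level using (_⊔_; 0ℓ) renaming (suc to lsuc)
open import Relation.Binary.Core using (Rel)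
open import Relation.Binary.PropositionalEquality.Core as ≡ using ()
open import Relation.Binary.Structures using (IsStrictTotalOrder)
open import Relation.Nullary.Decidable using (yes; no; ¬?)
open import Relation.Nullary.Negation using (¬_)
open import Relation.Unary using (Pred)

-- The classical real numbers, axiomatised up to isomorphism as a (Dedekind-)complete
-- ordered field.  Trichotomy is decidable, as it is classically.
-- `_⁻¹` is unspecified at 0 and `√` at negative numbers; on the nonnegative numbers
-- `√` is uniquely determined, and its existence follows from `supremum`.
record CompleteOrderedField c ℓ₁ ℓ₂ : Set (lsuc (c ⊔ ℓ₁ ⊔ ℓ₂)) where
  field
    commutativeRing : CommutativeRing c ℓ₁

  open CommutativeRing commutativeRing public

  infix  4 _<_ _≤_
  infix  8 _⁻¹

  field
    _⁻¹        : Carrier → Carrier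
    0≉1        : ¬ (0# ≈ 1#)
    ⁻¹-inverse : ∀ {x} → ¬ (x ≈ 0#) → x * x ⁻¹ ≈ 1#

    _<_                : Rel Carrier ℓ₂
    isStrictTotalOrder : IsStrictTotalOrder _≈_ _<_
    +-monoˡ-<          : ∀ z {x y} → x < y → x + z < y + z
    *-pos              : ∀ {x y} → 0# < x → 0# < y → 0# < x * y

  _≤_ : Rel Carrier (ℓ₁ ⊔ ℓ₂)
  x ≤ y = x < y ⊎ x ≈ y

  UpperBound : Pred Carrier (c ⊔ ℓ₁ ⊔ ℓ₂) → Pred Carrier (c ⊔ ℓ₁ ⊔ ℓ₂)
  UpperBound P b = ∀ x → P x → x ≤ b

  field
    supremum : ∀ P → ∃ P → ∃ (UpperBound P) →
               ∃ λ s → UpperBound P s × (∀ b → UpperBound P b → s ≤ b)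

    √        : Carrier → Carrier
    √-nonneg : ∀ {x} → 0# ≤ x → 0# ≤ √ x
    √-square : ∀ {x} → 0# ≤ x → √ x * √ x ≈ x

------------------------------------------------------------------------
-- [n]^k, with Fin n standing for [n]

Tuple : ℕ → ℕ → Set
Tuple n k = Vec (Fin n) k

-- All of [n]^k, each tuple once, in lexicographic order.
tuples : ∀ n k → List (Tuple n k)
tuples n zero    = Vec.[] ∷ []
tuples n (suc k) = cartesianProductWith Vec._∷_ (allFin n) (tuples n k)

Nondecreasing : ∀ {n k} → Pred (Tuple n k) 0ℓ
Nondecreasing = Linked Fin._≤_

vertices : ∀ n k → List (Tuple n k)
vertices n k = filter (linked? Fin._≤?_) (tuples n k)

order : ℕ → ℕ → ℕ
order n k = length (vertices n k)

vertex : ∀ n k → Fin (order n k) → Tuple n k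
vertex n k = List.lookup (vertices n k)

-- A permutation σ of [k] is written in one-line notation (σ(1), …, σ(k)).
permutations : ∀ k → List (Tuple k k)
permutations k = filter {P = Unique} (allPairs? λ a b → ¬? (a Fin.≟ b)) (tuples k k)

infixr 7 _·_

-- The entry of σ · i at position l is the entry of i at position σ(l).
_·_ : ∀ {n k} → Tuple k k → Tuple n k → Tuple n k
σ · i = Vec.map (lookup i) σ

-- Orb(i), listed without repetition.
Orb : ∀ {n k} → Tuple n k → List (Tuple n k)
Orb {k = k} i = deduplicate (≡-dec Fin._≟_) (List.map (_· i) (permutations k))

occurrences : ∀ {n k} → Tuple n k → Fin n → ℕ
occurrences i ℓ = count (Fin._≟ ℓ) i

-- The division is exact.
multinomial : ∀ {n k} → Tuple n k → ℕ
multinomial {n} {k} i = (k !) ℕ./ product factors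
  where
  factors : List ℕ
  factors = List.tabulate λ ℓ → occurrences i ℓ !

  instance
    product≢0′ : NonZero (product factors)
    product≢0′ = product≢0 (tabulate⁺ λ ℓ → occurrences i ℓ ℕ.!≢0)

------------------------------------------------------------------------

module OverReals {c ℓ₁ ℓ₂} (ℝ : CompleteOrderedField c ℓ₁ ℓ₂) where

  open CompleteOrderedField ℝ hiding (zero; Carrier; _≈_)
  open CompleteOrderedField ℝ public using (Carrier; _≈_)
  open RawSemiringDefinitions (Semiring.rawSemiring semiring) using (_^_) renaming (_×_ to _×ₙ_)
  open Sum +-commutativeMonoid public using (sum-syntax)
  open Sum +-commutativeMonoid using (sum-cong-≋; ∑-comm)
  private module Product = Sum *-commutativeMonoid

  infixl 10 product-syntax

  product-syntax : ∀ n → Vector Carrier n → Carrier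
  product-syntax _ = Product.sum

  syntax product-syntax n (λ i → x) = ∏[ i < n ] x

  fromℕ : ℕ → Carrier
  fromℕ n = n ×ₙ 1#

  -- Sum over the entries of a list.
  ∑ₗ : ∀ {a} {A : Set a} → List A → (A → Carrier) → Carrier
  ∑ₗ xs f = ∑[ a < length xs ] f (List.lookup xs a)

  ∑ₗ-cong : ∀ {a} {A : Set a} (xs : List A) {f g : A → Carrier} →
            (∀ x → f x ≈ g x) → ∑ₗ xs f ≈ ∑ₗ xs g
  ∑ₗ-cong xs f≈g = sum-cong-≋ {length xs} λ a → f≈g (List.lookup xs a)

  Matrix : ℕ → Set c
  Matrix n = Fin n → Fin n → Carrier

  -- Laplace expansion along the first row.
  det : ∀ {n} → Matrix n → Carrier
  det {zero}  M = 1#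
  det {suc n} M = ∑[ j < suc n ]
    ((- 1#) ^ toℕ j * M zero j * det (λ p q → M (suc p) (punchIn j q)))

  scalar : ∀ {n} → Carrier → Matrix n
  scalar x p q with p Fin.≟ q
  ... | yes _ = x
  ... | no  _ = 0#

  -- det (x I − A).  A real polynomial is determined by its values, so it is
  -- treated as a function of x.
  charPoly : ∀ {n} → Matrix n → Carrier → Carrier
  charPoly A x = det (λ p q → scalar x p q - A p q)

  -- The multiset {λ₁, …, λₙ} is the multiset of eigenvalues of A, counted with
  -- (algebraic) multiplicity.
  IsSpectrum : ∀ {n} → Matrix n → Vector Carrier n → Set (c ⊔ ℓ₁)
  IsSpectrum {n} A λs = ∀ x → charPoly A x ≈ ∏[ a < n ] (x - λs a)

  IsEigenvalue : ∀ {n} → Matrix n → Carrier → Set (c ⊔ ℓ₁)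
  IsEigenvalue {n} A μ = Σ (Vector Carrier n) λ v →
    ¬ (∀ p → v p ≈ 0#) × (∀ p → ∑[ q < n ] (A p q * v q) ≈ μ * v p)

  -- A finite undirected graph with loops allowed; a missing edge has weight 0,
  -- so the graph is its weight function.
  record Graph (n : ℕ) : Set (c ⊔ ℓ₁) where
    field
      ω     : Fin n → Fin n → Carrier
      ω-sym : ∀ p q → ω p q ≈ ω q p

  open Graph public

  adjacency : ∀ {n} → Graph n → Matrix n
  adjacency G p q = ω G p q

  module _ {n} (G : Graph n) where

    tensorWeight : ∀ {k} → Tuple n k → Tuple n k → Carrier
    tensorWeight {k} i j =
      (√ (fromℕ (multinomial i ℕ.* multinomial j))) ⁻¹ *
      ∑ₗ (Orb i) λ p → ∑ₗ (Orb j) λ q → ∏[ l < k ] ω G (lookup p l) (lookup q l)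

    tensorWeight-sym : ∀ {k} (i j : Tuple n k) → tensorWeight i j ≈ tensorWeight j i
    tensorWeight-sym {k} i j = *-cong
      (reflexive (≡.cong (λ m → (√ (fromℕ m)) ⁻¹) (ℕ.*-comm (multinomial i) (multinomial j))))
      (trans (∑-comm λ a b → weight (List.lookup (Orb i) a) (List.lookup (Orb j) b))
        (∑ₗ-cong (Orb j) λ q → ∑ₗ-cong (Orb i) λ p → Product.sum-cong-≋ {k} λ l →
          ω-sym G (lookup p l) (lookup q l)))
      where
      weight : Tuple n k → Tuple n k → Carrier
      weight p q = ∏[ l < k ] ω G (lookup p l) (lookup q l)

  infixl 7 _⊙_

  -- The symmetric tensor power; its vertices are the nondecreasing tuples
  -- `vertex n k a`, for a : Fin (order n k).
  _⊙_ : ∀ {n} → Graph n → (k : ℕ) → Graph (order n k)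
  _⊙_ {n} G k = record
    { ω     = λ a b → tensorWeight G (vertex n k a) (vertex n k b)
    ; ω-sym = λ a b → tensorWeight-sym G (vertex n k a) (vertex n k b)
    }

  tupleProduct : ∀ {n k} → Vector Carrier n → Tuple n k → Carrier
  tupleProduct {k = k} λs i = ∏[ l < k ] λs (lookup i l)

{-# OPTIONS --safe #-}
-- Since the characteristic polynomial of A splits, A is similar to a lower triangular matrix T
-- whose diagonal is λ₁, …, λₙ: a root of it yields a left eigenvector, which is completed to a basis,
-- and the remaining block is treated recursively.  Up to conjugation by the diagonal matrix of the
-- √ |Orb(i)|, the matrix of the symmetric tensor power is S(A), where
--   S(A)ᵢⱼ = Σ_{q ∈ Orb(j)} ∏ₗ A(iₗ, qₗ).
-- S is multiplicative, so S(A) is similar to S(T), and S(T) is lower triangular for the lexicographic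
-- order on nondecreasing tuples, with the products λ_{i₁} ⋯ λ_{iₖ} on its diagonal.
module Submission where

open import Defs
open import Algebra.Bundles using (CommutativeRing; CommutativeSemiring; RawRing; Semiring)
import Algebra.Definitions.RawSemiring as RawSemiringDefinitions
import Algebra.Properties.CommutativeMonoid.Sum as CommutativeMonoidSum
import Algebra.Properties.Ring as RingProperties
import Algebra.Properties.Semiring.Mult as SemiringMult
import Algebra.Properties.Semiring.Sum as SemiringSum
import Algebra.Solver.Ring as RingSolver
open import Algebra.Solver.Ring.AlmostCommutativeRing as ACR using (_-Raw-AlmostCommutative⟶_)
open import Data.Bool.Base using (true; false; if_then_else_)
open import Data.Empty using (⊥)
open import Data.Fin.Base as Fin using (Fin; zero; suc; toℕ; fromℕ<; inject₁; punchIn; punchOut)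
open import Data.Fin.Induction using (<-weakInduction-startingFrom)
import Data.Fin.Properties as Fin
open import Data.List.Base as List using (List; []; _∷_; filter; allFin; cartesianProductWith)
open import Data.List.Membership.Propositional using () renaming (_∈_ to _∈ₗ_)
import Data.List.Membership.Propositional.Properties as ∈ₗ
open import Data.List.Membership.Propositional.Properties.WithK using (unique∧set⇒bag)
import Data.List.Properties as List
open import Data.List.Relation.Binary.BagAndSetEquality using (∼bag⇒↭)
import Data.List.Relation.Binary.Permutation.Propositional as ↭ₗ
import Data.List.Relation.Binary.Permutation.Propositional.Properties as ↭ₗ
open import Data.List.Relation.Unary.All as Allₗ using ([]; _∷_) renaming (All to Allₗ)
import Data.List.Relation.Unary.All.Properties as Allₗ
open import Data.List.Relation.Unary.AllPairs as AllPairsₗ using ([]; _∷_) renaming (AllPairs to AllPairsₗ)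
import Data.List.Relation.Unary.AllPairs.Properties as AllPairsₗ
open import Data.List.Relation.Unary.Any as Anyₗ using (here; there)
import Data.List.Relation.Unary.Any.Properties as Anyₗ
import Data.List.Relation.Unary.Unique.DecPropositional.Properties as DecUniqueₗ
open import Data.List.Relation.Unary.Unique.Propositional using () renaming (Unique to Uniqueₗ)
import Data.List.Relation.Unary.Unique.Propositional.Properties as Uniqueₗ
open import Data.Maybe.Base using (Maybe; nothing; just)
open import Data.Nat.Base as ℕ using (ℕ; zero; suc; z≤n; s≤s; _!; NonZero)
import Data.Nat.DivMod as ℕ
open import Data.Nat.ListAction using (product)
open import Data.Nat.ListAction.Properties using (product≢0)
import Data.Nat.Properties as ℕ
open import Data.Product.Base using (Σ; ∃; _×_; _,_; proj₁; proj₂; map₂)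
open import Data.Sum.Base using (_⊎_; inj₁; inj₂; [_,_]′)
open import Data.Vec.Base as Vec using (Vec; []; _∷_; lookup; removeAt; count)
open import Data.Vec.Functional using (Vector; insertAt; updateAt) renaming (_∷_ to _◂_)
open import Data.Vec.Functional.Properties using (insertAt-lookup; insertAt-punchIn; updateAt-updates; updateAt-minimal)
import Data.Vec.Properties as Vec
open import Data.Vec.Relation.Binary.Lex.Core using (Lex; this; next)
open import Data.Vec.Relation.Unary.All as All using (All; []; _∷_)
import Data.Vec.Relation.Unary.All.Properties as All
open import Data.Vec.Relation.Unary.AllPairs as AllPairs using ([]; _∷_; allPairs?)
open import Data.Vec.Relation.Unary.Linked as Linked using ([]; [-]; _∷_; linked?)
import Data.Vec.Relation.Unary.Linked.Properties as Linked
open import Data.Vec.Relation.Unary.Unique.Propositional using (Unique)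
import Data.Vec.Relation.Unary.Unique.Propositional.Properties as Unique
open import Function.Base using (_∘_; const)
open import Function.Bundles using (_⇔_; mk⇔)
open import Level using (_⊔_; 0ℓ)
open import Relation.Binary.Definitions using (tri<; tri≈; tri>; Decidable)
open import Relation.Binary.PropositionalEquality as ≡ using (_≡_; _≢_)
open import Relation.Binary.Structures using (IsStrictTotalOrder)
open import Relation.Nullary.Decidable using (Dec; yes; no; ¬?; does; map′; decidable-stable)
open import Relation.Nullary.Negation using (¬_; contradiction)
open import Relation.Unary using (Pred) renaming (Decidable to Decidable₁)
open import Tactic.RingSolver.Core.AlmostCommutativeRing using (fromCommutativeRing)
import Tactic.RingSolver.NonReflective as NonReflective

-- A triangular form is sought because it follows by elimination from the splitting of the
-- characteristic function alone and shows the multiplicities on its diagonal. Two obstacles shape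
-- the linear algebra. `det` is a Laplace expansion, so multiplicativity has to be earned:
-- alternating functions of the columns are compared by column elimination, without sums over
-- permutations. And `charPoly` is a function of `x`, so a factor `x - λ₁` cancels only away from
-- `λ₁`; the missing value is recovered because a polynomial function vanishing off a finite list
-- vanishes everywhere. S(A) is the matrix of the k-th Kronecker power of A on symmetric tensors, in
-- the basis of orbit sums. It is multiplicative because its rows depend on the orbit of the row
-- index only. The square roots arise from the double orbit sum in the weights, in which all
-- |Orb(i)| inner sums are equal. Triangularity of S(T) rests on a counting argument: a
-- rearrangement of a later vertex must exceed the earlier vertex at some position, where T has a
-- zero. Symmetry of the weights enters when left eigenvectors are turned into eigenvectors.

-- A ring solver with integer coefficients.

module IntegerSolver {c ℓ} (R : CommutativeRing c ℓ) where
  open CommutativeRing R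
  open SemiringMult semiring using (×-homo-+; ×1-homo-*) renaming (_×_ to _×ₙ_)
  open import Relation.Binary.Reasoning.Setoid setoid
  open RingProperties ring using (-‿involutive; ⁻¹-anti-homo‿-; -‿distribˡ-*; -‿distribʳ-*; -‿+-comm; -0#≈0#)
  private module S = NonReflective (fromCommutativeRing R (λ _ → nothing))

  -- Integers as formal differences of natural numbers: unlike the elements of an abstract
  -- ring they can be compared, so that the solver recognises cancelling coefficients.
  differences : RawRing 0ℓ 0ℓ
  differences = record
    { Carrier = ℕ × ℕ
    ; _≈_     = _≡_
    ; _+_     = λ (a , b) (x , y) → a ℕ.+ x , b ℕ.+ y
    ; _*_     = λ (a , b) (x , y) → a ℕ.* x ℕ.+ b ℕ.* y , a ℕ.* y ℕ.+ b ℕ.* x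
    ; -_      = λ (a , b) → b , a
    ; 0#      = 0 , 0
    ; 1#      = 1 , 0
    }

  infix 9 ι_
  ι_ : ℕ → Carrier
  ι n = n ×ₙ 1#

  ι-*+* : ∀ a x b y → ι (a ℕ.* x ℕ.+ b ℕ.* y) ≈ ι a * ι x + ι b * ι y
  ι-*+* a x b y = trans (×-homo-+ 1# (a ℕ.* x) (b ℕ.* y)) (+-cong (×1-homo-* a x) (×1-homo-* b y))

  difference-morphism : differences -Raw-AlmostCommutative⟶ ACR.fromCommutativeRing R
  difference-morphism = record
    { ⟦_⟧    = λ (a , b) → ι a + - ι b
    ; +-homo = λ (a , b) (x , y) → trans
        (+-cong (×-homo-+ 1# a x) (-‿cong (×-homo-+ 1# b y)))
        (S.solve 4 (λ a b x y → (a S.⊕ x S.⊕ (S.⊝ (b S.⊕ y))) S.⊜ ((a S.⊕ (S.⊝ b)) S.⊕ (x S.⊕ (S.⊝ y)))) refl (ι a) (ι b) (ι x) (ι y))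
    ; *-homo = λ (a , b) (x , y) → trans
        (+-cong (ι-*+* a x b y) (-‿cong (ι-*+* a y b x)))
        (sym (trans (S.solve 4 (λ a b x y → ((a S.⊕ b) S.⊗ (x S.⊕ y)) S.⊜ (a S.⊗ x S.⊕ b S.⊗ y S.⊕ (a S.⊗ y S.⊕ b S.⊗ x))) refl (ι a) (- ι b) (ι x) (- ι y))
          (+-cong (+-congˡ (trans (sym (-‿distribˡ-* (ι b) (- ι y))) (trans (-‿cong (sym (-‿distribʳ-* (ι b) (ι y)))) (-‿involutive (ι b * ι y)))))
            (trans (+-cong (sym (-‿distribʳ-* (ι a) (ι y))) (sym (-‿distribˡ-* (ι b) (ι x)))) (-‿+-comm (ι a * ι y) (ι b * ι x))))))
    ; -‿homo = λ (a , b) → sym (⁻¹-anti-homo‿- (ι a) (ι b))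
    ; 0-homo = -‿inverseʳ 0#
    ; 1-homo = trans (+-congʳ (+-identityʳ 1#)) (trans (+-congˡ (-0#≈0#)) (+-identityʳ 1#))
    }

  open _-Raw-AlmostCommutative⟶_ difference-morphism using (⟦_⟧)

  -- The test `a + y = x + b` is made on naturals and carried to the ring by adding and cancelling
  -- `ι y` and `ι b`. A failed test decides nothing, since unequal integers may agree in the ring.
  _≟_ : ∀ x y → Maybe (⟦ x ⟧ ≈ ⟦ y ⟧)
  (a , b) ≟ (x , y) with a ℕ.+ y ℕ.≟ x ℕ.+ b
  ... | no  _  = nothing
  ... | yes eq = just (begin
    ι a - ι b                    ≈⟨ shift (ι a) (ι y) (ι b) ⟨
    ι a + ι y - ι y - ι b        ≈⟨ +-congʳ (+-congʳ (×-homo-+ 1# a y)) ⟨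
    ι (a ℕ.+ y) - ι y - ι b      ≡⟨ ≡.cong (λ n → ι n - ι y - ι b) eq ⟩
    ι (x ℕ.+ b) - ι y - ι b      ≈⟨ +-congʳ (+-congʳ (×-homo-+ 1# x b)) ⟩
    ι x + ι b - ι y - ι b        ≈⟨ trans (+-assoc _ _ _) (trans (+-congˡ (+-comm _ _)) (sym (+-assoc _ _ _))) ⟩
    ι x + ι b - ι b - ι y        ≈⟨ shift (ι x) (ι b) (ι y) ⟩
    ι x - ι y                    ∎)
    where
    shift : ∀ p q r → p + q - q - r ≈ p - r
    shift p q r = +-congʳ (trans (+-assoc p q (- q)) (trans (+-congˡ (-‿inverseʳ q)) (+-identityʳ p)))

  open RingSolver differences (ACR.fromCommutativeRing R) difference-morphism _≟_ public
    using (solve; _:=_; _:+_; _:*_; :-_; _:-_)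

  [x+y]*[x-y]≈x*x-y*y : ∀ x y → (x + y) * (x - y) ≈ x * x - y * y
  [x+y]*[x-y]≈x*x-y*y = solve 2 (λ x y → (x :+ y) :* (x :- y) := x :* x :- y :* y) refl

-- Rearrangements of tuples and their occurrence counts.

module Rearrangements where
  open import Data.Nat.Base using (_+_)
  open import Data.Nat.Combinatorics using (_C_; nCk+nC[k+1]≡[n+1]C[k+1]; k>n⇒nCk≡0)
  open import Relation.Binary.PropositionalEquality using (refl; sym; trans; cong; subst)

  infix 3 _↭_
  -- Generated by exchanging the first two entries below a common prefix, so that invariance of a
  -- quantity only has to be checked on a single exchange.
  data _↭_ {a} {A : Set a} : ∀ {k} → Vec A k → Vec A k → Set a where
    ↭-refl  : ∀ {k} {xs : Vec A k} → xs ↭ xs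
    ↭-prep  : ∀ {k} x {xs ys : Vec A k} → xs ↭ ys → x ∷ xs ↭ x ∷ ys
    ↭-swap  : ∀ {k} x y {xs : Vec A k} → x ∷ y ∷ xs ↭ y ∷ x ∷ xs
    ↭-trans : ∀ {k} {xs ys zs : Vec A k} → xs ↭ ys → ys ↭ zs → xs ↭ zs

  module _ {a} {A : Set a} where

    ↭-sym : ∀ {k} {xs ys : Vec A k} → xs ↭ ys → ys ↭ xs
    ↭-sym ↭-refl          = ↭-refl
    ↭-sym (↭-prep x p)    = ↭-prep x (↭-sym p)
    ↭-sym (↭-swap x y)    = ↭-swap y x
    ↭-sym (↭-trans p q)   = ↭-trans (↭-sym q) (↭-sym p)

    lookup∷removeAt-↭ : ∀ {k} (xs : Vec A (suc k)) t → lookup xs t ∷ removeAt xs t ↭ xs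
    lookup∷removeAt-↭ (x ∷ xs)     zero    = ↭-refl
    lookup∷removeAt-↭ (x ∷ y ∷ xs) (suc t) = ↭-trans (↭-swap _ x) (↭-prep x (lookup∷removeAt-↭ (y ∷ xs) t))

    count-↭ : ∀ {p} {P : Pred A p} (P? : Decidable₁ P) {k} {xs ys : Vec A k} → xs ↭ ys → count P? xs ≡ count P? ys
    count-↭ P? ↭-refl         = refl
    count-↭ P? (↭-prep x p) with does (P? x)
    ... | true  = cong suc (count-↭ P? p)
    ... | false = count-↭ P? p
    count-↭ P? (↭-swap x y) with does (P? x) | does (P? y)
    ... | true  | true  = refl
    ... | true  | false = refl
    ... | false | true  = refl
    ... | false | false = refl
    count-↭ P? (↭-trans p q)  = trans (count-↭ P? p) (count-↭ P? q)

    count-yes : ∀ {p} {P : Pred A p} (P? : Decidable₁ P) {k x} (xs : Vec A k) → P x → count P? (x ∷ xs) ≡ suc (count P? xs)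
    count-yes P? {x = x} xs px with P? x
    ... | yes _  = refl
    ... | no ¬px = contradiction px ¬px

    count-no : ∀ {p} {P : Pred A p} (P? : Decidable₁ P) {k x} (xs : Vec A k) → ¬ P x → count P? (x ∷ xs) ≡ count P? xs
    count-no P? {x = x} xs ¬px with P? x
    ... | yes px = contradiction px ¬px
    ... | no _   = refl

    All-↭ : ∀ {p} {P : Pred A p} {k} {xs ys : Vec A k} → xs ↭ ys → All P xs → All P ys
    All-↭ ↭-refl        pxs            = pxs
    All-↭ (↭-prep x p)  (px ∷ pxs)     = px ∷ All-↭ p pxs
    All-↭ (↭-swap x y)  (px ∷ py ∷ ps) = py ∷ px ∷ ps
    All-↭ (↭-trans p q) pxs            = All-↭ q (All-↭ p pxs)

  occurrences-∷-≡ : ∀ {n k} (x : Fin n) (xs : Tuple n k) → occurrences (x ∷ xs) x ≡ suc (occurrences xs x)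
  occurrences-∷-≡ x xs = count-yes (Fin._≟ x) xs refl

  occurrences-∷-≢ : ∀ {n k} {x ℓ : Fin n} (xs : Tuple n k) → x ≢ ℓ → occurrences (x ∷ xs) ℓ ≡ occurrences xs ℓ
  occurrences-∷-≢ {ℓ = ℓ} = count-no (Fin._≟ ℓ)

  occurrences-↭ : ∀ {n k} {xs ys : Tuple n k} → xs ↭ ys → ∀ ℓ → occurrences xs ℓ ≡ occurrences ys ℓ
  occurrences-↭ p ℓ = count-↭ (Fin._≟ ℓ) p

  occurrences≢0⇒lookup : ∀ {n k} (xs : Tuple n k) ℓ → occurrences xs ℓ ≢ 0 → ∃ λ t → lookup xs t ≡ ℓ
  occurrences≢0⇒lookup []       ℓ occ≢0 = contradiction refl occ≢0
  occurrences≢0⇒lookup (x ∷ xs) ℓ occ≢0 with x Fin.≟ ℓ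
  ... | yes x≡ℓ = zero , x≡ℓ
  ... | no  x≢ℓ with occurrences≢0⇒lookup xs ℓ occ≢0
  ...   | t , eq = suc t , eq

  occurrences-drop-∷ : ∀ {n k} {x : Fin n} {xs ys : Tuple n k} →
    (∀ ℓ → occurrences (x ∷ xs) ℓ ≡ occurrences (x ∷ ys) ℓ) → ∀ ℓ → occurrences xs ℓ ≡ occurrences ys ℓ
  occurrences-drop-∷ {x = x} eq ℓ with x Fin.≟ ℓ | eq ℓ
  ... | yes _ | eqℓ = ℕ.suc-injective eqℓ
  ... | no  _ | eqℓ = eqℓ

  -- The count of `x` in `ys` is a successor, so `x` sits at some position; pulling it to the front
  -- of `ys` and dropping it on both sides leaves equal counts. This is the induction step of
  -- `occurrences⇒↭` and of `↭⇒·`.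
  extract : ∀ {n k} {x : Fin n} {xs : Tuple n k} (ys : Tuple n (suc k)) →
    (∀ ℓ → occurrences (x ∷ xs) ℓ ≡ occurrences ys ℓ) →
    ∃ λ t → lookup ys t ≡ x × (∀ ℓ → occurrences xs ℓ ≡ occurrences (removeAt ys t) ℓ)
  extract {x = x} {xs} ys eq
    with occurrences≢0⇒lookup ys x (λ occ≡0 → ℕ.1+n≢0 (trans (sym (occurrences-∷-≡ x xs)) (trans (eq x) occ≡0)))
  ... | t , refl = t , refl , occurrences-drop-∷ {x = lookup ys t} {xs} {removeAt ys t} λ ℓ → trans (eq ℓ) (sym (occurrences-↭ (lookup∷removeAt-↭ ys t) ℓ))

  occurrences⇒↭ : ∀ {n k} (xs ys : Tuple n k) → (∀ ℓ → occurrences xs ℓ ≡ occurrences ys ℓ) → xs ↭ ys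
  occurrences⇒↭ []       []       eq = ↭-refl
  occurrences⇒↭ (x ∷ xs) ys eq with extract {x = x} {xs} ys eq
  ... | t , refl , eq′ = ↭-trans (↭-prep x (occurrences⇒↭ xs (removeAt ys t) eq′)) (lookup∷removeAt-↭ ys t)

  -- Induction on the derivation would be stopped by `↭-trans`, whose middle tuple may have another
  -- head; the counts bypass it.
  drop-∷ : ∀ {n k} {x : Fin n} {xs ys : Tuple n k} → x ∷ xs ↭ x ∷ ys → xs ↭ ys
  drop-∷ {x = x} {xs} {ys} p = occurrences⇒↭ xs ys (occurrences-drop-∷ {x = x} {xs} {ys} (occurrences-↭ p))

  infix 4 _↭?_
  _↭?_ : ∀ {n k} (xs ys : Tuple n k) → Dec (xs ↭ ys)
  xs ↭? ys = map′ (occurrences⇒↭ xs ys) occurrences-↭ (Fin.all? λ ℓ → occurrences xs ℓ ℕ.≟ occurrences ys ℓ)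

  -- Sorting, and the lexicographic order on nondecreasing tuples.

  module _ {n : ℕ} where

    Nondecreasing⇒head≤ : ∀ {k} {x : Fin n} {xs : Tuple n k} → Nondecreasing (x ∷ xs) → All (x Fin.≤_) (x ∷ xs)
    Nondecreasing⇒head≤ = Linked.Linked⇒All Fin.≤-trans Fin.≤-refl

    Nondecreasing-∷ : ∀ {k} {x : Fin n} {xs : Tuple n k} → All (x Fin.≤_) xs → Nondecreasing xs → Nondecreasing (x ∷ xs)
    Nondecreasing-∷ {xs = []}    _         _   = [-]
    Nondecreasing-∷ {xs = _ ∷ _} (x≤y ∷ _) xs↗ = x≤y ∷ xs↗

    insert : ∀ {k} x (xs : Tuple n k) → Nondecreasing xs → ∃ λ ys → ys ↭ x ∷ xs × Nondecreasing ys
    insert x []       _   = x ∷ [] , ↭-refl , [-]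
    insert x (y ∷ xs) xs↗ with Fin.≤-total x y
    ... | inj₁ x≤y = x ∷ y ∷ xs , ↭-refl , x≤y ∷ xs↗
    ... | inj₂ y≤x with insert x xs (Linked.tail xs↗)
    ...   | zs , p , zs↗ = y ∷ zs , ↭-trans (↭-prep y p) (↭-swap y x) ,
      Nondecreasing-∷ (All-↭ (↭-sym p) (y≤x ∷ All.tail (Nondecreasing⇒head≤ xs↗))) zs↗

    sort : ∀ {k} (xs : Tuple n k) → ∃ λ ys → ys ↭ xs × Nondecreasing ys
    sort []       = [] , ↭-refl , []
    sort (x ∷ xs) with sort xs
    ... | ys , p , ys↗ with insert x ys ys↗
    ...   | zs , q , zs↗ = zs , ↭-trans q (↭-prep x p) , zs↗

    -- The head of a nondecreasing tuple is its minimum, which rearrangement preserves.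
    Nondecreasing-unique : ∀ {k} {xs ys : Tuple n k} → Nondecreasing xs → Nondecreasing ys → xs ↭ ys → xs ≡ ys
    Nondecreasing-unique {xs = []}     {[]}     _   _   _ = refl
    Nondecreasing-unique {xs = x ∷ xs} {y ∷ ys} xs↗ ys↗ p
      with Fin.≤-antisym (All.head (All-↭ p (Nondecreasing⇒head≤ xs↗))) (All.head (All-↭ (↭-sym p) (Nondecreasing⇒head≤ ys↗)))
    ... | refl = cong (x ∷_) (Nondecreasing-unique (Linked.tail xs↗) (Linked.tail ys↗) (drop-∷ p))

    infix 4 _<ₗₑₓ_
    -- The parameter `⊥` is the value on two empty tuples and makes the order strict.
    _<ₗₑₓ_ : ∀ {k} → Tuple n k → Tuple n k → Set
    _<ₗₑₓ_ = Lex {A = Fin n} ⊥ _≡_ Fin._<_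

    <ₗₑₓ-irrefl : ∀ {k} {xs : Tuple n k} → ¬ (xs <ₗₑₓ xs)
    <ₗₑₓ-irrefl (this x<x _)  = Fin.<-irrefl refl x<x
    <ₗₑₓ-irrefl (next _ xs<xs) = <ₗₑₓ-irrefl xs<xs

    at-most? : ∀ (z : Fin n) → Decidable₁ (λ (y : Fin n) → y Fin.≤ z)
    at-most? z y = y Fin.≤? z

    count-≤-none : ∀ {k} z (ys : Tuple n k) → All (z Fin.<_) ys → count (at-most? z) ys ≡ 0
    count-≤-none z []       []          = refl
    count-≤-none z (y ∷ ys) (z<y ∷ z<ys) = trans (count-no (at-most? z) ys (ℕ.<⇒≱ z<y)) (count-≤-none z ys z<ys)

    -- Take for `z` the entry of `xs` at the first difference. The common prefix contributes equally
    -- to both counts; from there on `ys`, being nondecreasing, has only entries above `z`, whereas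
    -- `xs` has `z` itself.
    <ₗₑₓ⇒count-≤ : ∀ {k} {xs ys : Tuple n k} → Nondecreasing ys → xs <ₗₑₓ ys →
                   ∃ λ z → count (at-most? z) ys ℕ.< count (at-most? z) xs
    <ₗₑₓ⇒count-≤ {xs = x ∷ xs} {y ∷ ys} ys↗ (this x<y _) = x , ℕ.≤-trans (s≤s (ℕ.≤-reflexive ys≡0)) xs>0
      where
      ys≡0 : count (at-most? x) (y ∷ ys) ≡ 0
      ys≡0 = count-≤-none x (y ∷ ys) (All.map (ℕ.<-≤-trans x<y) (Nondecreasing⇒head≤ ys↗))
      xs>0 : 0 ℕ.< count (at-most? x) (x ∷ xs)
      xs>0 = subst (0 ℕ.<_) (sym (count-yes (at-most? x) xs Fin.≤-refl)) (s≤s z≤n)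
    <ₗₑₓ⇒count-≤ {xs = x ∷ xs} {.x ∷ ys} ys↗ (next refl xs<ys) with <ₗₑₓ⇒count-≤ (Linked.tail ys↗) xs<ys
    ... | z , lt with x Fin.≤? z
    ...   | yes x≤z = z , ≡.subst₂ ℕ._<_ (sym (count-yes (at-most? z) ys x≤z)) (sym (count-yes (at-most? z) xs x≤z)) (s≤s lt)
    ...   | no  x≰z = z , ≡.subst₂ ℕ._<_ (sym (count-no (at-most? z) ys x≰z)) (sym (count-no (at-most? z) xs x≰z)) lt

    count-≤-antitone : ∀ {k} z (xs ys : Tuple n k) → (∀ l → lookup ys l Fin.≤ lookup xs l) →
                       count (at-most? z) xs ℕ.≤ count (at-most? z) ys
    count-≤-antitone z []       []       ys≤xs = z≤n
    count-≤-antitone z (x ∷ xs) (y ∷ ys) ys≤xs with x Fin.≤? z | y Fin.≤? z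
    ... | yes x≤z | no  y≰z = contradiction (Fin.≤-trans (ys≤xs zero) x≤z) y≰z
    ... | yes x≤z | yes y≤z = ≡.subst₂ ℕ._≤_ (sym (count-yes (at-most? z) xs x≤z)) (sym (count-yes (at-most? z) ys y≤z))
                                (s≤s (count-≤-antitone z xs ys (ys≤xs ∘ suc)))
    ... | no  x≰z | yes y≤z = ≡.subst₂ ℕ._≤_ (sym (count-no (at-most? z) xs x≰z)) (sym (count-yes (at-most? z) ys y≤z))
                                (ℕ.m≤n⇒m≤1+n (count-≤-antitone z xs ys (ys≤xs ∘ suc)))
    ... | no  x≰z | no  y≰z = ≡.subst₂ ℕ._≤_ (sym (count-no (at-most? z) xs x≰z)) (sym (count-no (at-most? z) ys y≰z))
                                (count-≤-antitone z xs ys (ys≤xs ∘ suc))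

    -- For a suitable z, xs has more entries ≤ z than ys, hence than qs, so that qs ≤ xs
    -- cannot hold entrywise.
    <ₗₑₓ⇒exceeds : ∀ {k} {xs ys qs : Tuple n k} → Nondecreasing ys → xs <ₗₑₓ ys → qs ↭ ys →
                   ∃ λ l → lookup xs l Fin.< lookup qs l
    <ₗₑₓ⇒exceeds {xs = xs} {ys} {qs} ys↗ xs<ys p with Fin.any? (λ l → lookup xs l Fin.<? lookup qs l)
    ... | yes found = found
    ... | no  none with <ₗₑₓ⇒count-≤ ys↗ xs<ys
    ...   | z , lt = contradiction
      (count-≤-antitone z xs qs λ l → ℕ.≮⇒≥ λ xs<qs → none (l , xs<qs))
      (ℕ.<⇒≱ (subst (ℕ._< count (at-most? z) xs) (sym (count-↭ (at-most? z) p)) lt))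

    total : ∀ {k} → Tuple n k → ℕ
    total []       = 0
    total (x ∷ xs) = toℕ x ℕ.+ total xs

    total-↭ : ∀ {k} {xs ys : Tuple n k} → xs ↭ ys → total xs ≡ total ys
    total-↭ ↭-refl        = refl
    total-↭ (↭-prep x p)  = cong (toℕ x ℕ.+_) (total-↭ p)
    total-↭ (↭-swap x y {xs})  = trans (sym (ℕ.+-assoc (toℕ x) (toℕ y) (total xs)))
      (trans (cong (ℕ._+ total xs) (ℕ.+-comm (toℕ x) (toℕ y))) (ℕ.+-assoc (toℕ y) (toℕ x) (total xs)))
    total-↭ (↭-trans p q) = trans (total-↭ p) (total-↭ q)

    total-mono : ∀ {k} (xs ys : Tuple n k) → (∀ l → lookup ys l Fin.≤ lookup xs l) → total ys ℕ.≤ total xs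
    total-mono []       []       _     = z≤n
    total-mono (x ∷ xs) (y ∷ ys) ys≤xs = ℕ.+-mono-≤ (ys≤xs zero) (total-mono xs ys (ys≤xs ∘ suc))

    total-strict : ∀ {k} (xs ys : Tuple n k) → (∀ l → lookup ys l Fin.≤ lookup xs l) → total ys ≡ total xs → ys ≡ xs
    total-strict []       []       _     _  = refl
    total-strict (x ∷ xs) (y ∷ ys) ys≤xs eq with Fin.<-cmp y x
    ... | tri≈ _ refl _ = cong (x ∷_) (total-strict xs ys (ys≤xs ∘ suc) (ℕ.+-cancelˡ-≡ (toℕ x) _ _ eq))
    ... | tri< y<x _ _  = contradiction eq (ℕ.<⇒≢ (ℕ.+-mono-<-≤ y<x (total-mono xs ys (ys≤xs ∘ suc))))
    ... | tri> _ _ x<y  = contradiction (ys≤xs zero) (ℕ.<⇒≱ x<y)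

    -- Rearrangements have the same sum of entries, so if `qs` were at most `xs` in every position
    -- the two would coincide.
    ≢⇒exceeds : ∀ {k} {xs qs : Tuple n k} → qs ↭ xs → qs ≢ xs → ∃ λ l → lookup xs l Fin.< lookup qs l
    ≢⇒exceeds {xs = xs} {qs} p qs≢xs with Fin.any? (λ l → lookup xs l Fin.<? lookup qs l)
    ... | yes found = found
    ... | no  none  = contradiction (total-strict xs qs (λ l → ℕ.≮⇒≥ λ xs<qs → none (l , xs<qs)) (total-↭ p)) qs≢xs

  -- Enumerations of tuples, orbits and vertices, compared through membership.

  unique-↭ₗ : ∀ {a} {A : Set a} {xs ys : List A} → Uniqueₗ xs → Uniqueₗ ys →
              (∀ {x} → x ∈ₗ xs → x ∈ₗ ys) → (∀ {x} → x ∈ₗ ys → x ∈ₗ xs) → xs ↭ₗ.↭ ys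
  unique-↭ₗ xs! ys! xs⊆ys ys⊆xs = ∼bag⇒↭ (unique∧set⇒bag xs! ys! (mk⇔ xs⊆ys ys⊆xs))

  ∈-tuples : ∀ {n k} (xs : Tuple n k) → xs ∈ₗ tuples n k
  ∈-tuples []       = here refl
  ∈-tuples (x ∷ xs) = ∈ₗ.∈-cartesianProductWith⁺ _∷_ (∈ₗ.∈-allFin x) (∈-tuples xs)

  -- Gives two things at once: the absence of repetitions, by irreflexivity, and, since filtering
  -- keeps the order, the monotonicity of `vertex` on which triangularity depends.
  tuples-sorted : ∀ n k → AllPairsₗ _<ₗₑₓ_ (tuples n k)
  tuples-sorted n zero    = Allₗ.[] AllPairsₗ.∷ AllPairsₗ.[]
  tuples-sorted n (suc k) = prefixed (allFin n) (AllPairsₗ.tabulate⁺-< λ i<j → i<j)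
    where
    prefixed : ∀ xs → AllPairsₗ Fin._<_ xs → AllPairsₗ _<ₗₑₓ_ (cartesianProductWith _∷_ xs (tuples n k))
    prefixed []       AllPairsₗ.[]            = AllPairsₗ.[]
    prefixed (x ∷ xs) (x<xs AllPairsₗ.∷ xs<) = AllPairsₗ.++⁺
      (AllPairsₗ.map⁺ (AllPairsₗ.map (next refl) (tuples-sorted n k)))
      (prefixed xs xs<)
      (Allₗ.map⁺ {f = x ∷_} (Allₗ.universal (λ v → Allₗ.tabulate (smaller v)) (tuples n k)))
      where
      smaller : ∀ v {w} → w ∈ₗ cartesianProductWith _∷_ xs (tuples n k) → (x ∷ v) <ₗₑₓ w
      smaller v w∈ with ∈ₗ.∈-cartesianProductWith⁻ _∷_ xs (tuples n k) w∈
      ... | y , u , y∈xs , _ , refl = this (Allₗ.lookup x<xs y∈xs) refl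

  tuples-unique : ∀ n k → Uniqueₗ (tuples n k)
  tuples-unique n k = AllPairsₗ.map (λ { xs<xs refl → <ₗₑₓ-irrefl xs<xs }) (tuples-sorted n k)

  vertices-unique : ∀ n k → Uniqueₗ (vertices n k)
  vertices-unique n k = Uniqueₗ.filter⁺ (linked? Fin._≤?_) (tuples-unique n k)

  ∈-vertices : ∀ {n k} {xs : Tuple n k} → Nondecreasing xs → xs ∈ₗ vertices n k
  ∈-vertices {xs = xs} xs↗ = ∈ₗ.∈-filter⁺ (linked? Fin._≤?_) (∈-tuples xs) xs↗

  ∈-vertices⁻ : ∀ {n k} {xs : Tuple n k} → xs ∈ₗ vertices n k → Nondecreasing xs
  ∈-vertices⁻ {n} {k} xs∈ = proj₂ (∈ₗ.∈-filter⁻ (linked? Fin._≤?_) {xs = tuples n k} xs∈)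

  vertex-nondecreasing : ∀ n k a → Nondecreasing (vertex n k a)
  vertex-nondecreasing n k a = ∈-vertices⁻ (∈ₗ.∈-lookup a)

  vertex-mono : ∀ n k {a b} → a Fin.< b → vertex n k a <ₗₑₓ vertex n k b
  vertex-mono n k = lookup-mono (AllPairsₗ.filter⁺ (linked? Fin._≤?_) (tuples-sorted n k))
    where
    lookup-mono : ∀ {xs} → AllPairsₗ _<ₗₑₓ_ xs → ∀ {a b} → a Fin.< b → List.lookup xs a <ₗₑₓ List.lookup xs b
    lookup-mono (x<xs AllPairsₗ.∷ _) {zero}  {suc b} _   = Allₗ.lookup x<xs (∈ₗ.∈-lookup b)
    lookup-mono (_ AllPairsₗ.∷ xs<)  {suc a} {suc b} a<b = lookup-mono xs< (ℕ.s≤s⁻¹ a<b)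

  ·-suc : ∀ {n k m} (σ : Vec (Fin k) m) (xs : Tuple n (suc k)) t →
          Vec.map (lookup xs) (Vec.map (punchIn t) σ) ≡ Vec.map (lookup (removeAt xs t)) σ
  ·-suc σ xs t = trans (sym (Vec.map-∘ (lookup xs) (punchIn t) σ)) (Vec.map-cong (λ s → lookup-punchIn xs t s) σ)
    where
    lookup-punchIn : ∀ {a} {A : Set a} {k} (xs : Vec A (suc k)) t s → lookup xs (punchIn t s) ≡ lookup (removeAt xs t) s
    lookup-punchIn (x ∷ xs)     zero    s       = refl
    lookup-punchIn (x ∷ y ∷ xs) (suc t) zero    = refl
    lookup-punchIn (x ∷ y ∷ xs) (suc t) (suc s) = lookup-punchIn (y ∷ xs) t s

  -- The first value of `σ` is the position `t` in `ys` of the head of `xs`. The remaining values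
  -- come from the permutation found for `removeAt ys t`, renumbered by `punchIn t` so as to skip
  -- `t`.
  ↭⇒· : ∀ {n k} (xs ys : Tuple n k) → xs ↭ ys → ∃ λ σ → Unique σ × xs ≡ σ · ys
  ↭⇒· []       []       p = [] , [] , refl
  ↭⇒· (x ∷ xs) ys       p with extract {x = x} {xs} ys (occurrences-↭ p)
  ... | t , refl , eq with ↭⇒· xs (removeAt ys t) (occurrences⇒↭ xs (removeAt ys t) eq)
  ...   | σ , σ! , refl = t ∷ Vec.map (punchIn t) σ ,
    All.map⁺ (All.universal (λ s eq → Fin.punchInᵢ≢i t s (sym eq)) σ) ∷ Unique.map⁺ (Fin.punchIn-injective t _ _) σ! ,
    cong (lookup ys t ∷_) (sym (·-suc σ ys t))

  -- The tail of a repetition-free `σ` misses its head `t`, hence is `punchIn t` applied to a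
  -- shorter permutation, which acts on `removeAt ys t`.
  ·⇒↭ : ∀ {n k} (σ : Tuple k k) (ys : Tuple n k) → Unique σ → σ · ys ↭ ys
  ·⇒↭ []      []        []          = ↭-refl
  ·⇒↭ {k = suc k} (t ∷ τ) ys (t∉τ ∷ τ!) with punchOut-all τ t∉τ
    where
    punchOut-all : ∀ {m} (τ : Vec (Fin (suc k)) m) → All (t ≢_) τ → ∃ λ σ → τ ≡ Vec.map (punchIn t) σ
    punchOut-all []      []          = [] , refl
    punchOut-all (s ∷ τ) (t≢s ∷ t∉τ) with punchOut-all τ t∉τ
    ... | σ , refl = punchOut t≢s ∷ σ , cong (_∷ _) (sym (Fin.punchIn-punchOut t≢s))
  ... | σ , refl = ↭-trans (subst (λ zs → lookup ys t ∷ zs ↭ lookup ys t ∷ removeAt ys t) (sym (·-suc σ ys t))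
      (↭-prep _ (·⇒↭ σ (removeAt ys t) (AllPairs.map (λ { x≢y refl → x≢y refl }) (unmap τ!)))))
    (lookup∷removeAt-↭ ys t)
    where
    unmap : ∀ {m} {σ : Vec (Fin k) m} → Unique (Vec.map (punchIn t) σ) → Unique σ
    unmap {σ = []}    []          = []
    unmap {σ = s ∷ σ} (s∉σ ∷ σ!) = All.map (λ { s≢r refl → s≢r refl }) (All.map⁻ s∉σ) ∷ unmap σ!

  ∈-Orb⁺ : ∀ {n k} {i q : Tuple n k} → q ↭ i → q ∈ₗ Orb i
  ∈-Orb⁺ {i = i} {q} p with ↭⇒· q i p
  ... | σ , σ! , refl = ∈ₗ.∈-deduplicate⁺ (Vec.≡-dec Fin._≟_)
    (∈ₗ.∈-map⁺ (_· i) (∈ₗ.∈-filter⁺ (allPairs? λ a b → ¬? (a Fin.≟ b)) (∈-tuples σ) σ!))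

  ∈-Orb⁻ : ∀ {n k} {i q : Tuple n k} → q ∈ₗ Orb i → q ↭ i
  ∈-Orb⁻ {k = k} {i = i} q∈ with ∈ₗ.∈-map⁻ (_· i) (∈ₗ.∈-deduplicate⁻ (Vec.≡-dec Fin._≟_) (List.map (_· i) (permutations k)) q∈)
  ... | σ , σ∈ , refl = ·⇒↭ σ i (proj₂ (∈ₗ.∈-filter⁻ (allPairs? λ a b → ¬? (a Fin.≟ b)) {xs = tuples k k} σ∈))

  -- Trades the deduplicated list of images for a filter of all tuples. A sum over the orbit thereby
  -- becomes a weighted sum over `tuples n k`, which can be split by first entry.
  Orb-↭ₗ : ∀ {n k} (i : Tuple n k) → Orb i ↭ₗ.↭ filter (_↭? i) (tuples n k)
  Orb-↭ₗ {n} {k} i = unique-↭ₗ (DecUniqueₗ.deduplicate-! (Vec.≡-dec Fin._≟_) _) (Uniqueₗ.filter⁺ (_↭? i) (tuples-unique n k))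
    (λ q∈ → ∈ₗ.∈-filter⁺ (_↭? i) (∈-tuples _) (∈-Orb⁻ q∈))
    (λ q∈ → ∈-Orb⁺ (proj₂ (∈ₗ.∈-filter⁻ (_↭? i) {xs = tuples n k} q∈)))

  -- Existence of the representative is `sort`, uniqueness is `Nondecreasing-unique`. In this form
  -- the fact serves to regroup a sum over all tuples by vertices.
  representative-↭ₗ : ∀ {n k} (r : Tuple n k) → filter (r ↭?_) (vertices n k) ↭ₗ.↭ (proj₁ (sort r) ∷ [])
  representative-↭ₗ {n} {k} r with sort r
  ... | s , s↭r , s↗ = unique-↭ₗ (Uniqueₗ.filter⁺ (r ↭?_) (vertices-unique n k)) (Allₗ.[] AllPairsₗ.∷ AllPairsₗ.[])
    to (λ { (here refl) → ∈ₗ.∈-filter⁺ (r ↭?_) (∈-vertices s↗) (↭-sym s↭r) })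
    where
    to : ∀ {m} → m ∈ₗ filter (r ↭?_) (vertices n k) → m ∈ₗ (s ∷ [])
    to m∈ with ∈ₗ.∈-filter⁻ (r ↭?_) {xs = vertices n k} m∈
    ... | m∈v , r↭m = here (Nondecreasing-unique (∈-vertices⁻ m∈v) s↗ (↭-sym (↭-trans s↭r r↭m)))

  -- A nondecreasing tuple either starts with the least letter, and then any nondecreasing tail may
  -- follow, or it avoids that letter altogether. For the lengths this is Pascal's rule.
  vertices-suc-↭ₗ : ∀ n k → vertices (suc n) (suc k) ↭ₗ.↭
    (List.map (zero ∷_) (vertices (suc n) k) List.++ List.map (Vec.map Fin.suc) (vertices n (suc k)))
  vertices-suc-↭ₗ n k = unique-↭ₗ (vertices-unique (suc n) (suc k))
    (Uniqueₗ.++⁺ (Uniqueₗ.map⁺ Vec.∷-injectiveʳ (vertices-unique (suc n) k))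
                 (Uniqueₗ.map⁺ (map-suc-injective _ _) (vertices-unique n (suc k))) disjoint)
    to from
    where
    map-suc-injective : ∀ {m} (xs ys : Tuple n m) → Vec.map Fin.suc xs ≡ Vec.map Fin.suc ys → xs ≡ ys
    map-suc-injective []       []       _  = refl
    map-suc-injective (x ∷ xs) (y ∷ ys) eq = ≡.cong₂ _∷_ (Fin.suc-injective (Vec.∷-injectiveˡ eq)) (map-suc-injective xs ys (Vec.∷-injectiveʳ eq))
    disjoint : ∀ {v} → ¬ (v ∈ₗ List.map (zero ∷_) (vertices (suc n) k) × v ∈ₗ List.map (Vec.map Fin.suc) (vertices n (suc k)))
    disjoint (v∈₁ , v∈₂) with ∈ₗ.∈-map⁻ (zero ∷_) v∈₁ | ∈ₗ.∈-map⁻ (Vec.map Fin.suc) v∈₂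
    ... | _ , _ , refl | (_ ∷ _) , _ , ()
    positive : ∀ {m} (xs : Tuple (suc n) m) {x : Fin n} → All (suc x Fin.≤_) xs → ∃ λ ys → xs ≡ Vec.map Fin.suc ys
    positive []           []          = [] , refl
    positive (suc y ∷ xs) (_ ∷ x≤xs) with positive xs x≤xs
    ... | ys , refl = y ∷ ys , refl
    to : ∀ {v} → v ∈ₗ vertices (suc n) (suc k) → v ∈ₗ (List.map (zero ∷_) (vertices (suc n) k) List.++ List.map (Vec.map Fin.suc) (vertices n (suc k)))
    to {zero ∷ v}  v∈ = ∈ₗ.∈-++⁺ˡ (∈ₗ.∈-map⁺ (zero ∷_) (∈-vertices (Linked.tail (∈-vertices⁻ v∈))))
    to {suc x ∷ v} v∈ with positive v (All.tail (Nondecreasing⇒head≤ (∈-vertices⁻ v∈)))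
    ... | w , refl = ∈ₗ.∈-++⁺ʳ _ (∈ₗ.∈-map⁺ (Vec.map Fin.suc) {x = x ∷ w} (∈-vertices (Linked.map ℕ.s≤s⁻¹ (Linked.map⁻ (∈-vertices⁻ v∈)))))
    from : ∀ {v} → v ∈ₗ (List.map (zero ∷_) (vertices (suc n) k) List.++ List.map (Vec.map Fin.suc) (vertices n (suc k))) → v ∈ₗ vertices (suc n) (suc k)
    from v∈ with ∈ₗ.∈-++⁻ (List.map (zero ∷_) (vertices (suc n) k)) v∈
    ... | inj₁ v∈₁ with ∈ₗ.∈-map⁻ (zero ∷_) v∈₁
    ...   | w , w∈ , refl = ∈-vertices (Nondecreasing-∷ (All.universal (λ _ → z≤n) w) (∈-vertices⁻ w∈))
    from v∈ | inj₂ v∈₂ with ∈ₗ.∈-map⁻ (Vec.map Fin.suc) v∈₂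
    ...   | w , w∈ , refl = ∈-vertices (Linked.map⁺ (Linked.map s≤s (∈-vertices⁻ w∈)))

  -- With length `suc k` the upper index n + (k + 1) - 1 is `n + k` without truncated subtraction,
  -- also for the empty alphabet, where both sides are 0.
  order≡C : ∀ n k → order n (suc k) ≡ (n + k) C suc k
  order≡C zero    k = sym (k>n⇒nCk≡0 (ℕ.n<1+n k))
  order≡C (suc n) k = begin
    order (suc n) (suc k)                      ≡⟨ ↭ₗ.↭-length (vertices-suc-↭ₗ n k) ⟩
    _                                          ≡⟨ List.length-++ (List.map (zero ∷_) (vertices (suc n) k)) ⟩
    _                                          ≡⟨ ≡.cong₂ _+_ (List.length-map _ (vertices (suc n) k)) (List.length-map _ (vertices n (suc k))) ⟩
    order (suc n) k + order n (suc k)          ≡⟨ ≡.cong₂ _+_ (order≡C′ k) (order≡C n k) ⟩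
    (n + k) C k + (n + k) C suc k              ≡⟨ nCk+nC[k+1]≡[n+1]C[k+1] (n + k) k ⟩
    (suc n + k) C suc k                        ∎
    where
    open ≡.≡-Reasoning
    -- The tails after the least letter may have length 0. There the alphabet is nonempty, so that
    -- `n + k` is again the exact upper index.
    order≡C′ : ∀ k → order (suc n) k ≡ (n + k) C k
    order≡C′ zero    = refl
    order≡C′ (suc k) = trans (order≡C (suc n) k) (cong (_C suc k) (sym (ℕ.+-suc n k)))

-- Finite sums in a commutative semiring, used both for naturals and for reals.

module FiniteSums {c ℓ} (K : CommutativeSemiring c ℓ) where
  open CommutativeSemiring K hiding (zero)
  open SemiringSum semiring
    using (sum; sum-syntax; sum-cong-≋; sum-remove; ∑-comm; sum-replicate-zero; *-distribˡ-sum; *-distribʳ-sum)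
  open CommutativeMonoidSum *-commutativeMonoid using () renaming (sum to ∏)
  open import Relation.Binary.Reasoning.Setoid setoid

  ∑-zero : ∀ {n} {f : Vector Carrier n} → (∀ i → f i ≈ 0#) → ∑[ i < n ] f i ≈ 0#
  ∑-zero {n} f≈0 = trans (sum-cong-≋ f≈0) (sum-replicate-zero n)

  ∑-single : ∀ {n} {f : Vector Carrier n} t → (∀ i → i ≢ t → f i ≈ 0#) → ∑[ i < n ] f i ≈ f t
  ∑-single {suc n} {f} t f≈0 = begin
    ∑[ i < suc n ] f i                   ≈⟨ sum-remove {i = t} f ⟩
    f t + ∑[ i < n ] f (punchIn t i)     ≈⟨ +-congˡ (∑-zero λ i → f≈0 _ (Fin.punchInᵢ≢i t i)) ⟩
    f t + 0#                             ≈⟨ +-identityʳ _ ⟩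
    f t                                  ∎

  ∏-zero : ∀ {n} {f : Vector Carrier n} t → f t ≈ 0# → ∏ f ≈ 0#
  ∏-zero zero    ft≈0 = trans (*-congʳ ft≈0) (zeroˡ _)
  ∏-zero (suc t) ft≈0 = trans (*-congˡ (∏-zero t ft≈0)) (zeroʳ _)

  -- Unfolds to the same sum as `OverReals.∑ₗ` when the semiring is that of the reals, so the lemmas
  -- below apply there directly.
  ∑ₗ : ∀ {a} {A : Set a} → List A → (A → Carrier) → Carrier
  ∑ₗ xs f = ∑[ a < List.length xs ] f (List.lookup xs a)

  -- The Iverson bracket: it lets a sum over a filtered list be written over the whole list, where
  -- the order of summation can be exchanged.
  [_]? : ∀ {p} {P : Set p} → Dec P → Carrier
  [ d ]? = if does d then 1# else 0#

  module _ {p} {P : Set p} where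

    []?-yes : (d : Dec P) → P → [ d ]? ≈ 1#
    []?-yes (yes _) _ = refl
    []?-yes (no ¬p) p = contradiction p ¬p

    []?-no : (d : Dec P) → ¬ P → [ d ]? ≈ 0#
    []?-no (yes p) ¬p = contradiction p ¬p
    []?-no (no _)  _  = refl

    []?-*-cong : ∀ (d : Dec P) {x y} → (P → x ≈ y) → [ d ]? * x ≈ [ d ]? * y
    []?-*-cong (yes p) x≈y = *-congˡ (x≈y p)
    []?-*-cong (no ¬p) x≈y = trans (zeroˡ _) (sym (zeroˡ _))

  []?-⇔ : ∀ {p q} {P : Set p} {Q : Set q} (d : Dec P) (e : Dec Q) → (P → Q) → (Q → P) → [ d ]? ≈ [ e ]?
  []?-⇔ (yes p) e P→Q Q→P = sym ([]?-yes e (P→Q p))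
  []?-⇔ (no ¬p) e P→Q Q→P = sym ([]?-no e (¬p ∘ Q→P))

  module _ {a} {A : Set a} where

    ∑ₗ-cong : ∀ (xs : List A) {f g : A → Carrier} → (∀ x → f x ≈ g x) → ∑ₗ xs f ≈ ∑ₗ xs g
    ∑ₗ-cong xs f≈g = sum-cong-≋ {List.length xs} λ a → f≈g (List.lookup xs a)

    ∑ₗ-cong-∈ : ∀ (xs : List A) {f g : A → Carrier} → (∀ {x} → x ∈ₗ xs → f x ≈ g x) → ∑ₗ xs f ≈ ∑ₗ xs g
    ∑ₗ-cong-∈ xs f≈g = sum-cong-≋ {List.length xs} λ a → f≈g (∈ₗ.∈-lookup a)

    ∑ₗ-zero : ∀ (xs : List A) {f : A → Carrier} → (∀ {x} → x ∈ₗ xs → f x ≈ 0#) → ∑ₗ xs f ≈ 0#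
    ∑ₗ-zero xs f≈0 = ∑-zero {List.length xs} λ a → f≈0 (∈ₗ.∈-lookup a)

    ∑ₗ-++ : ∀ (xs ys : List A) (f : A → Carrier) → ∑ₗ (xs List.++ ys) f ≈ ∑ₗ xs f + ∑ₗ ys f
    ∑ₗ-++ []       ys f = sym (+-identityˡ _)
    ∑ₗ-++ (x ∷ xs) ys f = trans (+-congˡ (∑ₗ-++ xs ys f)) (sym (+-assoc _ _ _))

    ∑ₗ-↭ : ∀ {xs ys : List A} → xs ↭ₗ.↭ ys → ∀ f → ∑ₗ xs f ≈ ∑ₗ ys f
    ∑ₗ-↭ ↭ₗ.refl         f = refl
    ∑ₗ-↭ (↭ₗ.prep x p)   f = +-congˡ (∑ₗ-↭ p f)
    ∑ₗ-↭ (↭ₗ.swap {xs} {ys} x y p) f = begin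
      f x + (f y + ∑ₗ xs f)  ≈⟨ +-assoc _ _ _ ⟨
      f x + f y + ∑ₗ xs f    ≈⟨ +-cong (+-comm _ _) (∑ₗ-↭ p f) ⟩
      f y + f x + ∑ₗ ys f    ≈⟨ +-assoc _ _ _ ⟩
      f y + (f x + ∑ₗ ys f)  ∎
    ∑ₗ-↭ (↭ₗ.trans p q)  f = trans (∑ₗ-↭ p f) (∑ₗ-↭ q f)

    ∑ₗ-filter : ∀ {p} {P : Pred A p} (P? : Decidable₁ P) (xs : List A) f →
                ∑ₗ (filter P? xs) f ≈ ∑ₗ xs (λ x → [ P? x ]? * f x)
    ∑ₗ-filter P? []       f = refl
    ∑ₗ-filter P? (x ∷ xs) f with P? x
    ... | yes _ = +-cong (sym (*-identityˡ _)) (∑ₗ-filter P? xs f)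
    ... | no  _ = trans (∑ₗ-filter P? xs f) (sym (trans (+-congʳ (zeroˡ _)) (+-identityˡ _)))

    ∑ₗ-single : ∀ {xs : List A} {f : A → Carrier} → Uniqueₗ xs → ∀ {x} → x ∈ₗ xs →
                (∀ {y} → y ∈ₗ xs → y ≢ x → f y ≈ 0#) → ∑ₗ xs f ≈ f x
    ∑ₗ-single {x ∷ xs} (x∉xs AllPairsₗ.∷ _) (here ≡.refl) f≈0 = trans
      (+-congˡ (∑ₗ-zero xs λ y∈xs → f≈0 (there y∈xs) λ y≡x → Allₗ.lookup x∉xs y∈xs (≡.sym y≡x))) (+-identityʳ _)
    ∑ₗ-single (y∉xs AllPairsₗ.∷ xs!) (there x∈xs) f≈0 = trans
      (+-cong (f≈0 (here ≡.refl) (Allₗ.lookup y∉xs x∈xs)) (∑ₗ-single xs! x∈xs (f≈0 ∘ there))) (+-identityˡ _)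

    ∑ₗ-map : ∀ {b} {B : Set b} (h : B → A) xs (f : A → Carrier) → ∑ₗ (List.map h xs) f ≈ ∑ₗ xs (f ∘ h)
    ∑ₗ-map h []       f = refl
    ∑ₗ-map h (x ∷ xs) f = +-congˡ (∑ₗ-map h xs f)

    ∑ₗ-tabulate : ∀ {n} (h : Fin n → A) (f : A → Carrier) → ∑ₗ (List.tabulate h) f ≈ ∑[ i < n ] f (h i)
    ∑ₗ-tabulate {zero}  h f = refl
    ∑ₗ-tabulate {suc n} h f = +-congˡ (∑ₗ-tabulate (h ∘ suc) f)

  ∑ₜ : ∀ n k → (Tuple n k → Carrier) → Carrier
  ∑ₜ n k = ∑ₗ (tuples n k)

  -- The lexicographic enumeration groups tuples by first entry. Every induction on the length of
  -- tuples under a sum goes through this identity.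
  ∑ₜ-suc : ∀ {n} k f → ∑ₜ n (suc k) f ≈ ∑[ b < n ] ∑ₜ n k (λ q → f (b ∷ q))
  ∑ₜ-suc {n} k f = trans (prefixed (allFin n)) (∑ₗ-tabulate (λ b → b) λ b → ∑ₜ n k (λ q → f (b ∷ q)))
    where
    prefixed : ∀ xs → ∑ₗ (cartesianProductWith _∷_ xs (tuples n k)) f ≈ ∑ₗ xs λ b → ∑ₜ n k (λ q → f (b ∷ q))
    prefixed []       = refl
    prefixed (x ∷ xs) = trans (∑ₗ-++ (List.map (x ∷_) (tuples n k)) _ f)
      (+-cong (∑ₗ-map (x ∷_) (tuples n k) f) (prefixed xs))

  ∑ₗ-comm : ∀ {a b} {A : Set a} {B : Set b} (xs : List A) (ys : List B) (f : A → B → Carrier) →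
            ∑ₗ xs (λ x → ∑ₗ ys (f x)) ≈ ∑ₗ ys (λ y → ∑ₗ xs (λ x → f x y))
  ∑ₗ-comm xs ys f = ∑-comm λ a b → f (List.lookup xs a) (List.lookup ys b)

  *-distribˡ-∑ₗ : ∀ {a} {A : Set a} x (xs : List A) (f : A → Carrier) → x * ∑ₗ xs f ≈ ∑ₗ xs (λ y → x * f y)
  *-distribˡ-∑ₗ x xs f = *-distribˡ-sum x (λ a → f (List.lookup xs a))

  *-distribʳ-∑ₗ : ∀ {a} {A : Set a} x (xs : List A) (f : A → Carrier) → ∑ₗ xs f * x ≈ ∑ₗ xs (λ y → f y * x)
  *-distribʳ-∑ₗ x xs f = *-distribʳ-sum x (λ a → f (List.lookup xs a))

-- Multinomial coefficients as orbit sizes.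

module Multinomials where
  open Rearrangements
  open FiniteSums ℕ.+-*-commutativeSemiring
  open SemiringSum (CommutativeSemiring.semiring ℕ.+-*-commutativeSemiring)
    using (sum-syntax; sum-cong-≋; ∑-distrib-+; sum-replicate-zero; *-distribʳ-sum)

  factorials : ∀ {n k} → Tuple n k → ℕ
  factorials i = product (List.tabulate λ ℓ → occurrences i ℓ !)

  product-tabulate-update : ∀ {n} (f g : Fin n → ℕ) m b → f b ≡ m ℕ.* g b → (∀ ℓ → ℓ ≢ b → f ℓ ≡ g ℓ) →
                            product (List.tabulate f) ≡ m ℕ.* product (List.tabulate g)
  product-tabulate-update f g m zero    fb f≡g = ≡.trans (≡.cong₂ ℕ._*_ fb (≡.cong product
    (List.tabulate-cong (λ ℓ → f≡g (suc ℓ) λ ())))) (ℕ.*-assoc m (g zero) _)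
  product-tabulate-update f g m (suc b) fb f≡g = ≡.trans
    (≡.cong₂ ℕ._*_ (f≡g zero λ ()) (product-tabulate-update (f ∘ suc) (g ∘ suc) m b fb λ ℓ ℓ≢b → f≡g (suc ℓ) (ℓ≢b ∘ Fin.suc-injective)))
    (≡.trans (≡.sym (ℕ.*-assoc (g zero) m rest)) (≡.trans (≡.cong (ℕ._* rest) (ℕ.*-comm (g zero) m)) (ℕ.*-assoc m (g zero) rest)))
    where rest = product (List.tabulate (g ∘ suc))

  factorials-∷ : ∀ {n k} b (i : Tuple n k) → factorials (b ∷ i) ≡ occurrences (b ∷ i) b ℕ.* factorials i
  factorials-∷ b i = product-tabulate-update _ _ (occurrences (b ∷ i) b) b
    (≡.trans (≡.cong _! (occurrences-∷-≡ b i)) (≡.cong (ℕ._* occurrences i b !) (≡.sym (occurrences-∷-≡ b i))))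
    (λ ℓ ℓ≢b → ≡.cong _! (occurrences-∷-≢ i (ℓ≢b ∘ ≡.sym)))

  factorials-↭ : ∀ {n k} {i j : Tuple n k} → i ↭ j → factorials i ≡ factorials j
  factorials-↭ p = ≡.cong product (List.tabulate-cong λ ℓ → ≡.cong _! (occurrences-↭ p ℓ))

  ∑-occurrences : ∀ {n k} (i : Tuple n k) → ∑[ b < n ] occurrences i b ≡ k
  ∑-occurrences {n} []       = sum-replicate-zero n
  ∑-occurrences {n} {suc k} (x ∷ xs) = begin
    ∑[ b < n ] occurrences (x ∷ xs) b                              ≡⟨ sum-cong-≋ step ⟩
    ∑[ b < n ] ([ x Fin.≟ b ]? ℕ.+ occurrences xs b)               ≡⟨ ∑-distrib-+ (λ b → [ x Fin.≟ b ]?) (occurrences xs) ⟩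
    ∑[ b < n ] [ x Fin.≟ b ]? ℕ.+ ∑[ b < n ] occurrences xs b      ≡⟨ ≡.cong₂ ℕ._+_ (∑-single x λ b b≢x → []?-no (x Fin.≟ b) (b≢x ∘ ≡.sym)) (∑-occurrences xs) ⟩
    [ x Fin.≟ x ]? ℕ.+ k                                           ≡⟨ ≡.cong (ℕ._+ k) ([]?-yes (x Fin.≟ x) ≡.refl) ⟩
    suc k                                                          ∎
    where
    open ≡.≡-Reasoning
    step : ∀ b → occurrences (x ∷ xs) b ≡ [ x Fin.≟ b ]? ℕ.+ occurrences xs b
    step b with does (x Fin.≟ b)
    ... | true  = ≡.refl
    ... | false = ≡.refl

  -- The size of the orbit as a sum of brackets, a form that recurses on the length, as the list
  -- `Orb i` does not.
  rearrangements : ∀ {n k} → Tuple n k → ℕ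
  rearrangements {n} {k} i = ∑ₜ n k λ q → [ q ↭? i ]?

  -- Split by the first entry `b`. The rearrangements starting with `b` are those of `i` with one
  -- `b` removed, and the factorials of `i` are those of the shorter tuple times the multiplicity of
  -- `b`. By induction `b` contributes its multiplicity times `k !`, and the multiplicities add up
  -- to `suc k`.
  rearrangements*factorials≡! : ∀ {n k} (i : Tuple n k) → rearrangements i ℕ.* factorials i ≡ k !
  rearrangements*factorials≡! {n} {zero} [] = ≡.trans
    (≡.cong (λ r → (r ℕ.+ 0) ℕ.* factorials {n} []) ([]?-yes (_↭?_ {n} [] []) ↭-refl))
    (≡.trans (ℕ.*-identityˡ (factorials {n} [])) (product-ones n))
    where
    product-ones : ∀ n → product (List.tabulate {n = n} λ ℓ → 1) ≡ 1
    product-ones zero    = ≡.refl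
    product-ones (suc n) = ≡.trans (ℕ.*-identityˡ _) (product-ones n)
  rearrangements*factorials≡! {n} {suc k} i = begin
    rearrangements i ℕ.* factorials i                            ≡⟨ ≡.cong (ℕ._* factorials i) (∑ₜ-suc k λ q → [ q ↭? i ]?) ⟩
    ∑[ b < n ] starting b ℕ.* factorials i                       ≡⟨ *-distribʳ-sum (factorials i) starting ⟩
    ∑[ b < n ] (starting b ℕ.* factorials i)                     ≡⟨ sum-cong-≋ step ⟩
    ∑[ b < n ] (occurrences i b ℕ.* k !)                         ≡⟨ *-distribʳ-sum (k !) (occurrences i) ⟨
    ∑[ b < n ] occurrences i b ℕ.* k !                           ≡⟨ ≡.cong (ℕ._* k !) (∑-occurrences i) ⟩
    suc k !                                                      ∎
    where
    open ≡.≡-Reasoning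
    starting : Fin n → ℕ
    starting b = ∑ₜ n k λ q → [ b ∷ q ↭? i ]?
    step : ∀ b → starting b ℕ.* factorials i ≡ occurrences i b ℕ.* k !
    step b with occurrences i b ℕ.≟ 0
    -- A letter that does not occur in `i` cannot start a rearrangement, and its multiplicity is 0
    -- on the other side.
    ... | yes none = ≡.trans
      (≡.cong (ℕ._* factorials i) (∑ₗ-zero (tuples n k) λ {q} _ → []?-no (b ∷ q ↭? i) λ p →
        ℕ.1+n≢0 (≡.trans (≡.sym (occurrences-∷-≡ b q)) (≡.trans (occurrences-↭ p b) none))))
      (≡.sym (≡.cong (ℕ._* k !) none))
    ... | no  some with occurrences≢0⇒lookup i b some
    ...   | t , ≡.refl = begin
      starting b ℕ.* factorials i
        ≡⟨ ≡.cong₂ ℕ._*_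
             (∑ₗ-cong (tuples n k) λ q → []?-⇔ (b ∷ q ↭? i) (q ↭? i′) (λ p → drop-∷ (↭-trans p (↭-sym i′∷))) (λ p → ↭-trans (↭-prep b p) i′∷))
             (≡.trans (≡.sym (factorials-↭ i′∷)) (factorials-∷ b i′)) ⟩
      rearrangements i′ ℕ.* (occurrences (b ∷ i′) b ℕ.* factorials i′)
        ≡⟨ ≡.cong (λ o → rearrangements i′ ℕ.* (o ℕ.* factorials i′)) (occurrences-↭ i′∷ b) ⟩
      rearrangements i′ ℕ.* (occurrences i b ℕ.* factorials i′)
        ≡⟨ ≡.trans (≡.sym (ℕ.*-assoc (rearrangements i′) (occurrences i b) (factorials i′)))
             (≡.trans (≡.cong (ℕ._* factorials i′) (ℕ.*-comm (rearrangements i′) (occurrences i b)))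
               (ℕ.*-assoc (occurrences i b) (rearrangements i′) (factorials i′))) ⟩
      occurrences i b ℕ.* (rearrangements i′ ℕ.* factorials i′)
        ≡⟨ ≡.cong (occurrences i b ℕ.*_) (rearrangements*factorials≡! i′) ⟩
      occurrences i b ℕ.* k ! ∎
      where
      i′ = removeAt i t
      i′∷ = lookup∷removeAt-↭ i t

  length≡∑ₗ : ∀ {a} {A : Set a} (xs : List A) → List.length xs ≡ ∑ₗ xs (const 1)
  length≡∑ₗ []       = ≡.refl
  length≡∑ₗ (x ∷ xs) = ≡.cong suc (length≡∑ₗ xs)

  -- Connects the normalisation of `tensorWeight` with the number of equal summands in its double
  -- orbit sum.
  multinomial≡length-Orb : ∀ {n k} (i : Tuple n k) → multinomial i ≡ List.length (Orb i)
  multinomial≡length-Orb {n} {k} i = begin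
    multinomial i                                                          ≡⟨ ≡.cong (λ m → (m ℕ./ factorials i) {{≢0}}) (rearrangements*factorials≡! i) ⟨
    (rearrangements i ℕ.* factorials i ℕ./ factorials i) {{≢0}}            ≡⟨ ℕ.m*n/n≡m (rearrangements i) (factorials i) {{≢0}} ⟩
    rearrangements i                                                       ≡⟨ ∑ₗ-cong (tuples n k) (λ q → ℕ.*-identityʳ [ q ↭? i ]?) ⟨
    ∑ₜ n k (λ q → [ q ↭? i ]? ℕ.* 1)                                       ≡⟨ ∑ₗ-filter (_↭? i) (tuples n k) (const 1) ⟨
    ∑ₗ (filter (_↭? i) (tuples n k)) (const 1)                             ≡⟨ ∑ₗ-↭ (Orb-↭ₗ i) (const 1) ⟨
    ∑ₗ (Orb i) (const 1)                                                   ≡⟨ length≡∑ₗ (Orb i) ⟨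
    List.length (Orb i)                                                    ∎
    where
    open ≡.≡-Reasoning
    ≢0 : NonZero (factorials i)
    ≢0 = product≢0 (Allₗ.tabulate⁺ λ ℓ → occurrences i ℓ ℕ.!≢0)

-- Cancellation in the field.

module Field {c ℓ₁ ℓ₂} (ℝ : CompleteOrderedField c ℓ₁ ℓ₂) where
  open CompleteOrderedField ℝ hiding (zero)
  open import Relation.Binary.Reasoning.Setoid setoid

  infix 4 _≈?_
  _≈?_ : Decidable _≈_
  _≈?_ = IsStrictTotalOrder._≟_ isStrictTotalOrder

  ⁻¹-inverseˡ : ∀ {x} → ¬ (x ≈ 0#) → x ⁻¹ * x ≈ 1#
  ⁻¹-inverseˡ x≉0 = trans (*-comm _ _) (⁻¹-inverse x≉0)

  *-cancelˡ-nonZero : ∀ {x y z} → ¬ (x ≈ 0#) → x * y ≈ x * z → y ≈ z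
  *-cancelˡ-nonZero {x} {y} {z} x≉0 xy≈xz = begin
    y               ≈⟨ *-identityˡ y ⟨
    1# * y          ≈⟨ *-congʳ (⁻¹-inverseˡ x≉0) ⟨
    x ⁻¹ * x * y    ≈⟨ *-assoc _ _ _ ⟩
    x ⁻¹ * (x * y)  ≈⟨ *-congˡ xy≈xz ⟩
    x ⁻¹ * (x * z)  ≈⟨ *-assoc _ _ _ ⟨
    x ⁻¹ * x * z    ≈⟨ *-congʳ (⁻¹-inverseˡ x≉0) ⟩
    1# * z          ≈⟨ *-identityˡ z ⟩
    z               ∎

  x*y≈0⇒x≈0∨y≈0 : ∀ {x y} → x * y ≈ 0# → x ≈ 0# ⊎ y ≈ 0#
  x*y≈0⇒x≈0∨y≈0 {x} {y} xy≈0 with x ≈? 0#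
  ... | yes x≈0 = inj₁ x≈0
  ... | no  x≉0 = inj₂ (*-cancelˡ-nonZero x≉0 (trans xy≈0 (sym (zeroʳ x))))

  x-y≈0⇒x≈y : ∀ {x y} → x - y ≈ 0# → x ≈ y
  x-y≈0⇒x≈y {x} {y} x-y≈0 = begin
    x            ≈⟨ solve 2 (λ x y → x := x :- y :+ y) refl x y ⟩
    x - y + y    ≈⟨ +-congʳ x-y≈0 ⟩
    0# + y       ≈⟨ +-identityˡ y ⟩
    y            ∎
    where open IntegerSolver commutativeRing

-- Matrix algebra up to pointwise equality.

module Matrices {c ℓ₁ ℓ₂} (ℝ : CompleteOrderedField c ℓ₁ ℓ₂) where
  open CompleteOrderedField ℝ hiding (zero; Carrier; _≈_)
  open OverReals ℝ
  open FiniteSums commutativeSemiring using (∑-single)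
  open SemiringSum semiring using (sum-cong-≋; ∑-comm; *-distribˡ-sum; *-distribʳ-sum)
  open import Relation.Binary.Reasoning.Setoid setoid

  infix 4 _≋_
  _≋_ : ∀ {n} → Matrix n → Matrix n → Set ℓ₁
  A ≋ B = ∀ p q → A p q ≈ B p q

  -- Recursive, in contrast to `scalar 1#`, so that rows and bordered blocks of the identity
  -- compute; `scalar-I` relates the two.
  I : ∀ {n} → Matrix n
  I zero    zero    = 1#
  I zero    (suc _) = 0#
  I (suc _) zero    = 0#
  I (suc p) (suc q) = I p q

  infixl 7 _∙_
  _∙_ : ∀ {n} → Matrix n → Matrix n → Matrix n
  _∙_ {n} A B p q = ∑[ r < n ] (A p r * B r q)

  I-diagonal : ∀ {n} (p : Fin n) → I p p ≈ 1#
  I-diagonal zero    = refl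
  I-diagonal (suc p) = I-diagonal p

  I-off-diagonal : ∀ {n} {p q : Fin n} → p ≢ q → I p q ≈ 0#
  I-off-diagonal {p = zero}  {zero}  p≢q = contradiction ≡.refl p≢q
  I-off-diagonal {p = zero}  {suc q} p≢q = refl
  I-off-diagonal {p = suc p} {zero}  p≢q = refl
  I-off-diagonal {p = suc p} {suc q} p≢q = I-off-diagonal (p≢q ∘ ≡.cong suc)

  ∑-Iˡ : ∀ {n} p (f : Vector Carrier n) → ∑[ q < n ] (I p q * f q) ≈ f p
  ∑-Iˡ p f = begin
    _            ≈⟨ ∑-single p (λ q q≢p → trans (*-congʳ (I-off-diagonal (q≢p ∘ ≡.sym))) (zeroˡ _)) ⟩
    I p p * f p  ≈⟨ *-congʳ (I-diagonal p) ⟩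
    1# * f p     ≈⟨ *-identityˡ _ ⟩
    f p          ∎

  ∑-Iʳ : ∀ {n} p (f : Vector Carrier n) → ∑[ q < n ] (f q * I q p) ≈ f p
  ∑-Iʳ p f = begin
    _            ≈⟨ ∑-single p (λ q q≢p → trans (*-congˡ (I-off-diagonal q≢p)) (zeroʳ _)) ⟩
    f p * I p p  ≈⟨ *-congˡ (I-diagonal p) ⟩
    f p * 1#     ≈⟨ *-identityʳ _ ⟩
    f p          ∎

  ∙-cong : ∀ {n} {A B C D : Matrix n} → A ≋ B → C ≋ D → A ∙ C ≋ B ∙ D
  ∙-cong A≋B C≋D p q = sum-cong-≋ λ r → *-cong (A≋B p r) (C≋D r q)

  ∙-identityˡ : ∀ {n} (A : Matrix n) → I ∙ A ≋ A
  ∙-identityˡ A p q = ∑-Iˡ p (λ r → A r q)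

  ∙-identityʳ : ∀ {n} (A : Matrix n) → A ∙ I ≋ A
  ∙-identityʳ A p q = ∑-Iʳ q (A p)

  ∑∑-assoc : ∀ {m n} (x : Vector Carrier m) (Y : Fin m → Fin n → Carrier) (z : Vector Carrier n) →
             ∑[ s < n ] (∑[ r < m ] (x r * Y r s) * z s) ≈ ∑[ r < m ] (x r * ∑[ s < n ] (Y r s * z s))
  ∑∑-assoc {m} {n} x Y z = begin
    ∑[ s < n ] (∑[ r < m ] (x r * Y r s) * z s)      ≈⟨ sum-cong-≋ (λ s → *-distribʳ-sum (z s) λ r → x r * Y r s) ⟩
    ∑[ s < n ] ∑[ r < m ] (x r * Y r s * z s)        ≈⟨ ∑-comm (λ s r → x r * Y r s * z s) ⟩
    ∑[ r < m ] ∑[ s < n ] (x r * Y r s * z s)        ≈⟨ sum-cong-≋ (λ r → sum-cong-≋ λ s → *-assoc (x r) (Y r s) (z s)) ⟩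
    ∑[ r < m ] ∑[ s < n ] (x r * (Y r s * z s))      ≈⟨ sum-cong-≋ (λ r → *-distribˡ-sum (x r) λ s → Y r s * z s) ⟨
    ∑[ r < m ] (x r * ∑[ s < n ] (Y r s * z s))      ∎

  ∙-assoc : ∀ {n} (A B C : Matrix n) → (A ∙ B) ∙ C ≋ A ∙ (B ∙ C)
  ∙-assoc A B C p q = ∑∑-assoc (A p) B (λ s → C s q)

  ≋-sym : ∀ {n} {A B : Matrix n} → A ≋ B → B ≋ A
  ≋-sym A≋B p q = sym (A≋B p q)

  ≋-trans : ∀ {n} {A B C : Matrix n} → A ≋ B → B ≋ C → A ≋ C
  ≋-trans A≋B B≋C p q = trans (A≋B p q) (B≋C p q)

-- Determinants as alternating functions of the columns.

module Determinants {c ℓ₁ ℓ₂} (ℝ : CompleteOrderedField c ℓ₁ ℓ₂) where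
  open CompleteOrderedField ℝ hiding (zero; Carrier; _≈_)
  open OverReals ℝ
  open Field ℝ
  open Matrices ℝ
  open FiniteSums commutativeSemiring using (∑-zero; ∑-single)
  open RawSemiringDefinitions (Semiring.rawSemiring semiring) using (_^_)
  open SemiringSum semiring
    using (sum-cong-≋; ∑-distrib-+; *-distribˡ-sum)
  open RingProperties ring using (+-identityʳ-unique)
  open IntegerSolver commutativeRing
  open import Relation.Binary.Reasoning.Setoid setoid

  infixl 8 _[_≔_]
  _[_≔_] : ∀ {n} → Matrix n → Fin n → Vector Carrier n → Matrix n
  (A [ j ≔ x ]) p = updateAt (A p) j (const (x p))

  [≔]-at : ∀ {n} (A : Matrix n) j x p → (A [ j ≔ x ]) p j ≈ x p
  [≔]-at A j x p = reflexive (updateAt-updates j (A p))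

  [≔]-off : ∀ {n} (A : Matrix n) j x p q → q ≢ j → (A [ j ≔ x ]) p q ≈ A p q
  [≔]-off A j x p q q≢j = reflexive (updateAt-minimal q j (A p) q≢j)

  minor : ∀ {n} → Fin (suc n) → Matrix (suc n) → Matrix n
  minor j A p q = A (suc p) (punchIn j q)

  det-term : ∀ {n} → Matrix (suc n) → Fin (suc n) → Carrier
  det-term A j = (- 1#) ^ toℕ j * A zero j * det (minor j A)

  -- Linearity in the column j is stated for three matrices related column by column, since
  -- functions have no useful equality.
  ColumnLinear : ∀ {n} → (Matrix n → Carrier) → Set (c ⊔ ℓ₁)
  ColumnLinear {n} F = ∀ j s {A B C : Matrix n} →
    (∀ p q → q ≢ j → A p q ≈ C p q) → (∀ p q → q ≢ j → B p q ≈ C p q) →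
    (∀ p → C p j ≈ A p j + s * B p j) → F C ≈ F A + s * F B

  EqualColumns : ∀ {n} → (Matrix n → Carrier) → Fin n → Fin n → Set (c ⊔ ℓ₁)
  EqualColumns {n} F a b = ∀ (A : Matrix n) → (∀ p → A p a ≈ A p b) → F A ≈ 0#

  -- The function is kept abstract because the uniqueness argument is applied to more than `det`: to
  -- `X ↦ det (A ∙ X)`, to differences, and to functions of a block inside a bordered matrix.
  record Alternating {n} (F : Matrix n → Carrier) : Set (c ⊔ ℓ₁) where
    field
      cong          : ∀ {A B} → A ≋ B → F A ≈ F B
      linear        : ColumnLinear F
      equal-columns : ∀ {a b} → a ≢ b → EqualColumns F a b

  det-cong : ∀ {n} {A B : Matrix n} → A ≋ B → det A ≈ det B
  det-cong {zero}  A≋B = refl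
  det-cong {suc n} A≋B = sum-cong-≋ λ j →
    *-cong (*-congˡ {(- 1#) ^ toℕ j} (A≋B zero j)) (det-cong λ p q → A≋B (suc p) (punchIn j q))

  -- In the Laplace term of column `i`, either `i` is the varying column and linearity is that of
  -- the entry, the minors being equal, or the varying column survives in the minor, at position
  -- `punchOut i≢j`, and induction applies.
  det-linear : ∀ {n} → ColumnLinear (det {n})
  det-linear {suc n} j s {A} {B} {C} A≈C B≈C Cj = begin
    ∑[ i < suc n ] det-term C i                                         ≈⟨ sum-cong-≋ term ⟩
    ∑[ i < suc n ] (det-term A i + s * det-term B i)                    ≈⟨ ∑-distrib-+ (det-term A) (λ i → s * det-term B i) ⟩
    ∑[ i < suc n ] det-term A i + ∑[ i < suc n ] (s * det-term B i)     ≈⟨ +-congˡ (*-distribˡ-sum s (det-term B)) ⟨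
    ∑[ i < suc n ] det-term A i + s * ∑[ i < suc n ] det-term B i       ∎
    where
    term : ∀ i → det-term C i ≈ det-term A i + s * det-term B i
    term i with i Fin.≟ j
    ... | yes ≡.refl = begin
      ε * C zero i * det (minor i C)
        ≈⟨ *-congʳ (*-congˡ (Cj zero)) ⟩
      ε * (A zero i + s * B zero i) * det (minor i C)
        ≈⟨ solve 5 (λ e a b s d → e :* (a :+ s :* b) :* d := e :* a :* d :+ s :* (e :* b :* d)) refl ε (A zero i) (B zero i) s (det (minor i C)) ⟩
      ε * A zero i * det (minor i C) + s * (ε * B zero i * det (minor i C))
        ≈⟨ +-cong (*-congˡ (det-cong λ p q → sym (A≈C _ _ (Fin.punchInᵢ≢i i q))))
                  (*-congˡ (*-congˡ (det-cong λ p q → sym (B≈C _ _ (Fin.punchInᵢ≢i i q))))) ⟩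
      ε * A zero i * det (minor i A) + s * (ε * B zero i * det (minor i B)) ∎
      where ε = (- 1#) ^ toℕ i
    ... | no i≢j = begin
      ε * C zero i * det (minor i C)
        ≈⟨ *-congˡ (det-linear (punchOut i≢j) s (λ p q q≢ → A≈C _ _ (off q≢)) (λ p q q≢ → B≈C _ _ (off q≢)) at) ⟩
      ε * C zero i * (det (minor i A) + s * det (minor i B))
        ≈⟨ solve 5 (λ e c a b s → e :* c :* (a :+ s :* b) := e :* c :* a :+ s :* (e :* c :* b)) refl ε (C zero i) (det (minor i A)) (det (minor i B)) s ⟩
      ε * C zero i * det (minor i A) + s * (ε * C zero i * det (minor i B))
        ≈⟨ +-cong (*-congʳ (*-congˡ (sym (A≈C zero i i≢j)))) (*-congˡ (*-congʳ (*-congˡ (sym (B≈C zero i i≢j))))) ⟩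
      ε * A zero i * det (minor i A) + s * (ε * B zero i * det (minor i B)) ∎
      where
      ε = (- 1#) ^ toℕ i
      off : ∀ {q} → q ≢ punchOut i≢j → punchIn i q ≢ j
      off {q} q≢ eq = q≢ (Fin.punchIn-injective i q _ (≡.trans eq (≡.sym (Fin.punchIn-punchOut i≢j))))
      at : ∀ p → minor i C p (punchOut i≢j) ≈ minor i A p (punchOut i≢j) + s * minor i B p (punchOut i≢j)
      at p rewrite Fin.punchIn-punchOut i≢j = Cj (suc p)

  ∑-pair : ∀ {n} (f : Vector Carrier (suc n)) (a : Fin n) →
           (∀ i → i ≢ inject₁ a → i ≢ suc a → f i ≈ 0#) → f (inject₁ a) + f (suc a) ≈ 0# →
           ∑[ i < suc n ] f i ≈ 0#
  ∑-pair {suc n} f zero f≈0 pair = begin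
    f zero + (f (suc zero) + ∑[ i < n ] f (suc (suc i)))  ≈⟨ +-assoc _ _ _ ⟨
    f zero + f (suc zero) + ∑[ i < n ] f (suc (suc i))    ≈⟨ +-cong pair (∑-zero λ i → f≈0 (suc (suc i)) (λ ()) (λ ())) ⟩
    0# + 0#                                               ≈⟨ +-identityʳ 0# ⟩
    0#                                                    ∎
  ∑-pair {suc n} f (suc a) f≈0 pair = begin
    f zero + ∑[ i < suc n ] f (suc i)  ≈⟨ +-cong (f≈0 zero (λ ()) (λ ()))
                                            (∑-pair (f ∘ suc) a (λ i i≢ i≢′ → f≈0 (suc i) (i≢ ∘ Fin.suc-injective) (i≢′ ∘ Fin.suc-injective)) pair) ⟩
    0# + 0#                            ≈⟨ +-identityʳ 0# ⟩
    0#                                 ∎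

  private
    -- The minors at two adjacent columns list the same columns, except at one position where each
    -- shows the column deleted in the other.
    punchIn-inject₁-suc : ∀ {n} (a q : Fin n) →
      punchIn (inject₁ a) q ≡ punchIn (suc a) q ⊎ punchIn (inject₁ a) q ≡ suc a × punchIn (suc a) q ≡ inject₁ a
    punchIn-inject₁-suc zero    zero    = inj₂ (≡.refl , ≡.refl)
    punchIn-inject₁-suc zero    (suc q) = inj₁ ≡.refl
    punchIn-inject₁-suc (suc a) zero    = inj₁ ≡.refl
    punchIn-inject₁-suc (suc a) (suc q) with punchIn-inject₁-suc a q
    ... | inj₁ eq         = inj₁ (≡.cong suc eq)
    ... | inj₂ (eq , eq′) = inj₂ (≡.cong suc eq , ≡.cong suc eq′)

    punchIn-adjacent : ∀ {n} (a : Fin (suc n)) i → i ≢ inject₁ a → i ≢ suc a →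
      ∃ λ (b : Fin n) → punchIn i (inject₁ b) ≡ inject₁ a × punchIn i (suc b) ≡ suc a
    punchIn-adjacent zero zero i≢ i≢′ = contradiction ≡.refl i≢
    punchIn-adjacent zero (suc zero) i≢ i≢′ = contradiction ≡.refl i≢′
    punchIn-adjacent {suc n} zero (suc (suc i)) i≢ i≢′ = zero , ≡.refl , ≡.refl
    punchIn-adjacent {suc n} (suc a) zero i≢ i≢′ = a , ≡.refl , ≡.refl
    punchIn-adjacent {suc n} (suc a) (suc i) i≢ i≢′ with punchIn-adjacent a i (i≢ ∘ ≡.cong suc) (i≢′ ∘ ≡.cong suc)
    ... | b , eq , eq′ = suc b , ≡.cong suc eq , ≡.cong suc eq′

  -- In the terms of all other columns the two equal columns stay adjacent inside the minor, which
  -- vanishes by induction. The two terms left over have equal entries, equal minors and opposite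
  -- signs.
  det-adjacent : ∀ {n} (a : Fin n) → EqualColumns (det {suc n}) (inject₁ a) (suc a)
  det-adjacent {suc n} a A Aa≈Aa′ = ∑-pair (det-term A) a other pair
    where
    other : ∀ i → i ≢ inject₁ a → i ≢ suc a → det-term A i ≈ 0#
    other i i≢ i≢′ with punchIn-adjacent a i i≢ i≢′
    ... | b , eq , eq′ = trans (*-congˡ (det-adjacent b (minor i A) columns)) (zeroʳ _)
      where
      columns : ∀ p → minor i A p (inject₁ b) ≈ minor i A p (suc b)
      columns p rewrite eq | eq′ = Aa≈Aa′ (suc p)
    minors : minor (inject₁ a) A ≋ minor (suc a) A
    minors p q with punchIn-inject₁-suc a q
    ... | inj₁ eq         = reflexive (≡.cong (A (suc p)) eq)
    ... | inj₂ (eq , eq′) = trans (reflexive (≡.cong (A (suc p)) eq))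
                             (trans (sym (Aa≈Aa′ (suc p))) (reflexive (≡.cong (A (suc p)) (≡.sym eq′))))
    ε = (- 1#) ^ toℕ a
    x = A zero (inject₁ a)
    d = det (minor (inject₁ a) A)
    pair : det-term A (inject₁ a) + det-term A (suc a) ≈ 0#
    pair = begin
      det-term A (inject₁ a) + - 1# * ε * A zero (suc a) * det (minor (suc a) A)
        ≈⟨ +-cong (*-congʳ (*-congʳ (reflexive (≡.cong ((- 1#) ^_) (Fin.toℕ-inject₁ a)))))
                  (*-cong (*-congˡ (sym (Aa≈Aa′ zero))) (det-cong (≋-sym minors))) ⟩
      ε * x * d + - 1# * ε * x * d
        ≈⟨ +-cong (sym (*-identityˡ _)) (trans (*-congʳ (*-assoc _ _ _)) (*-assoc _ _ _)) ⟩
      1# * (ε * x * d) + - 1# * (ε * x * d)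
        ≈⟨ distribʳ _ _ _ ⟨
      (1# + - 1#) * (ε * x * d)
        ≈⟨ *-congʳ (-‿inverseʳ 1#) ⟩
      0# * (ε * x * d)
        ≈⟨ zeroˡ _ ⟩
      0# ∎

  module _ {n} {F : Matrix n → Carrier} (F-cong : ∀ {A B} → A ≋ B → F A ≈ F B) (F-linear : ColumnLinear F) where

    -- With u in the columns a and c and v in the column b, expand F(u, v + u, v + u) = 0.
    EqualColumns-trans : ∀ {a b c} → a ≢ b → b ≢ c → a ≢ c →
                         EqualColumns F a b → EqualColumns F b c → EqualColumns F a c
    EqualColumns-trans {a} {b} {c} a≢b b≢c a≢c ab bc A Aa≈Ac = begin
      F A                                       ≈⟨ F-cong A≋ ⟩
      F (M v u)                                 ≈⟨ *-identityˡ _ ⟨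
      1# * F (M v u)                            ≈⟨ +-identityˡ _ ⟨
      0# + 1# * F (M v u)                       ≈⟨ +-congʳ (bc (M v v) (λ p → trans (M-b v v p) (sym (M-c v v p)))) ⟨
      F (M v v) + 1# * F (M v u)                ≈⟨ F-linear c 1# (off-c v v v+u) (off-c v u v+u)
                                                     (λ p → trans (M-c v v+u p) (trans (+-congˡ (sym (*-identityˡ _)))
                                                       (+-cong (sym (M-c v v p)) (*-congˡ (sym (M-c v u p)))))) ⟨
      F (M v v+u)                               ≈⟨ +-identityʳ _ ⟨
      F (M v v+u) + 0#                          ≈⟨ +-congˡ (trans (*-congˡ (ab (M u v+u) λ p → trans (M-a u v+u p) (sym (M-b u v+u p)))) (zeroʳ _)) ⟨
      F (M v v+u) + 1# * F (M u v+u)            ≈⟨ F-linear b 1# (off-b v v+u v+u) (off-b u v+u v+u)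
                                                     (λ p → trans (M-b v+u v+u p) (trans (+-congˡ (sym (*-identityˡ _)))
                                                       (+-cong (sym (M-b v v+u p)) (*-congˡ (sym (M-b u v+u p)))))) ⟨
      F (M v+u v+u)                             ≈⟨ bc (M v+u v+u) (λ p → trans (M-b v+u v+u p) (sym (M-c v+u v+u p))) ⟩
      0#                                        ∎
      where
      u v v+u : Vector Carrier n
      u p = A p a
      v p = A p b
      v+u p = v p + u p
      M : Vector Carrier n → Vector Carrier n → Matrix n
      M x y = A [ b ≔ x ] [ c ≔ y ]
      M-a : ∀ x y p → M x y p a ≈ u p
      M-a x y p = trans ([≔]-off (A [ b ≔ x ]) c y p a a≢c) ([≔]-off A b x p a a≢b)
      M-b : ∀ x y p → M x y p b ≈ x p
      M-b x y p = trans ([≔]-off (A [ b ≔ x ]) c y p b b≢c) ([≔]-at A b x p)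
      M-c : ∀ x y p → M x y p c ≈ y p
      M-c x y p = [≔]-at (A [ b ≔ x ]) c y p
      off-c : ∀ x y z p q → q ≢ c → M x y p q ≈ M x z p q
      off-c x y z p q q≢c = trans ([≔]-off (A [ b ≔ x ]) c y p q q≢c) (sym ([≔]-off (A [ b ≔ x ]) c z p q q≢c))
      off-b : ∀ x y z p q → q ≢ b → M x y p q ≈ M z y p q
      off-b x y z p q q≢b with q Fin.≟ c
      ... | yes ≡.refl = trans (M-c x y p) (sym (M-c z y p))
      ... | no  q≢c    = trans (trans ([≔]-off (A [ b ≔ x ]) c y p q q≢c) ([≔]-off A b x p q q≢b))
                           (sym (trans ([≔]-off (A [ b ≔ z ]) c y p q q≢c) ([≔]-off A b z p q q≢b)))
      A≋ : A ≋ M v u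
      A≋ p q with q Fin.≟ c
      ... | yes ≡.refl = trans (sym (Aa≈Ac p)) (sym (M-c v u p))
      ... | no  q≢c with q Fin.≟ b
      ...   | yes ≡.refl = sym (M-b v u p)
      ...   | no  q≢b    = sym (trans ([≔]-off (A [ b ≔ v ]) c u p q q≢c) ([≔]-off A b v p q q≢b))

  private
    -- The second column moves away from `a` one step at a time: the adjacent case starts the
    -- induction, and `EqualColumns-trans` through column `inject₁ j` performs each further step.
    det-equal-columns-< : ∀ {n} {a b : Fin (suc n)} → a Fin.< b → EqualColumns det a b
    det-equal-columns-< {n} {a} a<b = <-weakInduction-startingFrom (λ b → a Fin.< b → EqualColumns det a b)
      (λ a<a → contradiction a<a (Fin.<-irrefl ≡.refl)) step (ℕ.<⇒≤ a<b) a<b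
      where
      inject₁≢suc : (j : Fin n) → inject₁ j ≢ suc j
      inject₁≢suc j eq = ℕ.1+n≢n (≡.trans (≡.cong toℕ (≡.sym eq)) (Fin.toℕ-inject₁ j))
      step : ∀ j → (a Fin.< inject₁ j → EqualColumns det a (inject₁ j)) → a Fin.< suc j → EqualColumns det a (suc j)
      step j ih a<j with a Fin.≟ inject₁ j
      ... | yes ≡.refl = det-adjacent j
      ... | no  a≢j    = EqualColumns-trans det-cong det-linear a≢j (inject₁≢suc j) (Fin.<⇒≢ a<j)
        (ih (Fin.≤∧≢⇒< (≡.subst (toℕ a ℕ.≤_) (≡.sym (Fin.toℕ-inject₁ j)) (ℕ.s≤s⁻¹ a<j)) a≢j)) (det-adjacent j)

  det-equal-columns : ∀ {n} {a b : Fin n} → a ≢ b → EqualColumns det a b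
  det-equal-columns {suc n} {a} {b} a≢b A Aa≈Ab with Fin.<-cmp a b
  ... | tri≈ _ a≡b _ = contradiction a≡b a≢b
  ... | tri< a<b _ _ = det-equal-columns-< a<b A Aa≈Ab
  ... | tri> _ _ b<a = det-equal-columns-< b<a A (sym ∘ Aa≈Ab)

  det-alternating : ∀ {n} → Alternating (det {n})
  det-alternating = record { cong = det-cong ; linear = det-linear ; equal-columns = det-equal-columns }

  module _ {n} {F : Matrix n → Carrier} (alt : Alternating F) where
    open Alternating alt

    -- A zero column is itself plus itself, so linearity gives `F A ≈ F A + 1# * F A`.
    zero-column : ∀ A j → (∀ p → A p j ≈ 0#) → F A ≈ 0#
    zero-column A j Aj≈0 = trans (sym (*-identityˡ _)) (+-identityʳ-unique _ _ (sym (linear j 1# (λ _ _ _ → refl) (λ _ _ _ → refl)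
      λ p → trans (Aj≈0 p) (sym (trans (+-cong (Aj≈0 p) (trans (*-congˡ (Aj≈0 p)) (zeroʳ _))) (+-identityʳ 0#))))))

    linear-sum : ∀ m j (s : Vector Carrier m) (U : Fin m → Vector Carrier n) A →
                 (∀ p → A p j ≈ ∑[ r < m ] (s r * U r p)) → F A ≈ ∑[ r < m ] (s r * F (A [ j ≔ U r ]))
    linear-sum zero    j s U A Aj = zero-column A j Aj
    linear-sum (suc m) j s U A Aj = begin
      F A
        ≈⟨ linear j (s zero) (λ p q → [≔]-off A j rest p q) (λ p q → [≔]-off A j (U zero) p q)
             (λ p → trans (Aj p) (trans (+-comm _ _) (+-cong (sym ([≔]-at A j rest p)) (*-congˡ (sym ([≔]-at A j (U zero) p)))))) ⟩
      F (A [ j ≔ rest ]) + s zero * F (A [ j ≔ U zero ])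
        ≈⟨ +-comm _ _ ⟩
      s zero * F (A [ j ≔ U zero ]) + F (A [ j ≔ rest ])
        ≈⟨ +-congˡ (linear-sum m j (s ∘ suc) (U ∘ suc) _ ([≔]-at A j rest)) ⟩
      s zero * F (A [ j ≔ U zero ]) + ∑[ r < m ] (s (suc r) * F (A [ j ≔ rest ] [ j ≔ U (suc r) ]))
        ≈⟨ +-congˡ (sum-cong-≋ λ r → *-congˡ (cong (overwrite (U (suc r))))) ⟩
      s zero * F (A [ j ≔ U zero ]) + ∑[ r < m ] (s (suc r) * F (A [ j ≔ U (suc r) ])) ∎
      where
      rest : Vector Carrier n
      rest p = ∑[ r < m ] (s (suc r) * U (suc r) p)
      overwrite : ∀ x → A [ j ≔ rest ] [ j ≔ x ] ≋ A [ j ≔ x ]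
      overwrite x p q with q Fin.≟ j
      ... | yes ≡.refl = trans ([≔]-at (A [ j ≔ rest ]) j x p) (sym ([≔]-at A j x p))
      ... | no  q≢j    = trans ([≔]-off (A [ j ≔ rest ]) j x p q q≢j) (trans ([≔]-off A j rest p q q≢j) (sym ([≔]-off A j x p q q≢j)))

    transvection : ∀ {c t} s {A B} → t ≢ c → (∀ p q → q ≢ c → B p q ≈ A p q) →
                   (∀ p → B p c ≈ A p c + s * A p t) → F B ≈ F A
    transvection {c} {t} s {A} {B} t≢c B≈A Bc = begin
      F B                                ≈⟨ linear c s (λ p q q≢c → sym (B≈A p q q≢c))
                                              (λ p q q≢c → trans ([≔]-off A c At p q q≢c) (sym (B≈A p q q≢c)))
                                              (λ p → trans (Bc p) (+-congˡ (*-congˡ (sym ([≔]-at A c At p))))) ⟩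
      F A + s * F (A [ c ≔ At ])         ≈⟨ +-congˡ (*-congˡ (equal-columns t≢c _ λ p →
                                              trans ([≔]-off A c At p t t≢c) (sym ([≔]-at A c At p)))) ⟩
      F A + s * 0#                       ≈⟨ trans (+-congˡ (zeroʳ s)) (+-identityʳ _) ⟩
      F A                                ∎
      where
      At : Vector Carrier n
      At p = A p t

    -- With `v t` nonzero, replace column `t` by the zero vector `A v`. The value is then 0, while
    -- expansion along the columns of `A` leaves only `v t * F A`, every other summand having a
    -- repeated column.
    right-kernel⇒zero : ∀ A (v : Vector Carrier n) → ¬ (∀ q → v q ≈ 0#) →
                        (∀ p → ∑[ q < n ] (A p q * v q) ≈ 0#) → F A ≈ 0#
    right-kernel⇒zero A v v≉0 Av≈0 with Fin.any? (λ q → ¬? (v q ≈? 0#))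
    ... | no  v≈0 = contradiction (λ q → decidable-stable (v q ≈? 0#) (λ vq≉0 → v≈0 (q , vq≉0))) v≉0
    ... | yes (t , vt≉0) with x*y≈0⇒x≈0∨y≈0 vt*FA≈0
      where
      0′ : Vector Carrier n
      0′ _ = 0#
      column : Fin n → Vector Carrier n
      column q p = A p q
      B : Matrix n
      B = A [ t ≔ 0′ ]
      B[t≔At]≋A : B [ t ≔ column t ] ≋ A
      B[t≔At]≋A p q with q Fin.≟ t
      ... | yes ≡.refl = [≔]-at B t (column t) p
      ... | no  q≢t    = trans ([≔]-off B t (column t) p q q≢t) ([≔]-off A t 0′ p q q≢t)
      vt*FA≈0 : v t * F A ≈ 0#
      vt*FA≈0 = begin
        v t * F A                                        ≈⟨ *-congˡ (cong B[t≔At]≋A) ⟨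
        v t * F (B [ t ≔ column t ])                     ≈⟨ ∑-single t (λ q q≢t → trans (*-congˡ (equal-columns q≢t _ λ p →
                                                              trans ([≔]-off B t (column q) p q q≢t)
                                                                (trans ([≔]-off A t 0′ p q q≢t) (sym ([≔]-at B t (column q) p))))) (zeroʳ _)) ⟨
        ∑[ q < n ] (v q * F (B [ t ≔ column q ]))        ≈⟨ linear-sum n t v column B (λ p → trans ([≔]-at A t 0′ p)
                                                              (trans (sym (Av≈0 p)) (sum-cong-≋ {n} λ q → *-comm (A p q) (v q)))) ⟨
        F B                                              ≈⟨ zero-column B t ([≔]-at A t 0′) ⟩
        0#                                               ∎
    ...   | inj₁ vt≈0 = contradiction vt≈0 vt≉0
    ...   | inj₂ FA≈0 = FA≈0

  -- Elimination is recorded as data, to be replayed both on alternating functions and on left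
  -- kernels. Only multiples of one column are added to another, so no sign or scalar ever has to be
  -- tracked.
  data _⇝_ {n} : Matrix n → Matrix n → Set (c ⊔ ℓ₁) where
    done : ∀ {A} → A ⇝ A
    _then_ : ∀ {A B C} → A ⇝ B → B ⇝ C → A ⇝ C
    addColumn : ∀ {A B} c t s → t ≢ c → (∀ p q → q ≢ c → B p q ≈ A p q) →
                (∀ p → B p c ≈ A p c + s * A p t) → A ⇝ B

  ⇝-alternating : ∀ {n} {F : Matrix n → Carrier} → Alternating F → ∀ {A B} → A ⇝ B → F A ≈ F B
  ⇝-alternating alt done                       = refl
  ⇝-alternating alt (A⇝B then B⇝C)             = trans (⇝-alternating alt A⇝B) (⇝-alternating alt B⇝C)
  ⇝-alternating alt (addColumn c t s t≢c B≈A Bc) = sym (transvection alt s t≢c B≈A Bc)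

  -- Column operations multiply on the right by invertible matrices and leave left kernels alone;
  -- this is why singular matrices yield left null vectors below.
  ⇝-left-kernel : ∀ {n} {A B : Matrix n} (v : Vector Carrier n) → A ⇝ B →
                  (∀ q → ∑[ p < n ] (v p * B p q) ≈ 0#) → ∀ q → ∑[ p < n ] (v p * A p q) ≈ 0#
  ⇝-left-kernel v done           vB≈0 q = vB≈0 q
  ⇝-left-kernel v (A⇝B then B⇝C) vC≈0 q = ⇝-left-kernel v A⇝B (⇝-left-kernel v B⇝C vC≈0) q
  ⇝-left-kernel {n} {A} {B} v (addColumn c t s t≢c B≈A Bc) vB≈0 q with q Fin.≟ c
  ... | no  q≢c    = trans (sum-cong-≋ λ p → *-congˡ (sym (B≈A p q q≢c))) (vB≈0 q)
  ... | yes ≡.refl = begin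
    ∑[ p < n ] (v p * A p q)                                        ≈⟨ +-identityʳ _ ⟨
    ∑[ p < n ] (v p * A p q) + 0#                                   ≈⟨ +-congˡ (trans (*-congˡ vAt≈0) (zeroʳ s)) ⟨
    ∑[ p < n ] (v p * A p q) + s * ∑[ p < n ] (v p * A p t)         ≈⟨ +-congˡ (*-distribˡ-sum s λ p → v p * A p t) ⟩
    ∑[ p < n ] (v p * A p q) + ∑[ p < n ] (s * (v p * A p t))       ≈⟨ ∑-distrib-+ (λ p → v p * A p q) (λ p → s * (v p * A p t)) ⟨
    ∑[ p < n ] (v p * A p q + s * (v p * A p t))                    ≈⟨ sum-cong-≋ (λ p → trans
      (solve 4 (λ v a s b → v :* a :+ s :* (v :* b) := v :* (a :+ s :* b)) refl (v p) (A p q) s (A p t)) (*-congˡ (sym (Bc p)))) ⟩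
    ∑[ p < n ] (v p * B p q)                                        ≈⟨ vB≈0 q ⟩
    0#                                                              ∎
    where
    vAt≈0 : ∑[ p < n ] (v p * A p t) ≈ 0#
    vAt≈0 = trans (sum-cong-≋ λ p → *-congˡ (sym (B≈A p t t≢c))) (vB≈0 t)

  private
    -- Here `m` is the number of columns after the first whose top entry has been cleared; the pivot
    -- column itself never changes its top entry.
    clear-with-pivot : ∀ {n} m (A : Matrix (suc n)) → ¬ (A zero zero ≈ 0#) → m ℕ.≤ n →
      ∃ λ B → A ⇝ B × B zero zero ≈ A zero zero × (∀ q → toℕ q ℕ.< m → B zero (suc q) ≈ 0#)
    clear-with-pivot zero    A pivot m≤n = A , done , refl , λ _ ()
    clear-with-pivot {n} (suc m) A pivot m<n with clear-with-pivot m A pivot (ℕ.<⇒≤ m<n)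
    ... | B , A⇝B , B₀₀ , B₀ = C , (A⇝B then addColumn j zero s (λ ()) ([≔]-off B j x) ([≔]-at B j x)) ,
      trans ([≔]-off B j x zero zero (λ ())) B₀₀ , C₀
      where
      j = suc (fromℕ< m<n)
      s = - (B zero j * (A zero zero) ⁻¹)
      x : Vector Carrier (suc n)
      x p = B p j + s * B p zero
      C = B [ j ≔ x ]
      C₀ : ∀ q → toℕ q ℕ.< suc m → C zero (suc q) ≈ 0#
      C₀ q q<1+m with suc q Fin.≟ j
      ... | no  q≢j    = trans ([≔]-off B j x zero (suc q) q≢j) (B₀ q (ℕ.≤∧≢⇒< (ℕ.s≤s⁻¹ q<1+m)
                           λ q≡m → q≢j (≡.cong suc (Fin.toℕ-injective (≡.trans q≡m (≡.sym (Fin.toℕ-fromℕ< m<n)))))))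
      ... | yes ≡.refl = begin
        C zero j                                                       ≈⟨ [≔]-at B j x zero ⟩
        B zero j + - (B zero j * (A zero zero) ⁻¹) * B zero zero       ≈⟨ +-congˡ (*-congˡ B₀₀) ⟩
        B zero j + - (B zero j * (A zero zero) ⁻¹) * A zero zero       ≈⟨ solve 3 (λ b i a → b :+ :- (b :* i) :* a := b :+ :- (b :* (i :* a))) refl _ _ _ ⟩
        B zero j + - (B zero j * ((A zero zero) ⁻¹ * A zero zero))     ≈⟨ +-congˡ (-‿cong (trans (*-congˡ (⁻¹-inverseˡ pivot)) (*-identityʳ _))) ⟩
        B zero j + - B zero j                                          ≈⟨ -‿inverseʳ _ ⟩
        0#                                                             ∎

  clear-first-row : ∀ {n} (A : Matrix (suc n)) → ∃ λ B → A ⇝ B × (∀ q → B zero (suc q) ≈ 0#)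
  clear-first-row {n} A with A zero zero ≈? 0#
  ... | no pivot with clear-with-pivot n A pivot ℕ.≤-refl
  ...   | B , A⇝B , _ , B₀ = B , A⇝B , λ q → B₀ q (Fin.toℕ<n q)
  clear-first-row {n} A | yes A₀₀≈0 with Fin.any? (λ q → ¬? (A zero (suc q) ≈? 0#))
  ... | no  A₀≈0 = A , done , λ q → decidable-stable (A zero (suc q) ≈? 0#) (λ A₀q≉0 → A₀≈0 (q , A₀q≉0))
  ... | yes (t , A₀t≉0) with clear-with-pivot n A′ pivot ℕ.≤-refl
    where
    x : Vector Carrier (suc n)
    x p = A p zero + 1# * A p (suc t)
    -- When the corner is 0, adding a column with nonzero top entry creates the pivot without
    -- exchanging columns.
    A′ = A [ zero ≔ x ]
    pivot : ¬ (A′ zero zero ≈ 0#)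
    pivot eq = A₀t≉0 (trans (sym (trans (+-cong A₀₀≈0 (*-identityˡ _)) (+-identityˡ _))) eq)
  ...   | B , A′⇝B , _ , B₀ = B ,
    (addColumn zero (suc t) 1# (λ ()) ([≔]-off A zero _) ([≔]-at A zero _) then A′⇝B) , λ q → B₀ q (Fin.toℕ<n q)

  -- The block matrix with rows (a, 0) and (w, X): the shape reached once the first row is cleared,
  -- and one stage of a lower triangular matrix.
  border : ∀ {n} → Carrier → Vector Carrier n → Matrix n → Matrix (suc n)
  border a w X zero    zero    = a
  border a w X zero    (suc q) = 0#
  border a w X (suc p) zero    = w p
  border a w X (suc p) (suc q) = X p q

  ≋-border : ∀ {n} (A : Matrix (suc n)) → (∀ q → A zero (suc q) ≈ 0#) →
             A ≋ border (A zero zero) (λ p → A (suc p) zero) (λ p q → A (suc p) (suc q))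
  ≋-border A A₀ zero    zero    = refl
  ≋-border A A₀ zero    (suc q) = A₀ q
  ≋-border A A₀ (suc p) zero    = refl
  ≋-border A A₀ (suc p) (suc q) = refl

  border-alternating : ∀ {n F} → Alternating F → ∀ a (w : Vector Carrier n) → Alternating (F ∘ border a w)
  border-alternating {n} {F} alt a w = record
    { cong          = λ A≋B → cong (border-cong A≋B)
    ; linear        = λ j s A≈C B≈C Cj → linear (suc j) s (off j A≈C) (off j B≈C) (at Cj)
    ; equal-columns = λ a≢b A Aa≈Ab → equal-columns (a≢b ∘ Fin.suc-injective) (border a w A) (equal Aa≈Ab)
    }
    where
    open Alternating alt
    border-cong : ∀ {A B} → A ≋ B → border a w A ≋ border a w B
    border-cong A≋B zero    zero    = refl
    border-cong A≋B zero    (suc q) = refl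
    border-cong A≋B (suc p) zero    = refl
    border-cong A≋B (suc p) (suc q) = A≋B p q
    off : ∀ j {A C : Matrix n} → (∀ p q → q ≢ j → A p q ≈ C p q) → ∀ p q → q ≢ suc j → border a w A p q ≈ border a w C p q
    off j A≈C zero    zero    _   = refl
    off j A≈C zero    (suc q) _   = refl
    off j A≈C (suc p) zero    _   = refl
    off j A≈C (suc p) (suc q) q≢j = A≈C p q (q≢j ∘ ≡.cong suc)
    at : ∀ {j s} {A B C : Matrix n} → (∀ p → C p j ≈ A p j + s * B p j) →
         ∀ p → border a w C p (suc j) ≈ border a w A p (suc j) + s * border a w B p (suc j)
    at Cj zero    = sym (trans (+-identityˡ _) (zeroʳ _))
    at Cj (suc p) = Cj p
    equal : ∀ {i j} {A : Matrix n} → (∀ p → A p i ≈ A p j) → ∀ p → border a w A p (suc i) ≈ border a w A p (suc j)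
    equal Ai≈Aj zero    = refl
    equal Ai≈Aj (suc p) = Ai≈Aj p

  -- Expand the first column in unit vectors: each of them except the first already occurs as a
  -- later column.
  alternating-border-I : ∀ {n F} → Alternating F → ∀ a (w : Vector Carrier n) → F (border a w I) ≈ a * F I
  alternating-border-I {n} {F} alt a w = begin
    F B                                              ≈⟨ linear-sum alt (suc n) zero (λ p → B p zero) I B (λ p → sym (∑-Iʳ p (λ r → B r zero))) ⟩
    ∑[ r < suc n ] (B r zero * F (B [ zero ≔ I r ])) ≈⟨ ∑-single zero off ⟩
    a * F (B [ zero ≔ I zero ])                      ≈⟨ *-congˡ (cong B[]≋I) ⟩
    a * F I                                          ∎
    where
    open Alternating alt
    B = border a w I
    off : ∀ r → r ≢ zero → B r zero * F (B [ zero ≔ I r ]) ≈ 0#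
    off zero    r≢0 = contradiction ≡.refl r≢0
    off (suc r) _   = trans (*-congˡ (equal-columns {zero} {suc r} (λ ()) (B [ zero ≔ I (suc r) ]) columns)) (zeroʳ _)
      where
      I-sym : ∀ {n} (p q : Fin n) → I p q ≈ I q p
      I-sym zero    zero    = refl
      I-sym zero    (suc q) = refl
      I-sym (suc p) zero    = refl
      I-sym (suc p) (suc q) = I-sym p q
      columns : ∀ p → (B [ zero ≔ I (suc r) ]) p zero ≈ (B [ zero ≔ I (suc r) ]) p (suc r)
      columns zero    = refl
      columns (suc p) = I-sym r p
    B[]≋I : B [ zero ≔ I zero ] ≋ I
    B[]≋I zero    zero    = refl
    B[]≋I zero    (suc q) = refl
    B[]≋I (suc p) zero    = refl
    B[]≋I (suc p) (suc q) = refl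

  -- Elimination leads to a bordered matrix. As a function of its block, `F` is again alternating,
  -- with value `a * F I` at the smaller identity, so induction on the size applies.
  vanishing-at-I : ∀ {n} {F : Matrix n → Carrier} → Alternating F → F I ≈ 0# → ∀ A → F A ≈ 0#
  vanishing-at-I {zero}      alt FI≈0 A = trans (Alternating.cong alt (λ ())) FI≈0
  vanishing-at-I {suc n} {F} alt FI≈0 A with clear-first-row A
  ... | B , A⇝B , B₀ = begin
    F A                                                ≈⟨ ⇝-alternating alt A⇝B ⟩
    F B                                                ≈⟨ Alternating.cong alt (≋-border B B₀) ⟩
    F (border (B zero zero) _ (λ p q → B (suc p) (suc q)))  ≈⟨ vanishing-at-I (border-alternating alt _ _)
      (trans (alternating-border-I alt _ _) (trans (*-congˡ FI≈0) (zeroʳ _))) (λ p q → B (suc p) (suc q)) ⟩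
    0#                                                 ∎

  det-first-row : ∀ {n} (A : Matrix (suc n)) → (∀ q → A zero (suc q) ≈ 0#) →
                  det A ≈ A zero zero * det (λ p q → A (suc p) (suc q))
  det-first-row A A₀ = trans (∑-single zero off) (*-congʳ (*-identityˡ _))
    where
    off : ∀ j → j ≢ zero → det-term A j ≈ 0#
    off zero    j≢0 = contradiction ≡.refl j≢0
    off (suc j) _   = trans (*-congʳ (trans (*-congˡ (A₀ j)) (zeroʳ _))) (zeroˡ _)

  det-lower-triangular : ∀ {n} (A : Matrix n) → (∀ {p q} → p Fin.< q → A p q ≈ 0#) →
                         det A ≈ ∏[ p < n ] A p p
  det-lower-triangular {zero}  A A≈0 = refl
  det-lower-triangular {suc n} A A≈0 = trans (det-first-row A λ q → A≈0 (s≤s z≤n))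
    (*-congˡ (det-lower-triangular (λ p q → A (suc p) (suc q)) (A≈0 ∘ s≤s)))

  det-I : ∀ {n} → det (I {n}) ≈ 1#
  det-I {zero}  = refl
  det-I {suc n} = trans (det-first-row (I {suc n}) λ _ → refl) (trans (*-identityˡ _) (det-I {n}))

  -- The difference of both sides is alternating in the matrix and vanishes at the identity.
  alternating-unique : ∀ {n} {F : Matrix n → Carrier} → Alternating F → ∀ A → F A ≈ F I * det A
  alternating-unique {n} {F} alt A = x-y≈0⇒x≈y (vanishing-at-I difference
    (trans (+-congˡ (-‿cong (trans (*-congˡ (det-I {n})) (*-identityʳ _)))) (-‿inverseʳ _)) A)
    where
    open Alternating alt
    difference : Alternating λ X → F X - F I * det X
    difference = record
      { cong          = λ A≋B → +-cong (cong A≋B) (-‿cong (*-congˡ (det-cong A≋B)))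
      ; linear        = λ j s A≈C B≈C Cj → trans
          (+-cong (linear j s A≈C B≈C Cj) (-‿cong (*-congˡ (det-linear j s A≈C B≈C Cj))))
          (solve 6 (λ fa fb s i da db → fa :+ s :* fb :+ :- (i :* (da :+ s :* db)) := fa :+ :- (i :* da) :+ s :* (fb :+ :- (i :* db)))
            refl _ _ s (F I) _ _)
      ; equal-columns = λ a≢b A Aa≈Ab → trans
          (+-cong (equal-columns a≢b A Aa≈Ab) (-‿cong (trans (*-congˡ (det-equal-columns a≢b A Aa≈Ab)) (zeroʳ _))))
          (-‿inverseʳ 0#)
      }

  -- For fixed `A` the left side is alternating in `B`, with value `det A` at the identity.
  det-∙ : ∀ {n} (A B : Matrix n) → det (A ∙ B) ≈ det A * det B
  det-∙ {n} A B = trans (alternating-unique alternating B) (*-congʳ (det-cong (∙-identityʳ A)))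
    where
    alternating : Alternating λ X → det (A ∙ X)
    alternating = record
      { cong          = λ X≋Y → det-cong (∙-cong {A = A} (λ _ _ → refl) X≋Y)
      ; linear        = λ j s {X} {Y} {Z} X≈Z Y≈Z Zj → det-linear j s
          (λ p q q≢j → sum-cong-≋ λ r → *-congˡ (X≈Z r q q≢j))
          (λ p q q≢j → sum-cong-≋ λ r → *-congˡ (Y≈Z r q q≢j))
          (λ p → begin
            ∑[ r < n ] (A p r * Z r j)                                  ≈⟨ sum-cong-≋ (λ r → trans (*-congˡ (Zj r))
              (solve 4 (λ a x s y → a :* (x :+ s :* y) := a :* x :+ s :* (a :* y)) refl (A p r) (X r j) s (Y r j))) ⟩
            ∑[ r < n ] (A p r * X r j + s * (A p r * Y r j))            ≈⟨ ∑-distrib-+ (λ r → A p r * X r j) (λ r → s * (A p r * Y r j)) ⟩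
            (A ∙ X) p j + ∑[ r < n ] (s * (A p r * Y r j))              ≈⟨ +-congˡ (*-distribˡ-sum s λ r → A p r * Y r j) ⟨
            (A ∙ X) p j + s * (A ∙ Y) p j                               ∎)
      ; equal-columns = λ a≢b X Xa≈Xb → det-equal-columns a≢b (A ∙ X) λ p → sum-cong-≋ λ r → *-congˡ (Xa≈Xb r)
      }

  -- Clear the first row. If the corner becomes 0, the whole first row is zero and the first unit
  -- vector works. Otherwise the remaining block is singular, and its null vector `u` is extended by
  -- the one entry that also annihilates the first column.
  det≈0⇒left-kernel : ∀ {n} (A : Matrix n) → det A ≈ 0# →
    ∃ λ (v : Vector Carrier n) → ¬ (∀ p → v p ≈ 0#) × (∀ q → ∑[ p < n ] (v p * A p q) ≈ 0#)
  det≈0⇒left-kernel {zero}  A detA≈0 = contradiction (sym detA≈0) 0≉1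
  det≈0⇒left-kernel {suc n} A detA≈0 with clear-first-row A
  ... | B , A⇝B , B₀ with B zero zero ≈? 0#
  ...   | yes B₀₀≈0 = I zero , (λ v≈0 → 0≉1 (sym (v≈0 zero))) , ⇝-left-kernel (I zero) A⇝B kernel
    where
    kernel : ∀ q → ∑[ p < suc n ] (I zero p * B p q) ≈ 0#
    kernel zero    = trans (∑-Iˡ zero λ p → B p zero) B₀₀≈0
    kernel (suc q) = trans (∑-Iˡ zero λ p → B p (suc q)) (B₀ q)
  ...   | no  B₀₀≉0 with det≈0⇒left-kernel (λ p q → B (suc p) (suc q))
    (*-cancelˡ-nonZero B₀₀≉0 (trans (trans (sym (det-first-row B B₀)) (trans (sym (⇝-alternating det-alternating A⇝B)) detA≈0)) (sym (zeroʳ _))))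
  ...     | u , u≉0 , uB′≈0 = v , (λ v≈0 → u≉0 (v≈0 ∘ suc)) , ⇝-left-kernel v A⇝B kernel
    where
    S = ∑[ p < n ] (u p * B (suc p) zero)
    v : Vector Carrier (suc n)
    v = - (S * (B zero zero) ⁻¹) ◂ u
    kernel : ∀ q → ∑[ p < suc n ] (v p * B p q) ≈ 0#
    kernel zero    = begin
      - (S * (B zero zero) ⁻¹) * B zero zero + S   ≈⟨ +-congʳ (solve 3 (λ s i b → :- (s :* i) :* b := :- (s :* (i :* b))) refl S _ _) ⟩
      - (S * ((B zero zero) ⁻¹ * B zero zero)) + S ≈⟨ +-congʳ (-‿cong (trans (*-congˡ (⁻¹-inverseˡ B₀₀≉0)) (*-identityʳ S))) ⟩
      - S + S                                      ≈⟨ -‿inverseˡ S ⟩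
      0#                                           ∎
    kernel (suc q) = trans (+-cong (trans (*-congˡ (B₀ q)) (zeroʳ _)) (uB′≈0 q)) (+-identityʳ 0#)

-- Consequences of the order.

module Order {c ℓ₁ ℓ₂} (ℝ : CompleteOrderedField c ℓ₁ ℓ₂) where
  open CompleteOrderedField ℝ hiding (zero)
  open IsStrictTotalOrder isStrictTotalOrder using (compare; <-resp-≈) renaming (trans to <-trans)
  open IntegerSolver commutativeRing

  <-respˡ-≈ : ∀ {x y z} → x ≈ y → x < z → y < z
  <-respˡ-≈ = proj₂ <-resp-≈

  <-respʳ-≈ : ∀ {x y z} → x ≈ y → z < x → z < y
  <-respʳ-≈ = proj₁ <-resp-≈

  0<1 : 0# < 1#
  0<1 with compare 0# 1#
  ... | tri< 0<1 _ _ = 0<1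
  ... | tri≈ _ 0≈1 _ = contradiction 0≈1 0≉1
  ... | tri> _ _ 1<0 = <-respʳ-≈ -1*-1≈1 (*-pos 0<-1 0<-1)
    where
    0<-1 : 0# < - 1#
    0<-1 = <-respʳ-≈ (+-identityˡ _) (<-respˡ-≈ (-‿inverseʳ 1#) (+-monoˡ-< (- 1#) 1<0))
    -1*-1≈1 : - 1# * - 1# ≈ 1#
    -1*-1≈1 = trans (solve 1 (λ x → :- x :* :- x := x :* x) refl 1#) (*-identityˡ 1#)

  x<y+1 : ∀ {x y} → x ≤ y → x < y + 1#
  x<y+1 {x} {y} x≤y with x≤y | <-respʳ-≈ (+-comm 1# y) (<-respˡ-≈ (+-identityˡ y) (+-monoˡ-< y 0<1))
  ... | inj₁ x<y | y<y+1 = <-trans x<y y<y+1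
  ... | inj₂ x≈y | y<y+1 = <-respˡ-≈ (sym x≈y) y<y+1

  -- A strict bound lies outside the list. In this guise the infinitude of the field enters the
  -- argument about polynomial functions.
  upper-bound : ∀ xs → ∃ λ b → Allₗ (_< b) xs
  upper-bound []       = 0# , []
  upper-bound (x ∷ xs) with upper-bound xs
  ... | b , xs<b with compare x b
  ...   | tri< x<b _ _ = b , x<b ∷ xs<b
  ...   | tri≈ _ x≈b _ = b + 1# , x<y+1 (inj₂ x≈b) ∷ Allₗ.map (λ y<b → x<y+1 (inj₁ y<b)) xs<b
  ...   | tri> _ _ b<x = x + 1# , x<y+1 (inj₂ refl) ∷ Allₗ.map (λ y<b → x<y+1 (inj₁ (<-trans y<b b<x))) xs<b

-- Polynomial functions and their identity principle.

module Polynomials {c ℓ₁ ℓ₂} (ℝ : CompleteOrderedField c ℓ₁ ℓ₂) where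
  open CompleteOrderedField ℝ hiding (zero; Carrier; _≈_)
  open OverReals ℝ
  open Field ℝ
  open Order ℝ
  open RawSemiringDefinitions (Semiring.rawSemiring semiring) using (_^_)
  open IntegerSolver commutativeRing
  open import Relation.Binary.Reasoning.Setoid setoid

  eval : ∀ {m} → Vec Carrier m → Carrier → Carrier
  eval []       x = 0#
  eval (c ∷ cs) x = c + x * eval cs x

  -- Synthetic division by `x - b`. The argument is the coefficient vector without its constant
  -- term, as that term does not influence the quotient.
  quotient : ∀ {m} → Carrier → Vec Carrier m → Vec Carrier m
  quotient b []       = []
  quotient b (c ∷ cs) = eval (c ∷ cs) b ∷ quotient b cs

  eval-quotient : ∀ {m} b c (cs : Vec Carrier m) x →
                  eval (c ∷ cs) x ≈ eval (c ∷ cs) b + (x - b) * eval (quotient b cs) x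
  eval-quotient b c []       x = trans (+-congˡ (trans (zeroʳ x) (sym (zeroʳ b))))
    (trans (sym (+-identityʳ _)) (+-congˡ (sym (zeroʳ _))))
  eval-quotient b c (d ∷ cs) x = begin
    c + x * eval (d ∷ cs) x                       ≈⟨ +-congˡ (*-congˡ (eval-quotient b d cs x)) ⟩
    c + x * (e + (x - b) * q)                     ≈⟨ solve 5 (λ b c x e q → c :+ x :* (e :+ (x :- b) :* q) := c :+ b :* e :+ (x :- b) :* (e :+ x :* q)) refl b c x e q ⟩
    c + b * e + (x - b) * (e + x * q)             ∎
    where
    e = eval (d ∷ cs) b
    q = eval (quotient b cs) x

  -- One coefficient is traded for one exceptional point. At a `b` above all of `xs` the polynomial
  -- vanishes, so it is `x - b` times a quotient with a shorter coefficient vector, which vanishes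
  -- off `b ∷ xs`.
  eval-vanishing : ∀ {m} (cs : Vec Carrier m) xs → (∀ x → Allₗ (λ y → ¬ (x ≈ y)) xs → eval cs x ≈ 0#) →
                   ∀ x → eval cs x ≈ 0#
  eval-vanishing []       xs cs≈0 x = refl
  eval-vanishing (c ∷ cs) xs cs≈0 x with upper-bound xs
  ... | b , xs<b = begin
    eval (c ∷ cs) x                                      ≈⟨ eval-quotient b c cs x ⟩
    eval (c ∷ cs) b + (x - b) * eval (quotient b cs) x   ≈⟨ +-cong fb≈0 (*-congˡ (eval-vanishing (quotient b cs) (b ∷ xs) quotient≈0 x)) ⟩
    0# + (x - b) * 0#                                    ≈⟨ trans (+-identityˡ _) (zeroʳ _) ⟩
    0#                                                   ∎
    where
    fb≈0 : eval (c ∷ cs) b ≈ 0#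
    fb≈0 = cs≈0 b (Allₗ.map (λ y<b b≈y → IsStrictTotalOrder.irrefl isStrictTotalOrder (sym b≈y) y<b) xs<b)
    quotient≈0 : ∀ y → Allₗ (λ z → ¬ (y ≈ z)) (b ∷ xs) → eval (quotient b cs) y ≈ 0#
    quotient≈0 y (y≉b ∷ y∉xs) = *-cancelˡ-nonZero (y≉b ∘ x-y≈0⇒x≈y) (begin
      (y - b) * eval (quotient b cs) y                     ≈⟨ +-identityˡ _ ⟨
      0# + (y - b) * eval (quotient b cs) y                ≈⟨ +-congʳ fb≈0 ⟨
      eval (c ∷ cs) b + (y - b) * eval (quotient b cs) y   ≈⟨ eval-quotient b c cs y ⟨
      eval (c ∷ cs) y                                      ≈⟨ cs≈0 y y∉xs ⟩
      0#                                                   ≈⟨ zeroʳ _ ⟨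
      (y - b) * 0#                                         ∎)

  -- Leading coefficients may be 0: `m` only bounds the degree, which is enough for an induction on
  -- the length.
  IsPolynomial : (Carrier → Carrier) → Set (c ⊔ ℓ₁)
  IsPolynomial f = Σ ℕ λ m → Σ (Vec Carrier m) λ cs → ∀ x → f x ≈ eval cs x

  const-polynomial : ∀ a → IsPolynomial (const a)
  const-polynomial a = 1 , a ∷ [] , λ x → sym (trans (+-congˡ (zeroʳ x)) (+-identityʳ a))

  id-polynomial : IsPolynomial (λ x → x)
  id-polynomial = 2 , 0# ∷ 1# ∷ [] , λ x → sym (trans (+-identityˡ _)
    (trans (*-congˡ (trans (+-congˡ (zeroʳ x)) (+-identityʳ 1#))) (*-identityʳ x)))

  resp-polynomial : ∀ {f g} → (∀ x → f x ≈ g x) → IsPolynomial f → IsPolynomial g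
  resp-polynomial f≈g (m , cs , f≈) = m , cs , λ x → trans (sym (f≈g x)) (f≈ x)

  private
    eval-+ : ∀ {m n} (cs : Vec Carrier m) (ds : Vec Carrier n) → IsPolynomial (λ x → eval cs x + eval ds x)
    eval-+ []       ds       = _ , ds , λ x → +-identityˡ _
    eval-+ (c ∷ cs) []       = _ , c ∷ cs , λ x → +-identityʳ _
    eval-+ (c ∷ cs) (d ∷ ds) with eval-+ cs ds
    ... | _ , es , eq = _ , (c + d) ∷ es , λ x → trans
      (solve 5 (λ c x e d f → c :+ x :* e :+ (d :+ x :* f) := c :+ d :+ x :* (e :+ f)) refl c x (eval cs x) d (eval ds x))
      (+-congˡ (*-congˡ (eq x)))

    eval-scale : ∀ {m} a (cs : Vec Carrier m) → IsPolynomial (λ x → a * eval cs x)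
    eval-scale a []       = _ , [] , λ x → zeroʳ a
    eval-scale a (c ∷ cs) with eval-scale a cs
    ... | _ , es , eq = _ , a * c ∷ es , λ x → trans
      (solve 4 (λ a c x e → a :* (c :+ x :* e) := a :* c :+ x :* (a :* e)) refl a c x (eval cs x))
      (+-congˡ (*-congˡ (eq x)))

  +-polynomial : ∀ {f g} → IsPolynomial f → IsPolynomial g → IsPolynomial (λ x → f x + g x)
  +-polynomial (_ , cs , f≈) (_ , ds , g≈) = resp-polynomial (λ x → sym (+-cong (f≈ x) (g≈ x))) (eval-+ cs ds)

  *-polynomial : ∀ {f g} → IsPolynomial f → IsPolynomial g → IsPolynomial (λ x → f x * g x)
  *-polynomial {f} {g} (_ , cs , f≈) (_ , ds , g≈) = resp-polynomial (λ x → sym (*-cong (f≈ x) (g≈ x))) (eval-* cs)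
    where
    eval-* : ∀ {m} (cs : Vec Carrier m) → IsPolynomial (λ x → eval cs x * eval ds x)
    eval-* []       = _ , [] , λ x → zeroˡ _
    eval-* (c ∷ cs) with eval-* cs
    ... | _ , es , eq = resp-polynomial
      (λ x → trans (+-congˡ (trans (+-identityˡ _) (*-congˡ (sym (eq x)))))
        (solve 4 (λ c x e d → c :* d :+ x :* (e :* d) := (c :+ x :* e) :* d) refl c x (eval cs x) (eval ds x)))
      (+-polynomial (eval-scale c ds) (_ , 0# ∷ es , λ x → refl))

  ∑-polynomial : ∀ {n} {f : Fin n → Carrier → Carrier} → (∀ i → IsPolynomial (f i)) → IsPolynomial (λ x → ∑[ i < n ] f i x)
  ∑-polynomial {zero}  f-poly = const-polynomial 0#
  ∑-polynomial {suc n} f-poly = +-polynomial (f-poly zero) (∑-polynomial (f-poly ∘ suc))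

  ∏-polynomial : ∀ {n} {f : Fin n → Carrier → Carrier} → (∀ i → IsPolynomial (f i)) → IsPolynomial (λ x → ∏[ i < n ] f i x)
  ∏-polynomial {zero}  f-poly = const-polynomial 1#
  ∏-polynomial {suc n} f-poly = *-polynomial (f-poly zero) (∏-polynomial (f-poly ∘ suc))

  det-polynomial : ∀ {n} {M : Carrier → Matrix n} → (∀ p q → IsPolynomial (λ x → M x p q)) → IsPolynomial (λ x → det (M x))
  det-polynomial {zero}  M-poly = const-polynomial 1#
  det-polynomial {suc n} M-poly = ∑-polynomial λ j → *-polynomial
    (*-polynomial (const-polynomial ((- 1#) ^ toℕ j)) (M-poly zero j)) (det-polynomial λ p q → M-poly (suc p) (punchIn j q))

  scalar-polynomial : ∀ {n} (p q : Fin n) → IsPolynomial (λ x → scalar x p q)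
  scalar-polynomial p q with p Fin.≟ q
  ... | yes _ = id-polynomial
  ... | no  _ = const-polynomial 0#

  charPoly-polynomial : ∀ {n} (A : Matrix n) → IsPolynomial (charPoly A)
  charPoly-polynomial A = det-polynomial λ p q → +-polynomial (scalar-polynomial p q) (const-polynomial (- A p q))

  -- Cancelling a factor `x - a` between functions says nothing at `a` itself; this lemma supplies
  -- the missing value.
  polynomial-identity : ∀ {f g} → IsPolynomial f → IsPolynomial g → ∀ a →
                        (∀ x → ¬ (x ≈ a) → f x ≈ g x) → ∀ x → f x ≈ g x
  polynomial-identity {f} {g} f-poly g-poly a f≈g x
    with +-polynomial f-poly (*-polynomial (const-polynomial (- 1#)) g-poly)
  ... | _ , cs , eq = x-y≈0⇒x≈y (trans (f-g≈eval x) (eval-vanishing cs (a ∷ []) cs≈0 x))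
    where
    f-g≈eval : ∀ x → f x - g x ≈ eval cs x
    f-g≈eval x = trans (+-congˡ (trans (-‿cong (sym (*-identityˡ _))) (RingProperties.-‿distribˡ-* ring 1# (g x)))) (eq x)
    cs≈0 : ∀ x → Allₗ (λ y → ¬ (x ≈ y)) (a ∷ []) → eval cs x ≈ 0#
    cs≈0 x (x≉a ∷ []) = trans (sym (f-g≈eval x)) (trans (+-congʳ (f≈g x x≉a)) (-‿inverseʳ _))

-- Similarity and lower triangular form.

module Triangularisation {c ℓ₁ ℓ₂} (ℝ : CompleteOrderedField c ℓ₁ ℓ₂) where
  open CompleteOrderedField ℝ hiding (zero; Carrier; _≈_)
  open OverReals ℝ
  open Field ℝ
  open Matrices ℝ
  open Determinants ℝ
  open Polynomials ℝ
  open RingProperties ring using (-1*x≈-x)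
  open FiniteSums commutativeSemiring using (∑-zero)
  open SemiringSum semiring using (sum-cong-≋; sum-remove; ∑-distrib-+; *-distribˡ-sum)
  open CommutativeMonoidSum *-commutativeMonoid using () renaming (sum-cong-≋ to ∏-cong)
  open IntegerSolver commutativeRing
  open import Relation.Binary.Reasoning.Setoid setoid

  scalar-I : ∀ {n} x (p q : Fin n) → scalar x p q ≈ x * I p q
  scalar-I x p q with p Fin.≟ q
  ... | yes ≡.refl = sym (trans (*-congˡ (I-diagonal p)) (*-identityʳ x))
  ... | no  p≢q    = sym (trans (*-congˡ (I-off-diagonal p≢q)) (zeroʳ x))

  characteristic : ∀ {n} → Matrix n → Carrier → Matrix n
  characteristic A x p q = scalar x p q - A p q

  ∑-characteristicˡ : ∀ {n} (v : Vector Carrier n) A x q →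
    ∑[ r < n ] (v r * characteristic A x r q) ≈ x * v q - ∑[ r < n ] (v r * A r q)
  ∑-characteristicˡ {n} v A x q = begin
    ∑[ r < n ] (v r * characteristic A x r q)                            ≈⟨ sum-cong-≋ (λ r → trans (*-congˡ (+-congʳ (scalar-I x r q)))
      (trans (solve 4 (λ v x i a → v :* (x :* i :- a) := x :* (v :* i) :+ :- (v :* a)) refl (v r) x (I r q) (A r q))
        (+-congˡ (sym (-1*x≈-x (v r * A r q)))))) ⟩
    ∑[ r < n ] (x * (v r * I r q) + - 1# * (v r * A r q))                ≈⟨ ∑-distrib-+ (λ r → x * (v r * I r q)) (λ r → - 1# * (v r * A r q)) ⟩
    ∑[ r < n ] (x * (v r * I r q)) + ∑[ r < n ] (- 1# * (v r * A r q))   ≈⟨ +-cong (*-distribˡ-sum x λ r → v r * I r q) (*-distribˡ-sum (- 1#) λ r → v r * A r q) ⟨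
    x * ∑[ r < n ] (v r * I r q) + - 1# * ∑[ r < n ] (v r * A r q)       ≈⟨ +-cong (*-congˡ (∑-Iʳ q v)) (-1*x≈-x _) ⟩
    x * v q - ∑[ r < n ] (v r * A r q)                                   ∎

  ∑-characteristicʳ : ∀ {n} A x (v : Vector Carrier n) p →
    ∑[ r < n ] (characteristic A x p r * v r) ≈ x * v p - ∑[ r < n ] (A p r * v r)
  ∑-characteristicʳ {n} A x v p = begin
    ∑[ r < n ] (characteristic A x p r * v r)                            ≈⟨ sum-cong-≋ (λ r → trans (*-congʳ (+-congʳ (scalar-I x p r)))
      (trans (solve 4 (λ v x i a → (x :* i :- a) :* v := x :* (i :* v) :+ :- (a :* v)) refl (v r) x (I p r) (A p r))
        (+-congˡ (sym (-1*x≈-x (A p r * v r)))))) ⟩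
    ∑[ r < n ] (x * (I p r * v r) + - 1# * (A p r * v r))                ≈⟨ ∑-distrib-+ (λ r → x * (I p r * v r)) (λ r → - 1# * (A p r * v r)) ⟩
    ∑[ r < n ] (x * (I p r * v r)) + ∑[ r < n ] (- 1# * (A p r * v r))   ≈⟨ +-cong (*-distribˡ-sum x λ r → I p r * v r) (*-distribˡ-sum (- 1#) λ r → A p r * v r) ⟨
    x * ∑[ r < n ] (I p r * v r) + - 1# * ∑[ r < n ] (A p r * v r)       ≈⟨ +-cong (*-congˡ (∑-Iˡ p v)) (-1*x≈-x _) ⟩
    x * v p - ∑[ r < n ] (A p r * v r)                                   ∎

  -- `P` also intertwines `x I - A` with `x I - T`. Taking determinants gives the claim up to the
  -- factor `det P`, which is nonzero because `det P * det Q` is 1.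
  charPoly-similar : ∀ {n} {A T P Q : Matrix n} → P ∙ Q ≋ I → P ∙ A ≋ T ∙ P → ∀ x → charPoly A x ≈ charPoly T x
  charPoly-similar {n} {A} {T} {P} {Q} PQ≋I PA≋TP x = *-cancelˡ-nonZero detP≉0 (begin
    det P * charPoly A x                    ≈⟨ det-∙ P (characteristic A x) ⟨
    det (P ∙ characteristic A x)            ≈⟨ det-cong (λ p q → trans (∑-characteristicˡ (P p) A x q)
                                                 (trans (+-congˡ (-‿cong (PA≋TP p q))) (sym (∑-characteristicʳ T x (λ r → P r q) p)))) ⟩
    det (characteristic T x ∙ P)            ≈⟨ det-∙ (characteristic T x) P ⟩
    charPoly T x * det P                    ≈⟨ *-comm _ _ ⟩
    det P * charPoly T x                    ∎)
    where
    detP≉0 : ¬ (det P ≈ 0#)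
    detP≉0 detP≈0 = 0≉1 (begin
      0#             ≈⟨ zeroˡ (det Q) ⟨
      0# * det Q     ≈⟨ *-congʳ detP≈0 ⟨
      det P * det Q  ≈⟨ det-∙ P Q ⟨
      det (P ∙ Q)    ≈⟨ det-cong PQ≋I ⟩
      det (I {n})    ≈⟨ det-I {n} ⟩
      1#             ∎)

  charPoly-lower-triangular : ∀ {n} (T : Matrix n) → (∀ {p q} → p Fin.< q → T p q ≈ 0#) →
                              ∀ x → charPoly T x ≈ ∏[ p < n ] (x - T p p)
  charPoly-lower-triangular {n} T lower x = trans
    (det-lower-triangular (characteristic T x) λ {p} {q} p<q → trans
      (+-cong (trans (scalar-I x p q) (trans (*-congˡ (I-off-diagonal (Fin.<⇒≢ p<q))) (zeroʳ x))) (-‿cong (lower p<q))) (-‿inverseʳ 0#))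
    (∏-cong {n} λ p → +-congʳ { - T p p} (trans (scalar-I x p p) (trans (*-congˡ (I-diagonal p)) (*-identityʳ x))))

  -- Where `v t` is nonzero, the rows of `P` are `v` and all unit vectors but the one at `t`. The
  -- inverse writes unit vectors in terms of these rows; only its row `t` is nontrivial and results
  -- from solving the expansion of `v` for the missing unit vector.
  invertible-with-first-row : ∀ {n} (v : Vector Carrier (suc n)) → ¬ (∀ q → v q ≈ 0#) →
    ∃ λ P → ∃ λ Q → (∀ q → P zero q ≈ v q) × P ∙ Q ≋ I × Q ∙ P ≋ I
  invertible-with-first-row {n} v v≉0 with Fin.any? (λ q → ¬? (v q ≈? 0#))
  ... | no  v≈0        = contradiction (λ q → decidable-stable (v q ≈? 0#) (λ vq≉0 → v≈0 (q , vq≉0))) v≉0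
  ... | yes (t , vt≉0) = P , Q , (λ _ → refl) , PQ≋I , QP≋I
    where
    i = v t ⁻¹
    Qt : Vector Carrier (suc n)
    Qt zero    = i
    Qt (suc r) = - (i * v (punchIn t r))
    P Q : Matrix (suc n)
    P zero    = v
    P (suc r) = I (punchIn t r)
    Q = insertAt (I ∘ suc) t Qt
    Q-t : ∀ c → Q t c ≈ Qt c
    Q-t c = reflexive (≡.cong (λ row → row c) (insertAt-lookup (I ∘ suc) t Qt))
    Q-punchIn : ∀ r c → Q (punchIn t r) c ≈ I (suc r) c
    Q-punchIn r c = reflexive (≡.cong (λ row → row c) (insertAt-punchIn (I ∘ suc) t Qt r))
    PQ≋I : P ∙ Q ≋ I
    PQ≋I (suc r) c = trans (∑-Iˡ (punchIn t r) (λ q → Q q c)) (Q-punchIn r c)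
    PQ≋I zero    c = begin
      ∑[ q < suc n ] (v q * Q q c)
        ≈⟨ sum-remove {i = t} (λ q → v q * Q q c) ⟩
      v t * Q t c + ∑[ r < n ] (v (punchIn t r) * Q (punchIn t r) c)
        ≈⟨ +-cong (*-congˡ (Q-t c)) (sum-cong-≋ λ r → *-congˡ (Q-punchIn r c)) ⟩
      v t * Qt c + ∑[ r < n ] (v (punchIn t r) * I (suc r) c)
        ≈⟨ row c ⟩
      I zero c ∎
      where
      row : ∀ c → v t * Qt c + ∑[ r < n ] (v (punchIn t r) * I (suc r) c) ≈ I zero c
      row zero    = trans (+-cong (⁻¹-inverse vt≉0) (∑-zero λ r → zeroʳ (v (punchIn t r)))) (+-identityʳ 1#)
      row (suc s) = begin
        v t * - (i * v (punchIn t s)) + ∑[ r < n ] (v (punchIn t r) * I r s)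
          ≈⟨ +-cong (solve 3 (λ a i b → a :* :- (i :* b) := :- (a :* i :* b)) refl (v t) i (v (punchIn t s))) (∑-Iʳ s (v ∘ punchIn t)) ⟩
        - (v t * i * v (punchIn t s)) + v (punchIn t s)
          ≈⟨ +-congʳ (-‿cong (trans (*-congʳ (⁻¹-inverse vt≉0)) (*-identityˡ _))) ⟩
        - v (punchIn t s) + v (punchIn t s)
          ≈⟨ -‿inverseˡ _ ⟩
        0# ∎
    QP≋I : Q ∙ P ≋ I
    QP≋I p q with t Fin.≟ p
    ... | no t≢p = ≡.subst (λ p → (Q ∙ P) p q ≈ I p q) (Fin.punchIn-punchOut t≢p) (begin
      ∑[ c < suc n ] (Q (punchIn t r) c * P c q)   ≈⟨ sum-cong-≋ (λ c → *-congʳ {P c q} (Q-punchIn r c)) ⟩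
      ∑[ c < suc n ] (I (suc r) c * P c q)         ≈⟨ ∑-Iˡ (suc r) (λ c → P c q) ⟩
      I (punchIn t r) q                            ∎)
      where r = punchOut t≢p
    ... | yes ≡.refl = begin
      ∑[ c < suc n ] (Q t c * P c q)
        ≈⟨ sum-cong-≋ (λ c → *-congʳ {P c q} (Q-t c)) ⟩
      i * v q + ∑[ r < n ] (- (i * v (punchIn t r)) * I (punchIn t r) q)
        ≈⟨ +-congˡ (sum-cong-≋ λ r → solve 3 (λ i a b → :- (i :* a) :* b := (:- i) :* (a :* b)) refl i (v (punchIn t r)) (I (punchIn t r) q)) ⟩
      i * v q + ∑[ r < n ] (- i * (v (punchIn t r) * I (punchIn t r) q))
        ≈⟨ +-cong (*-congˡ (trans (sym (∑-Iʳ q v)) (sum-remove {i = t} (λ s → v s * I s q))))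
                  (sym (*-distribˡ-sum (- i) λ r → v (punchIn t r) * I (punchIn t r) q)) ⟩
      i * (v t * I t q + Z) + - i * Z
        ≈⟨ solve 4 (λ i a b z → i :* (a :* b :+ z) :+ (:- i) :* z := a :* i :* b) refl i (v t) (I t q) Z ⟩
      v t * i * I t q
        ≈⟨ trans (*-congʳ (⁻¹-inverse vt≉0)) (*-identityˡ _) ⟩
      I t q ∎
      where Z = ∑[ r < n ] (v (punchIn t r) * I (punchIn t r) q)

  border-∙ : ∀ {n} a (w : Vector Carrier n) X b u Y →
             border a w X ∙ border b u Y ≋ border (a * b) (λ p → w p * b + ∑[ r < n ] (X p r * u r)) (X ∙ Y)
  border-∙ a w X b u Y zero    zero    = trans (+-congˡ (∑-zero λ r → zeroˡ (u r))) (+-identityʳ _)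
  border-∙ a w X b u Y zero    (suc q) = trans (+-cong (zeroʳ a) (∑-zero λ r → zeroˡ (Y r q))) (+-identityʳ _)
  border-∙ a w X b u Y (suc p) zero    = refl
  border-∙ a w X b u Y (suc p) (suc q) = trans (+-congʳ (zeroʳ (w p))) (+-identityˡ _)

  border-cong : ∀ {n a b} {w u : Vector Carrier n} {X Y} → a ≈ b → (∀ p → w p ≈ u p) → X ≋ Y → border a w X ≋ border b u Y
  border-cong a≈b w≈u X≋Y zero    zero    = a≈b
  border-cong a≈b w≈u X≋Y zero    (suc q) = refl
  border-cong a≈b w≈u X≋Y (suc p) zero    = w≈u p
  border-cong a≈b w≈u X≋Y (suc p) (suc q) = X≋Y p q

  -- The diagonal reproduces `λs` in the given order, beyond the equality of multisets, so that
  -- products over tuples can later be compared factor by factor.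
  record LowerTriangularForm {n} (A : Matrix n) (λs : Vector Carrier n) : Set (c ⊔ ℓ₁) where
    field
      P Q T    : Matrix n
      PQ≋I     : P ∙ Q ≋ I
      QP≋I     : Q ∙ P ≋ I
      PA≋TP    : P ∙ A ≋ T ∙ P
      lower    : ∀ {p q} → p Fin.< q → T p q ≈ 0#
      diagonal : ∀ p → T p p ≈ λs p

  border-form : ∀ {n} {B : Matrix n} {μs} → LowerTriangularForm B μs → ∀ μ w {λs} →
                μ ≈ λs zero → (∀ p → μs p ≈ λs (suc p)) → LowerTriangularForm (border μ w B) λs
  border-form {n} {B} form μ w μ≈ μs≈ = record
    { P        = border 1# 0′ P
    ; Q        = border 1# 0′ Q
    ; T        = border μ w′ T
    ; PQ≋I     = inverses PQ≋I
    ; QP≋I     = inverses QP≋I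
    ; PA≋TP    = ≋-trans (border-∙ 1# 0′ P μ w B) (≋-trans
                   (border-cong (*-comm 1# μ) (λ p → trans (trans (+-congʳ (zeroˡ μ)) (+-identityˡ _))
                     (sym (trans (+-cong (*-identityʳ _) (∑-zero λ r → zeroʳ (T p r))) (+-identityʳ _)))) PA≋TP)
                   (≋-sym (border-∙ μ w′ T 1# 0′ P)))
    ; lower    = λ { {zero} {suc q} p<q → refl ; {suc p} {suc q} p<q → lower (ℕ.s≤s⁻¹ p<q) }
    ; diagonal = λ { zero → μ≈ ; (suc p) → trans (diagonal p) (μs≈ p) }
    }
    where
    open LowerTriangularForm form
    0′ w′ : Vector Carrier n
    0′ _ = 0#
    -- Forced by the first column of the intertwining relation, which reads `P w` on one side and
    -- `w′` on the other.
    w′ p = ∑[ r < n ] (P p r * w r)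
    inverses : ∀ {X Y} → X ∙ Y ≋ I → border 1# 0′ X ∙ border 1# 0′ Y ≋ I
    inverses {X} {Y} XY≋I = ≋-trans (border-∙ 1# 0′ X 1# 0′ Y) (≋-trans
      (border-cong (*-identityˡ 1#) (λ p → trans (+-cong (zeroˡ 1#) (∑-zero λ r → zeroʳ (X p r))) (+-identityʳ 0#)) XY≋I)
      λ { zero zero → refl ; zero (suc q) → refl ; (suc p) zero → refl ; (suc p) (suc q) → refl })

  similar-form : ∀ {n} {A C P Q : Matrix n} {λs} → P ∙ Q ≋ I → Q ∙ P ≋ I → P ∙ A ≋ C ∙ P →
                 LowerTriangularForm C λs → LowerTriangularForm A λs
  similar-form {n} {A} {C} {P} {Q} PQ≋I QP≋I PA≋CP form = record
    { P        = F.P ∙ P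
    ; Q        = Q ∙ F.Q
    ; T        = F.T
    ; PQ≋I     = cancel F.P P Q F.Q PQ≋I F.PQ≋I
    ; QP≋I     = cancel Q F.Q F.P P F.QP≋I QP≋I
    ; PA≋TP    = ≋-trans (∙-assoc F.P P A) (≋-trans (∙-cong {A = F.P} (λ _ _ → refl) PA≋CP) (≋-trans
                   (≋-sym (∙-assoc F.P C P)) (≋-trans (∙-cong {C = P} F.PA≋TP (λ _ _ → refl)) (∙-assoc F.T F.P P))))
    ; lower    = F.lower
    ; diagonal = F.diagonal
    }
    where
    module F = LowerTriangularForm form
    cancel : ∀ W X Y Z → X ∙ Y ≋ I → W ∙ Z ≋ I → (W ∙ X) ∙ (Y ∙ Z) ≋ I
    cancel W X Y Z XY≋I WZ≋I = ≋-trans (∙-assoc W X (Y ∙ Z)) (≋-trans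
      (∙-cong {A = W} (λ _ _ → refl) (≋-trans (≋-sym (∙-assoc X Y Z)) (≋-trans (∙-cong {C = Z} XY≋I (λ _ _ → refl)) (∙-identityˡ Z))))
      WZ≋I)

  charPoly-border : ∀ {n} a (w : Vector Carrier n) X x → charPoly (border a w X) x ≈ (x - a) * charPoly X x
  charPoly-border {n} a w X x = trans (det-first-row (characteristic (border a w X) x) λ q →
      trans (+-congʳ (trans (scalar-I x zero (suc q)) (zeroʳ x))) (-‿inverseʳ 0#))
    (*-cong (+-congʳ (trans (scalar-I {suc n} x zero zero) (*-identityʳ x)))
      (det-cong {n} λ p q → +-congʳ { - X p q} (trans (scalar-I x (suc p) (suc q)) (sym (scalar-I x p q)))))

  triangularise : ∀ {n} (A : Matrix n) λs → IsSpectrum A λs → LowerTriangularForm A λs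
  triangularise {zero}  A λs spec = record
    { P = λ () ; Q = λ () ; T = λ () ; PQ≋I = λ () ; QP≋I = λ () ; PA≋TP = λ () ; lower = λ { {()} } ; diagonal = λ () }
  -- At `x = λs zero` the product in `spec` contains the factor 0, so the characteristic matrix is
  -- singular there and has a left null vector.
  triangularise {suc n} A λs spec
    with det≈0⇒left-kernel (characteristic A (λs zero)) (trans (spec (λs zero)) (trans (*-congʳ (-‿inverseʳ _)) (zeroˡ _)))
  ... | v , v≉0 , v-kernel with invertible-with-first-row v v≉0
  ... | P , Q , P₀≈v , PQ≋I , QP≋I = similar-form {C = C} {P} {Q} PQ≋I QP≋I PA≋CP
        (border-form (triangularise B (λs ∘ suc) B-spec) (λs zero) w refl (λ _ → refl))
    where
    μ = λs zero
    PA = P ∙ A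
    C′ = PA ∙ Q
    w : Vector Carrier n
    w p = C′ (suc p) zero
    B : Matrix n
    B p q = C′ (suc p) (suc q)
    C = border μ w B
    -- The first row of `P` is a left eigenvector, so the first row of `P A Q` is `μ` times the
    -- first row of `P Q`, that is of the identity. This is the zero block of the border.
    PA₀ : ∀ q → PA zero q ≈ μ * v q
    PA₀ q = trans (sum-cong-≋ λ r → *-congʳ {A r q} (P₀≈v r)) (sym (x-y≈0⇒x≈y (trans (sym (∑-characteristicˡ v A μ q)) (v-kernel q))))
    C′₀ : ∀ q → C′ zero q ≈ μ * I zero q
    C′₀ q = begin
      ∑[ r < suc n ] (PA zero r * Q r q)      ≈⟨ sum-cong-≋ (λ r → trans (*-congʳ (trans (PA₀ r) (*-congˡ (sym (P₀≈v r))))) (*-assoc μ (P zero r) (Q r q))) ⟩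
      ∑[ r < suc n ] (μ * (P zero r * Q r q)) ≈⟨ *-distribˡ-sum μ (λ r → P zero r * Q r q) ⟨
      μ * (P ∙ Q) zero q                      ≈⟨ *-congˡ (PQ≋I zero q) ⟩
      μ * I zero q                            ∎
    C′≋C : C′ ≋ C
    C′≋C zero    zero    = trans (C′₀ zero) (*-identityʳ μ)
    C′≋C zero    (suc q) = trans (C′₀ (suc q)) (zeroʳ μ)
    C′≋C (suc p) zero    = refl
    C′≋C (suc p) (suc q) = refl
    PA≋CP : P ∙ A ≋ C ∙ P
    PA≋CP = ≋-trans (≋-sym (∙-identityʳ PA)) (≋-trans (∙-cong {A = PA} (λ _ _ → refl) (≋-sym QP≋I))
      (≋-trans (≋-sym (∙-assoc PA Q P)) (∙-cong {C = P} C′≋C (λ _ _ → refl))))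
    -- Both sides agree after multiplication by `x - μ`, hence for all `x` other than `μ`, hence
    -- everywhere as polynomial functions.
    B-spec : IsSpectrum B (λs ∘ suc)
    B-spec = polynomial-identity (charPoly-polynomial B)
      (∏-polynomial λ a → +-polynomial id-polynomial (const-polynomial (- λs (suc a)))) μ
      λ x x≉μ → *-cancelˡ-nonZero (x≉μ ∘ x-y≈0⇒x≈y) (begin
        (x - μ) * charPoly B x                            ≈⟨ charPoly-border μ w B x ⟨
        charPoly C x                                      ≈⟨ charPoly-similar {A = A} {C} {P} {Q} PQ≋I PA≋CP x ⟨
        charPoly A x                                      ≈⟨ spec x ⟩
        (x - μ) * ∏[ a < n ] (x - λs (suc a))             ∎)

-- Square roots of positive integers.

module SquareRoots {c ℓ₁ ℓ₂} (ℝ : CompleteOrderedField c ℓ₁ ℓ₂) where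
  open CompleteOrderedField ℝ hiding (zero; Carrier; _≈_)
  open OverReals ℝ
  open Field ℝ
  open Order ℝ
  open IsStrictTotalOrder isStrictTotalOrder using (irrefl) renaming (trans to <-trans)
  open SemiringMult semiring using (×1-homo-*)
  open IntegerSolver commutativeRing
  open import Relation.Binary.Reasoning.Setoid setoid

  pos⇒≉0 : ∀ {x} → 0# < x → ¬ (x ≈ 0#)
  pos⇒≉0 0<x x≈0 = irrefl (sym x≈0) 0<x

  +-pos : ∀ {x y} → 0# < x → 0# ≤ y → 0# < x + y
  +-pos {x} {y} 0<x (inj₁ 0<y) = <-trans 0<y (<-respˡ-≈ (+-identityˡ y) (+-monoˡ-< y 0<x))
  +-pos {x} {y} 0<x (inj₂ 0≈y) = <-respʳ-≈ (trans (sym (+-identityʳ x)) (+-congˡ 0≈y)) 0<x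

  nonneg∧≉0⇒pos : ∀ {x} → 0# ≤ x → ¬ (x ≈ 0#) → 0# < x
  nonneg∧≉0⇒pos (inj₁ 0<x) x≉0 = 0<x
  nonneg∧≉0⇒pos (inj₂ 0≈x) x≉0 = contradiction (sym 0≈x) x≉0

  fromℕ-nonneg : ∀ n → 0# ≤ fromℕ n
  fromℕ-nonneg zero    = inj₂ refl
  fromℕ-nonneg (suc n) = inj₁ (+-pos 0<1 (fromℕ-nonneg n))

  fromℕ-pos : ∀ {n} → 0 ℕ.< n → 0# < fromℕ n
  fromℕ-pos {suc n} _ = +-pos 0<1 (fromℕ-nonneg n)

  √-pos : ∀ {x} → 0# < x → 0# < √ x
  √-pos 0<x = nonneg∧≉0⇒pos (√-nonneg (inj₁ 0<x)) λ √x≈0 →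
    pos⇒≉0 0<x (trans (sym (√-square (inj₁ 0<x))) (trans (*-congʳ √x≈0) (zeroˡ _)))

  square-injective : ∀ {x y} → 0# < x → 0# < y → x * x ≈ y * y → x ≈ y
  square-injective {x} {y} 0<x 0<y x²≈y² =
    [ (λ x+y≈0 → contradiction x+y≈0 (pos⇒≉0 (+-pos 0<x (inj₁ 0<y)))) , x-y≈0⇒x≈y ]′ (x*y≈0⇒x≈0∨y≈0 product≈0)
    where
    product≈0 : (x + y) * (x - y) ≈ 0#
    product≈0 = begin
      (x + y) * (x - y)  ≈⟨ [x+y]*[x-y]≈x*x-y*y x y ⟩
      x * x - y * y      ≈⟨ +-congʳ x²≈y² ⟩
      y * y - y * y      ≈⟨ -‿inverseʳ _ ⟩
      0#                 ∎

  -- Both sides are positive with equal squares. The lemma separates the joint normalisation of a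
  -- weight into a row factor and a column factor, as conjugation by a diagonal matrix requires.
  √-fromℕ-* : ∀ {m n} → 0 ℕ.< m → 0 ℕ.< n → √ (fromℕ (m ℕ.* n)) ≈ √ (fromℕ m) * √ (fromℕ n)
  √-fromℕ-* {m} {n} 0<m 0<n = square-injective (√-pos 0<mn) (*-pos (√-pos (fromℕ-pos 0<m)) (√-pos (fromℕ-pos 0<n))) (begin
    √ (fromℕ (m ℕ.* n)) * √ (fromℕ (m ℕ.* n))                       ≈⟨ √-square (inj₁ 0<mn) ⟩
    fromℕ (m ℕ.* n)                                                 ≈⟨ ×1-homo-* m n ⟩
    fromℕ m * fromℕ n                                               ≈⟨ *-cong (√-square (fromℕ-nonneg m)) (√-square (fromℕ-nonneg n)) ⟨
    √ (fromℕ m) * √ (fromℕ m) * (√ (fromℕ n) * √ (fromℕ n))         ≈⟨ solve 2 (λ x y → x :* x :* (y :* y) := x :* y :* (x :* y)) refl (√ (fromℕ m)) (√ (fromℕ n)) ⟩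
    √ (fromℕ m) * √ (fromℕ n) * (√ (fromℕ m) * √ (fromℕ n))         ∎)
    where
    0<mn : 0# < fromℕ (m ℕ.* n)
    0<mn = fromℕ-pos (ℕ.*-mono-≤ 0<m 0<n)

-- Symmetric powers of matrices.

module SymmetricPowers {c ℓ₁ ℓ₂} (ℝ : CompleteOrderedField c ℓ₁ ℓ₂) where
  open CompleteOrderedField ℝ hiding (zero; Carrier; _≈_)
  open OverReals ℝ hiding (∑ₗ-cong)
  open Matrices ℝ
  open Rearrangements
  open FiniteSums commutativeSemiring hiding (∑ₗ)
  open SemiringSum semiring using (sum-cong-≋; ∑-comm; *-distribˡ-sum; *-distribʳ-sum)
  open CommutativeMonoidSum *-commutativeMonoid using () renaming (sum-cong-≋ to ∏-cong)
  open IntegerSolver commutativeRing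
  open import Relation.Binary.Reasoning.Setoid setoid

  -- An entry of the k-fold Kronecker power of `A`.
  tensor : ∀ {n k} → Matrix n → Tuple n k → Tuple n k → Carrier
  tensor {k = k} A p q = ∏[ l < k ] A (lookup p l) (lookup q l)

  -- The coordinate at `i` of the image, under the Kronecker power, of the sum of the basis tensors
  -- in the orbit of `j`.
  orbitSum : ∀ {n k} → Matrix n → Tuple n k → Tuple n k → Carrier
  orbitSum A i j = ∑ₗ (Orb j) (tensor A i)

  orbitSum≈∑ₜ : ∀ {n k} A (i j : Tuple n k) → orbitSum A i j ≈ ∑ₜ n k (λ q → [ q ↭? j ]? * tensor A i q)
  orbitSum≈∑ₜ {n} {k} A i j = trans (∑ₗ-↭ (Orb-↭ₗ j) (tensor A i)) (∑ₗ-filter (_↭? j) (tuples n k) (tensor A i))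

  -- The Kronecker power maps symmetric tensors to symmetric tensors. The weight `f` is arbitrary
  -- because a common prefix `x` is absorbed into it: the induction is applied to
  -- `f (b ∷ q) * A x b`.
  ∑ₜ-*-tensor-↭ : ∀ {n k} A (f : Tuple n k → Carrier) → (∀ {q q′} → q ↭ q′ → f q ≈ f q′) →
    ∀ {r r′} → r ↭ r′ → ∑ₜ n k (λ q → f q * tensor A r q) ≈ ∑ₜ n k (λ q → f q * tensor A r′ q)
  ∑ₜ-*-tensor-↭ A f f-sym ↭-refl = refl
  ∑ₜ-*-tensor-↭ A f f-sym (↭-trans p q) = trans (∑ₜ-*-tensor-↭ A f f-sym p) (∑ₜ-*-tensor-↭ A f f-sym q)
  ∑ₜ-*-tensor-↭ {n} {suc k} A f f-sym (↭-prep x {r} {r′} p) = begin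
    ∑ₜ n (suc k) (λ q → f q * tensor A (x ∷ r) q)                  ≈⟨ ∑ₜ-suc k (λ q → f q * tensor A (x ∷ r) q) ⟩
    ∑[ b < n ] ∑ₜ n k (λ q → f (b ∷ q) * (A x b * tensor A r q))   ≈⟨ sum-cong-≋ (λ b → ∑ₗ-cong (tuples n k) λ q → *-assoc (f (b ∷ q)) (A x b) (tensor A r q)) ⟨
    ∑[ b < n ] ∑ₜ n k (λ q → f (b ∷ q) * A x b * tensor A r q)     ≈⟨ sum-cong-≋ (λ b → ∑ₜ-*-tensor-↭ A (λ q → f (b ∷ q) * A x b) (λ q↭q′ → *-congʳ (f-sym (↭-prep b q↭q′))) p) ⟩
    ∑[ b < n ] ∑ₜ n k (λ q → f (b ∷ q) * A x b * tensor A r′ q)    ≈⟨ sum-cong-≋ (λ b → ∑ₗ-cong (tuples n k) λ q → *-assoc (f (b ∷ q)) (A x b) (tensor A r′ q)) ⟩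
    ∑[ b < n ] ∑ₜ n k (λ q → f (b ∷ q) * (A x b * tensor A r′ q))  ≈⟨ ∑ₜ-suc k (λ q → f q * tensor A (x ∷ r′) q) ⟨
    ∑ₜ n (suc k) (λ q → f q * tensor A (x ∷ r′) q)                 ∎
  ∑ₜ-*-tensor-↭ {n} {suc (suc k)} A f f-sym (↭-swap x y {r}) = begin
    ∑ₜ n (2 ℕ.+ k) (λ q → f q * tensor A (x ∷ y ∷ r) q)
      ≈⟨ two-steps x y ⟩
    ∑[ b < n ] ∑[ c < n ] ∑ₜ n k (λ q → f (b ∷ c ∷ q) * (A x b * (A y c * tensor A r q)))
      ≈⟨ sum-cong-≋ (λ b → sum-cong-≋ λ c → ∑ₗ-cong (tuples n k) λ q → *-cong (f-sym (↭-swap b c {q}))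
           (solve 3 (λ a b t → a :* (b :* t) := b :* (a :* t)) refl (A x b) (A y c) (tensor A r q))) ⟩
    ∑[ b < n ] ∑[ c < n ] ∑ₜ n k (λ q → f (c ∷ b ∷ q) * (A y c * (A x b * tensor A r q)))
      ≈⟨ ∑-comm (λ b c → ∑ₜ n k (λ q → f (c ∷ b ∷ q) * (A y c * (A x b * tensor A r q)))) ⟩
    ∑[ c < n ] ∑[ b < n ] ∑ₜ n k (λ q → f (c ∷ b ∷ q) * (A y c * (A x b * tensor A r q)))
      ≈⟨ two-steps y x ⟨
    ∑ₜ n (2 ℕ.+ k) (λ q → f q * tensor A (y ∷ x ∷ r) q) ∎
    where
    two-steps : ∀ x y → ∑ₜ n (2 ℕ.+ k) (λ q → f q * tensor A (x ∷ y ∷ r) q) ≈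
      ∑[ b < n ] ∑[ c < n ] ∑ₜ n k (λ q → f (b ∷ c ∷ q) * (A x b * (A y c * tensor A r q)))
    two-steps x y = trans (∑ₜ-suc (suc k) (λ q → f q * tensor A (x ∷ y ∷ r) q))
      (sum-cong-≋ λ b → ∑ₜ-suc k (λ q → f (b ∷ q) * (A x b * tensor A (y ∷ r) q)))

  orbitSum-↭ : ∀ {n k} A (j : Tuple n k) {r r′} → r ↭ r′ → orbitSum A r j ≈ orbitSum A r′ j
  orbitSum-↭ A j {r} {r′} p = trans (orbitSum≈∑ₜ A r j) (trans
    (∑ₜ-*-tensor-↭ A (λ q → [ q ↭? j ]?) (λ {q} {q′} q↭q′ → []?-⇔ (q ↭? j) (q′ ↭? j) (↭-trans (↭-sym q↭q′)) (↭-trans q↭q′)) p)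
    (sym (orbitSum≈∑ₜ A r′ j)))

  tensor-∙ : ∀ {n k} A B (p q : Tuple n k) → tensor (A ∙ B) p q ≈ ∑ₜ n k (λ r → tensor A p r * tensor B r q)
  tensor-∙ A B [] [] = sym (trans (+-identityʳ _) (*-identityˡ 1#))
  tensor-∙ {n} {suc k} A B (x ∷ p) (y ∷ q) = begin
    (A ∙ B) x y * tensor (A ∙ B) p q
      ≈⟨ *-congˡ (tensor-∙ A B p q) ⟩
    (A ∙ B) x y * ∑ₜ n k AB
      ≈⟨ *-distribʳ-sum (∑ₜ n k AB) (λ b → A x b * B b y) ⟩
    ∑[ b < n ] (A x b * B b y * ∑ₜ n k AB)
      ≈⟨ sum-cong-≋ (λ b → trans (*-distribˡ-sum (A x b * B b y) (λ a → AB (List.lookup (tuples n k) a)))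
           (∑ₗ-cong (tuples n k) λ r → solve 4 (λ a b s t → a :* b :* (s :* t) := a :* s :* (b :* t)) refl (A x b) (B b y) (tensor A p r) (tensor B r q))) ⟩
    ∑[ b < n ] ∑ₜ n k (λ r → A x b * tensor A p r * (B b y * tensor B r q))
      ≈⟨ ∑ₜ-suc k (λ r → tensor A (x ∷ p) r * tensor B r (y ∷ q)) ⟨
    ∑ₜ n (suc k) (λ r → tensor A (x ∷ p) r * tensor B r (y ∷ q)) ∎
    where
    AB : Tuple n k → Carrier
    AB r = tensor A p r * tensor B r q

  -- A partition of unity on tuples, expressing that each orbit has exactly one vertex.
  ∑-representatives : ∀ {n k} (r : Tuple n k) → ∑ₗ (vertices n k) (λ m → [ r ↭? m ]?) ≈ 1#
  ∑-representatives {n} {k} r = begin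
    ∑ₗ (vertices n k) (λ m → [ r ↭? m ]?)        ≈⟨ ∑ₗ-cong (vertices n k) (λ m → *-identityʳ [ r ↭? m ]?) ⟨
    ∑ₗ (vertices n k) (λ m → [ r ↭? m ]? * 1#)   ≈⟨ ∑ₗ-filter (r ↭?_) (vertices n k) (const 1#) ⟨
    ∑ₗ (filter (r ↭?_) (vertices n k)) (const 1#) ≈⟨ ∑ₗ-↭ (representative-↭ₗ r) (const 1#) ⟩
    1# + 0#                                      ≈⟨ +-identityʳ 1# ⟩
    1#                                           ∎

  -- Multiplying Kronecker powers sums over all intermediate tuples `r`. The second factor depends
  -- only on the orbit of `r`, so the terms can be collected at the vertices `m`, where the first
  -- factors add up to `orbitSum A i m`.
  orbitSum-∙ : ∀ {n k} A B (i j : Tuple n k) →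
               orbitSum (A ∙ B) i j ≈ ∑ₗ (vertices n k) (λ m → orbitSum A i m * orbitSum B m j)
  orbitSum-∙ {n} {k} A B i j = begin
    orbitSum (A ∙ B) i j
      ≈⟨ orbitSum≈∑ₜ (A ∙ B) i j ⟩
    ∑ₗ T (λ q → [ q ↭? j ]? * tensor (A ∙ B) i q)
      ≈⟨ ∑ₗ-cong T (λ q → trans (*-congˡ (tensor-∙ A B i q)) (*-distribˡ-∑ₗ [ q ↭? j ]? T (λ r → tensor A i r * tensor B r q))) ⟩
    ∑ₗ T (λ q → ∑ₗ T λ r → [ q ↭? j ]? * (tensor A i r * tensor B r q))
      ≈⟨ ∑ₗ-comm T T (λ q r → [ q ↭? j ]? * (tensor A i r * tensor B r q)) ⟩
    ∑ₗ T (λ r → ∑ₗ T λ q → [ q ↭? j ]? * (tensor A i r * tensor B r q))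
      ≈⟨ ∑ₗ-cong T (λ r → trans (∑ₗ-cong T λ q → solve 3 (λ e a b → e :* (a :* b) := a :* (e :* b)) refl [ q ↭? j ]? (tensor A i r) (tensor B r q))
           (sym (*-distribˡ-∑ₗ (tensor A i r) T (λ q → [ q ↭? j ]? * tensor B r q)))) ⟩
    ∑ₗ T (λ r → tensor A i r * ∑ₗ T λ q → [ q ↭? j ]? * tensor B r q)
      ≈⟨ ∑ₗ-cong T (λ r → *-congˡ {tensor A i r} (orbitSum≈∑ₜ B r j)) ⟨
    ∑ₗ T (λ r → tensor A i r * orbitSum B r j)
      -- A factor 1 is inserted as the partition of unity over the vertices.
      ≈⟨ ∑ₗ-cong T (λ r → trans (*-congʳ {tensor A i r * orbitSum B r j} (∑-representatives r)) (*-identityˡ _)) ⟨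
    ∑ₗ T (λ r → ∑ₗ V (λ m → [ r ↭? m ]?) * (tensor A i r * orbitSum B r j))
      ≈⟨ ∑ₗ-cong T (λ r → *-distribʳ-∑ₗ (tensor A i r * orbitSum B r j) V (λ m → [ r ↭? m ]?)) ⟩
    ∑ₗ T (λ r → ∑ₗ V λ m → [ r ↭? m ]? * (tensor A i r * orbitSum B r j))
      ≈⟨ ∑ₗ-comm T V (λ r m → [ r ↭? m ]? * (tensor A i r * orbitSum B r j)) ⟩
    ∑ₗ V (λ m → ∑ₗ T λ r → [ r ↭? m ]? * (tensor A i r * orbitSum B r j))
      -- Under the bracket `r` is a rearrangement of `m` and may be replaced by it as row index of
      -- `B`.
      ≈⟨ ∑ₗ-cong V (λ m → ∑ₗ-cong T λ r → trans ([]?-*-cong (r ↭? m) (λ r↭m → *-congˡ {tensor A i r} (orbitSum-↭ B j r↭m))) (sym (*-assoc _ _ _))) ⟩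
    ∑ₗ V (λ m → ∑ₗ T λ r → [ r ↭? m ]? * tensor A i r * orbitSum B m j)
      ≈⟨ ∑ₗ-cong V (λ m → *-distribʳ-∑ₗ (orbitSum B m j) T (λ r → [ r ↭? m ]? * tensor A i r)) ⟨
    ∑ₗ V (λ m → ∑ₗ T (λ r → [ r ↭? m ]? * tensor A i r) * orbitSum B m j)
      ≈⟨ ∑ₗ-cong V (λ m → *-congʳ {orbitSum B m j} (orbitSum≈∑ₜ A i m)) ⟨
    ∑ₗ V (λ m → orbitSum A i m * orbitSum B m j) ∎
    where
    T = tuples n k
    V = vertices n k

  symmetricPower : ∀ {n} k → Matrix n → Matrix (order n k)
  symmetricPower {n} k A a b = orbitSum A (vertex n k a) (vertex n k b)

  symmetricPower-∙ : ∀ {n} k (A B : Matrix n) → symmetricPower k (A ∙ B) ≋ symmetricPower k A ∙ symmetricPower k B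
  symmetricPower-∙ {n} k A B a b = orbitSum-∙ A B (vertex n k a) (vertex n k b)

  symmetricPower-cong : ∀ {n} k {A B : Matrix n} → A ≋ B → symmetricPower k A ≋ symmetricPower k B
  symmetricPower-cong {n} k A≋B a b = ∑ₗ-cong (Orb (vertex n k b)) λ q →
    ∏-cong {k} λ l → A≋B (lookup (vertex n k a) l) (lookup q l)

  module _ {n} {T : Matrix n} (lower : ∀ {p q} → p Fin.< q → T p q ≈ 0#) where

    tensor-exceeds : ∀ {k} (i q : Tuple n k) → (∃ λ l → lookup i l Fin.< lookup q l) → tensor T i q ≈ 0#
    tensor-exceeds i q (l , i<q) = ∏-zero l (lower i<q)

    -- Each rearrangement `q` of the later vertex exceeds the earlier one somewhere, and the factor
    -- of `T` at that position lies above the diagonal.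
    symmetricPower-lower : ∀ k {a b} → a Fin.< b → symmetricPower k T a b ≈ 0#
    symmetricPower-lower k {a} {b} a<b = ∑ₗ-zero (Orb (vertex n k b)) λ {q} q∈ →
      tensor-exceeds (vertex n k a) q (<ₗₑₓ⇒exceeds (vertex-nondecreasing n k b) (vertex-mono n k a<b) (∈-Orb⁻ q∈))

    symmetricPower-diagonal : ∀ k a → symmetricPower k T a a ≈ ∏[ l < k ] T (lookup (vertex n k a) l) (lookup (vertex n k a) l)
    symmetricPower-diagonal k a = ∑ₗ-single {f = tensor T (vertex n k a)} (DecUniqueₗ.deduplicate-! (Vec.≡-dec Fin._≟_) _) {vertex n k a} (∈-Orb⁺ ↭-refl)
      λ {q} q∈ q≢i → tensor-exceeds (vertex n k a) q (≢⇒exceeds (∈-Orb⁻ q∈) q≢i)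

  vertex-injective : ∀ n k {a b} → vertex n k a ≡ vertex n k b → a ≡ b
  vertex-injective n k {a} {b} eq with Fin.<-cmp a b
  ... | tri≈ _ a≡b _ = a≡b
  ... | tri< a<b _ _ = contradiction (≡.subst (_<ₗₑₓ vertex n k b) eq (vertex-mono n k a<b)) <ₗₑₓ-irrefl
  ... | tri> _ _ b<a = contradiction (≡.subst (vertex n k b <ₗₑₓ_) eq (vertex-mono n k b<a)) <ₗₑₓ-irrefl

  I-lower : ∀ {n} {p q : Fin n} → p Fin.< q → I p q ≈ 0#
  I-lower p<q = I-off-diagonal (Fin.<⇒≢ p<q)

  -- On the diagonal the identity is treated as a lower triangular matrix. Off it, a nonzero term
  -- would need `q` equal to the row vertex, putting two different nondecreasing tuples into one
  -- orbit.
  symmetricPower-I : ∀ {n} k → symmetricPower {n} k I ≋ I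
  symmetricPower-I {n} k a b with a Fin.≟ b
  ... | yes ≡.refl = trans (symmetricPower-diagonal I-lower k a)
    (trans (∏-ones λ l → I-diagonal (lookup (vertex n k a) l)) (sym (I-diagonal a)))
    where
    ∏-ones : ∀ {m} {f : Vector Carrier m} → (∀ l → f l ≈ 1#) → ∏[ l < m ] f l ≈ 1#
    ∏-ones {zero}  f≈1 = refl
    ∏-ones {suc m} f≈1 = trans (*-cong (f≈1 zero) (∏-ones (f≈1 ∘ suc))) (*-identityˡ 1#)
  ... | no  a≢b = trans (∑ₗ-zero (Orb j) different) (sym (I-off-diagonal a≢b))
    where
    i = vertex n k a
    j = vertex n k b
    different : ∀ {q} → q ∈ₗ Orb j → tensor I i q ≈ 0#
    different {q} q∈ with Fin.any? (λ l → ¬? (lookup i l Fin.≟ lookup q l))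
    ... | yes (l , i≢q) = ∏-zero l (I-off-diagonal i≢q)
    ... | no  i≡q = contradiction (vertex-injective n k (Nondecreasing-unique (vertex-nondecreasing n k a)
      (vertex-nondecreasing n k b) (≡.subst (_↭ j) (≡.sym (lookup-injective λ l →
        decidable-stable (lookup i l Fin.≟ lookup q l) λ i≢q → i≡q (l , i≢q))) (∈-Orb⁻ q∈)))) a≢b
      where
      lookup-injective : ∀ {m} {xs ys : Tuple n m} → (∀ l → lookup xs l ≡ lookup ys l) → xs ≡ ys
      lookup-injective {xs = xs} {ys} eq = ≡.trans (≡.sym (Vec.tabulate∘lookup xs)) (≡.trans (Vec.tabulate-cong eq) (Vec.tabulate∘lookup ys))

-- The spectrum of the symmetric tensor power.

module PowerSpectrum {c ℓ₁ ℓ₂} (ℝ : CompleteOrderedField c ℓ₁ ℓ₂) where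
  open CompleteOrderedField ℝ hiding (zero; Carrier; _≈_)
  open OverReals ℝ hiding (∑ₗ-cong)
  open Field ℝ
  open Matrices ℝ
  open Determinants ℝ
  open Triangularisation ℝ
  open SquareRoots ℝ
  open SymmetricPowers ℝ
  open Rearrangements
  open Multinomials using (multinomial≡length-Orb)
  open FiniteSums commutativeSemiring hiding (∑ₗ)
  open SemiringSum semiring using (sum-cong-≋; *-distribʳ-sum)
  open CommutativeMonoidSum *-commutativeMonoid using () renaming (sum-cong-≋ to ∏-cong)
  open IntegerSolver commutativeRing
  open import Relation.Binary.Reasoning.Setoid setoid

  ∑ₗ-const : ∀ {a} {A : Set a} (xs : List A) x → ∑ₗ xs (const x) ≈ fromℕ (List.length xs) * x
  ∑ₗ-const []       x = sym (zeroˡ x)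
  ∑ₗ-const (_ ∷ xs) x = trans (+-cong (sym (*-identityˡ x)) (∑ₗ-const xs x)) (sym (distribʳ x _ _))

  multinomial-pos : ∀ {n k} (i : Tuple n k) → 0 ℕ.< multinomial i
  multinomial-pos i = ≡.subst (0 ℕ.<_) (≡.sym (multinomial≡length-Orb i)) (nonEmpty (∈-Orb⁺ ↭-refl))
    where
    nonEmpty : ∀ {xs} → i ∈ₗ xs → 0 ℕ.< List.length xs
    nonEmpty (Anyₗ.here _)  = s≤s z≤n
    nonEmpty (Anyₗ.there _) = s≤s z≤n

  √multinomial : ∀ {n k} → Tuple n k → Carrier
  √multinomial i = √ (fromℕ (multinomial i))

  √multinomial≉0 : ∀ {n k} (i : Tuple n k) → ¬ (√multinomial i ≈ 0#)
  √multinomial≉0 i = pos⇒≉0 (√-pos (fromℕ-pos (multinomial-pos i)))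

  -- All `p` in the orbit of `i` give the same inner sum, so the double sum is the size of the orbit
  -- times `orbitSum`. That size is the square of `√multinomial i`, and one of its two roots cancels
  -- against the normalisation together with `√multinomial j`.
  tensorWeight-orbitSum : ∀ {n k} (G : Graph n) (i j : Tuple n k) →
    tensorWeight G i j * √multinomial j ≈ √multinomial i * orbitSum (adjacency G) i j
  tensorWeight-orbitSum G i j = begin
    w * ∑ₗ (Orb i) (λ p → orbitSum A p j) * e
      ≈⟨ *-congʳ (*-congˡ (trans (∑ₗ-cong-∈ (Orb i) λ p∈ → orbitSum-↭ A j {r′ = i} (∈-Orb⁻ p∈)) (∑ₗ-const (Orb i) s))) ⟩
    w * (fromℕ (List.length (Orb i)) * s) * e
      ≈⟨ *-congʳ (*-congˡ (*-congʳ (trans (reflexive (≡.cong fromℕ (≡.sym (multinomial≡length-Orb i))))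
           (sym (√-square (fromℕ-nonneg (multinomial i))))))) ⟩
    w * (d * d * s) * e
      ≈⟨ solve 4 (λ w d s e → w :* (d :* d :* s) :* e := w :* (d :* e) :* (d :* s)) refl w d s e ⟩
    w * (d * e) * (d * s)
      ≈⟨ *-congʳ (trans (*-congˡ (sym (√-fromℕ-* (multinomial-pos i) (multinomial-pos j)))) (⁻¹-inverseˡ x≉0)) ⟩
    1# * (d * s)
      ≈⟨ *-identityˡ _ ⟩
    d * s ∎
    where
    A = adjacency G
    s = orbitSum A i j
    d = √multinomial i
    e = √multinomial j
    w = (√ (fromℕ (multinomial i ℕ.* multinomial j))) ⁻¹
    x≉0 : ¬ (√ (fromℕ (multinomial i ℕ.* multinomial j)) ≈ 0#)
    x≉0 = pos⇒≉0 (√-pos (fromℕ-pos (ℕ.*-mono-≤ (multinomial-pos i) (multinomial-pos j))))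

  ∏≈0⇒factor≈0 : ∀ {n} (f : Vector Carrier n) → ∏[ a < n ] f a ≈ 0# → ∃ λ a → f a ≈ 0#
  ∏≈0⇒factor≈0 {zero}  f ∏≈0 = contradiction (sym ∏≈0) 0≉1
  ∏≈0⇒factor≈0 {suc n} f ∏≈0 with x*y≈0⇒x≈0∨y≈0 ∏≈0
  ... | inj₁ f₀≈0 = zero , f₀≈0
  ... | inj₂ ∏≈0′ with ∏≈0⇒factor≈0 (f ∘ suc) ∏≈0′
  ...   | a , fa≈0 = suc a , fa≈0

  module _ {n} (G : Graph n) {λs : Vector Carrier n} (spec : IsSpectrum (adjacency G) λs) where
    private A = adjacency G

    eigenvalue⇒root : ∀ {μ} → IsEigenvalue A μ → ∃ λ a → μ ≈ λs a
    eigenvalue⇒root {μ} (v , v≉0 , Av≈μv) = map₂ x-y≈0⇒x≈y (∏≈0⇒factor≈0 (λ a → μ - λs a) root)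
      where
      v-kernel : ∀ p → ∑[ q < n ] (characteristic A μ p q * v q) ≈ 0#
      v-kernel p = trans (∑-characteristicʳ A μ v p) (trans (+-congˡ (-‿cong (Av≈μv p))) (-‿inverseʳ (μ * v p)))
      root : ∏[ a < n ] (μ - λs a) ≈ 0#
      root = trans (sym (spec μ)) (right-kernel⇒zero det-alternating (characteristic A μ) v v≉0 v-kernel)

    -- A singular characteristic matrix yields a left eigenvector, and symmetry of the weights makes
    -- it a right one.
    root⇒eigenvalue : ∀ {μ} a → μ ≈ λs a → IsEigenvalue A μ
    root⇒eigenvalue {μ} a μ≈λ
      with det≈0⇒left-kernel (characteristic A μ) (trans (spec μ) (∏-zero a (trans (+-congʳ μ≈λ) (-‿inverseʳ _))))
    ... | v , v≉0 , v-kernel = v , v≉0 , λ q → begin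
      ∑[ p < n ] (A q p * v p)  ≈⟨ sum-cong-≋ (λ p → trans (*-congʳ (ω-sym G q p)) (*-comm _ _)) ⟩
      ∑[ p < n ] (v p * A p q)  ≈⟨ x-y≈0⇒x≈y (trans (sym (∑-characteristicˡ v A μ q)) (v-kernel q)) ⟨
      μ * v q                   ∎

  module _ {n} (G : Graph n) {λs : Vector Carrier n} (form : LowerTriangularForm (adjacency G) λs) (k : ℕ) where
    open LowerTriangularForm form
    A = adjacency G
    A⊙k = adjacency (G ⊙ k)
    N = order n k

    d d⁻¹ : Fin N → Carrier
    d a = √multinomial (vertex n k a)
    d⁻¹ a = d a ⁻¹

    -- With D the diagonal matrix of `d`, this is `tensorWeight-orbitSum` multiplied by the inverse
    -- of D on both sides.
    ⊙-similar : ∀ a b → d⁻¹ a * A⊙k a b ≈ symmetricPower k A a b * d⁻¹ b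
    ⊙-similar a b = begin
      d⁻¹ a * A⊙k a b                                   ≈⟨ *-identityʳ _ ⟨
      d⁻¹ a * A⊙k a b * 1#                              ≈⟨ *-congˡ (⁻¹-inverse (√multinomial≉0 (vertex n k b))) ⟨
      d⁻¹ a * A⊙k a b * (d b * d⁻¹ b)                   ≈⟨ solve 4 (λ e m d f → e :* m :* (d :* f) := e :* (m :* d) :* f) refl _ _ _ _ ⟩
      d⁻¹ a * (A⊙k a b * d b) * d⁻¹ b                   ≈⟨ *-congʳ (*-congˡ (tensorWeight-orbitSum G (vertex n k a) (vertex n k b))) ⟩
      d⁻¹ a * (d a * symmetricPower k A a b) * d⁻¹ b    ≈⟨ *-congʳ (trans (sym (*-assoc _ _ _)) (trans (*-congʳ (⁻¹-inverseˡ (√multinomial≉0 (vertex n k a)))) (*-identityˡ _))) ⟩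
      symmetricPower k A a b * d⁻¹ b                    ∎

    -- The composite of two changes of basis: the diagonal one leading from `A⊙k` to the symmetric
    -- power of `A`, then the symmetric power of `P`.
    R R⁻¹ : Matrix N
    R a b = symmetricPower k P a b * d⁻¹ b
    R⁻¹ a b = d a * symmetricPower k Q a b

    R∙R⁻¹≋I : R ∙ R⁻¹ ≋ I
    R∙R⁻¹≋I a b = begin
      ∑[ r < N ] (symmetricPower k P a r * d⁻¹ r * (d r * symmetricPower k Q r b))
        ≈⟨ sum-cong-≋ (λ r → trans (solve 4 (λ p e d q → p :* e :* (d :* q) := e :* d :* (p :* q)) refl (symmetricPower k P a r) (d⁻¹ r) (d r) (symmetricPower k Q r b))
             (trans (*-congʳ (⁻¹-inverseˡ (√multinomial≉0 (vertex n k r)))) (*-identityˡ _))) ⟩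
      (symmetricPower k P ∙ symmetricPower k Q) a b
        ≈⟨ symmetricPower-∙ k P Q a b ⟨
      symmetricPower k (P ∙ Q) a b
        ≈⟨ symmetricPower-cong k PQ≋I a b ⟩
      symmetricPower k I a b
        ≈⟨ symmetricPower-I k a b ⟩
      I a b ∎

    R∙A⊙k≋T∙R : R ∙ A⊙k ≋ symmetricPower k T ∙ R
    R∙A⊙k≋T∙R a b = begin
      ∑[ r < N ] (symmetricPower k P a r * d⁻¹ r * A⊙k r b)
        ≈⟨ sum-cong-≋ (λ r → trans (*-assoc _ _ _) (trans (*-congˡ (⊙-similar r b)) (sym (*-assoc _ _ _)))) ⟩
      ∑[ r < N ] (symmetricPower k P a r * symmetricPower k A r b * d⁻¹ b)
        ≈⟨ *-distribʳ-sum (d⁻¹ b) (λ r → symmetricPower k P a r * symmetricPower k A r b) ⟨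
      (symmetricPower k P ∙ symmetricPower k A) a b * d⁻¹ b
        ≈⟨ *-congʳ (trans (sym (symmetricPower-∙ k P A a b)) (trans (symmetricPower-cong k PA≋TP a b) (symmetricPower-∙ k T P a b))) ⟩
      (symmetricPower k T ∙ symmetricPower k P) a b * d⁻¹ b
        ≈⟨ *-distribʳ-sum (d⁻¹ b) (λ r → symmetricPower k T a r * symmetricPower k P r b) ⟩
      ∑[ r < N ] (symmetricPower k T a r * symmetricPower k P r b * d⁻¹ b)
        ≈⟨ sum-cong-≋ (λ r → *-assoc (symmetricPower k T a r) (symmetricPower k P r b) (d⁻¹ b)) ⟩
      (symmetricPower k T ∙ R) a b ∎

    ⊙-spectrum : IsSpectrum A⊙k (λ a → tupleProduct λs (vertex n k a))
    ⊙-spectrum x = begin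
      charPoly A⊙k x                                        ≈⟨ charPoly-similar {A = A⊙k} {symmetricPower k T} {R} {R⁻¹} R∙R⁻¹≋I R∙A⊙k≋T∙R x ⟩
      charPoly (symmetricPower k T) x                       ≈⟨ charPoly-lower-triangular (symmetricPower k T) (symmetricPower-lower lower k) x ⟩
      ∏[ a < N ] (x - symmetricPower k T a a)               ≈⟨ ∏-cong {N} (λ a → +-congˡ (-‿cong (trans (symmetricPower-diagonal lower k a)
                                                                 (∏-cong {k} λ l → diagonal (lookup (vertex n k a) l))))) ⟩
      ∏[ a < N ] (x - tupleProduct λs (vertex n k a))       ∎

    ⊙-eigenvalue⇒ : ∀ {μ} → IsEigenvalue A⊙k μ → ∃ λ (i : Tuple n k) → Nondecreasing i × μ ≈ tupleProduct λs i
    ⊙-eigenvalue⇒ {μ} eigen = vertex n k (proj₁ root) , vertex-nondecreasing n k (proj₁ root) , proj₂ root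
      where
      root : ∃ λ a → μ ≈ tupleProduct λs (vertex n k a)
      root = eigenvalue⇒root (G ⊙ k) ⊙-spectrum eigen

    ⊙-eigenvalue⇐ : ∀ {μ} (i : Tuple n k) → Nondecreasing i → μ ≈ tupleProduct λs i → IsEigenvalue A⊙k μ
    ⊙-eigenvalue⇐ {μ} i i↗ μ≈ = root⇒eigenvalue (G ⊙ k) ⊙-spectrum (Anyₗ.index i∈)
      (≡.subst (λ j → μ ≈ tupleProduct λs j) (Anyₗ.lookup-index i∈) μ≈)
      where
      i∈ : i ∈ₗ vertices n k
      i∈ = ∈-vertices i↗

open import Data.Nat.Base using (_+_; _∸_)
open import Data.Nat.Combinatorics using (_C_)

theorem4p1 : ∀ {c ℓ₁ ℓ₂} (ℝ : CompleteOrderedField c ℓ₁ ℓ₂) →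
    let open OverReals ℝ in
    ∀ (n : ℕ) (G : Graph n) (λs : Vector Carrier n) →
    IsSpectrum (adjacency G) λs →
    ∀ (k : ℕ) .{{_ : NonZero k}} →
    order n k ≡ (n + k ∸ 1) C k
    × IsSpectrum (adjacency (G ⊙ k)) (λ a → tupleProduct λs (vertex n k a))
    × (∀ μ → IsEigenvalue (adjacency (G ⊙ k)) μ
    ⇔ ∃ λ (i : Tuple n k) → Nondecreasing i × μ ≈ tupleProduct λs i)
theorem4p1 ℝ n G λs spec (suc k) =
  -- Since the exponent is `suc k`, the subtraction in `n + suc k ∸ 1` takes off an actual successor
  -- and leaves `n + k`.
  ≡.trans (Rearrangements.order≡C n k) (≡.cong (λ m → (m ∸ 1) C suc k) (≡.sym (ℕ.+-suc n k))) ,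
  ⊙-spectrum G form (suc k) ,
  λ μ → mk⇔ (⊙-eigenvalue⇒ G form (suc k)) (λ (i , i↗ , μ≈) → ⊙-eigenvalue⇐ G form (suc k) i i↗ μ≈)
  where
  open PowerSpectrum ℝ
  form = Triangularisation.triangularise ℝ _ λs spec
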